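{- Let $f\in\mathbb{Z}[X]$ be a monic irreducible polynomial of degree $d\geq 2$ which is even, i.e. $f(-X)=f(X)$. For integers $N\geq 1$ put $L_f(N)=\operatorname{lcm}\{f(1),\ldots,f(N)\}$. Then there is a constant $C>0$ depending only on $f$ such that for all integers $N\geq 2$, \[ \log L_f(N)\;\geq\;\frac{2(d-1)}{d}\,N\log N - C N . \] -}

module Defs where

open import Data.Nat using (ℕ; zero; suc)
open import Data.Nat.LCM using (lcm)
open import Data.Integer using (ℤ; 0ℤ; 1ℤ; -1ℤ; _+_; _*_; -_; ∣_∣) renaming (+_ to pos)
open import Data.List using (List; []; _∷_; _++_; map; foldr; upTo; [_])
open import Data.Vec using (Vec; toList)
open import Data.Sum using (_⊎_)
open import Data.Product using (_×_)
open import Relation.Binary.PropositionalEquality using (_≡_)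
open import Relation.Nullary using (¬_)

-- Polynomials in ℤ[X] as lists of coefficients in ASCENDING order:
-- a₀ ∷ a₁ ∷ … represents a₀ + a₁ X + …  (trailing zeros allowed).
Poly : Set
Poly = List ℤ

coeff : Poly → ℕ → ℤ
coeff []       _       = 0ℤ
coeff (a ∷ p)  zero    = a
coeff (a ∷ p)  (suc i) = coeff p i

_≈ₚ_ : Poly → Poly → Set
p ≈ₚ q = ∀ i → coeff p i ≡ coeff q i

infix 4 _≈ₚ_

_+ₚ_ : Poly → Poly → Poly
[]      +ₚ q       = q
(a ∷ p) +ₚ []      = a ∷ p
(a ∷ p) +ₚ (b ∷ q) = (a + b) ∷ (p +ₚ q)

scale : ℤ → Poly → Poly
scale c = map (c *_)

_*ₚ_ : Poly → Poly → Poly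
[]      *ₚ q = []
(a ∷ p) *ₚ q = scale a q +ₚ (0ℤ ∷ (p *ₚ q))

eval : Poly → ℤ → ℤ
eval []      x = 0ℤ
eval (a ∷ p) x = a + x * eval p x

negX : Poly → Poly
negX []      = []
negX (a ∷ p) = a ∷ map -_ (negX p)

IsEven : Poly → Set
IsEven f = negX f ≈ₚ f

IsZero : Poly → Set
IsZero p = p ≈ₚ []

IsUnit : Poly → Set
IsUnit p = (p ≈ₚ [ 1ℤ ]) ⊎ (p ≈ₚ [ -1ℤ ])

Irreducible : Poly → Set
Irreducible f = ¬ IsZero f × ¬ IsUnit f
              × (∀ g h → f ≈ₚ (g *ₚ h) → IsUnit g ⊎ IsUnit h)

monic : ∀ {d} → Vec ℤ d → Poly
monic a = toList a ++ [ 1ℤ ]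

L : Poly → ℕ → ℕ
L f N = foldr lcm 1 (map (λ i → ∣ eval f (pos (suc i)) ∣) (upTo N))

module Submission where

-- Write w for the integers in [-N, N] and put M = 2N. Fix a nonzero integer D in the ideal (f, f′). If p ∤ D,
-- then all w in one class modulo p with p ∣ f(w) approximate the same p-adic root of f; so if w* is the one
-- with the largest valuation e, a w ≠ w* has at most the valuation of w − w*, and the class contributes at most
-- e + Σ_{k ≤ e} ⌊M / pᵏ⌋ to ∏ f(w). The pᵉ are residue moduli (pᵉ, X − w*) of ℤ[X]/(f), pairwise comaximal and
-- dividing L · f(0) (f is even, so negative w give nothing new); by the Chinese remainder theorem their product
-- is at most the size (L · |f(0)|)ᵈ of ℤ[X]/(f, L · f(0)).
--
-- For the rest, ∏ p^{Σ ⌊M / pᵏ⌋} ≤ (C M)^M, take M elements of the box [0, T)ᵈ in ℤ[X]/(f) with Tᵈ ≈ M. At least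
-- M ⌊M / q⌋ of the M² pairs coincide modulo (q, X − w*), by Cauchy–Schwarz. On the other hand, for one difference
-- γ ≠ 0 the product of all the moduli that it vanishes at is O(Tᵈ), again by the Chinese remainder theorem: division
-- with rounding by γ, which is invertible over ℚ since f is irreducible, shows that γ has O(Tᵈ) residues.
-- The diagonal pairs cost lcm(1, …, M)ᵈ and the primes dividing D cost Kᴺ. Finally ∏ f(w) ≥ N^{2dN} / Kᴺ.

-- The obstacle is the product of the p^{Σ ⌊M / pᵏ⌋} over all root classes. A prime p has as many
-- classes as f has roots modulo p, so bounding it by M! for each of up to d roots gives M^{dM}, as
-- large as the product of f itself. What is needed is that f has one root modulo p on average, in
-- effect Mertens' theorem for the degree-one prime ideals of ℚ[X]/(f). The box replaces that
-- analytic input. It is the analogue of bounding the primes of M! by the product of the differences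
-- of M integers: the M² differences have norms O(M), and every root class takes its share of them.
-- Exactly M elements are taken so that M / q measures both the points of the interval close to w*
-- and the forced collisions. The exponent is 2dN - 2N: the values give N^{2dN} and the box costs (C
-- N)^{2N}. Passing from [1, N] to [-N, N] doubles both terms, while L changes only by the factor
-- f(0); this is the source of the 2 in the theorem. Logarithms and norms are avoided throughout:
-- powers, products and counts of residues take their place.

open import Defs
open import Data.Nat
open import Data.Nat.Properties
open import Data.Nat.Divisibility
open import Data.Nat.DivMod using (m%n%n≡m%n; _%_; _/_; m%n<n; m≡m%n+[m/n]*n; m/n*n≡m; m<n*o⇒m/o<n)
open import Data.Nat.Coprimality using (Coprime; coprime-divisor; 1-coprimeTo) renaming (sym to coprime-sym)
open import Data.Nat.LCM using (lcm; m∣lcm[m,n]; n∣lcm[m,n]; lcm-least; gcd*lcm)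
open import Data.Nat.GCD using (gcd)
open import Data.Nat.Primality using (Prime; prime?; euclidsLemma; prime⇒nonZero; prime⇒nonTrivial; prime⇒irreducible; ¬prime[0]; ¬prime[1]; productOfPrimes≢0)
open import Data.Nat.Primality.Factorisation using (factorise)
open import Data.Nat.ListAction using (product)
open import Data.Nat.ListAction.Properties using (product-++)
open import Data.List.Relation.Unary.Unique.Propositional using (Unique)
import Data.List.Relation.Unary.Unique.Propositional.Properties as Uniqueₚ
open import Data.Nat.Combinatorics using (_C_; nCk+nC[k+1]≡[n+1]C[k+1]; nC1≡n; k![n∸k]!∣n!; nCk≡n!/k![n-k]!)
import Data.Nat.Tactic.RingSolver as ℕSolver
import Data.Integer.Tactic.RingSolver as ℤSolver
open import Data.Integer as ℤ using (ℤ; 0ℤ; 1ℤ; -1ℤ; ∣_∣) renaming (+_ to pos; _+_ to _+ℤ_; _*_ to _*ℤ_; _-_ to _-ℤ_; -_ to -ℤ_)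
import Data.Integer.Properties as ℤₚ
import Data.Integer.DivMod as ℤᵈ
open import Data.Integer.Divisibility.Signed as ℤ∣ using (divides) renaming (_∣_ to _∣ℤ_; _∣?_ to _∣ℤ?_)
open import Data.Empty using (⊥; ⊥-elim)
open import Data.Fin as Fin using (Fin; toℕ; fromℕ<; combine; remQuot; funToFin; finToFun)
import Data.Fin.Properties as Finₚ
open import Data.List using (List; []; _∷_; _++_; map; foldr; upTo; applyUpTo; length; [_]; cartesianProduct)
import Data.List.Properties as Listₚ
open import Data.List.Membership.Propositional using (_∈_)
open import Data.List.Membership.Propositional.Properties using (∈-map⁺; ∈-upTo⁺)
open import Data.List.Relation.Unary.All as All using (All; []; _∷_)
open import Data.List.Relation.Unary.Any using (here; there)
open import Data.List.Relation.Unary.AllPairs as AllPairs using (AllPairs; []; _∷_)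
open import Data.Vec as Vec using (Vec; toList)
import Data.Vec.Properties as Vecₚ
open import Data.Product using (Σ; ∃-syntax; _×_; _,_; proj₁; proj₂)
open import Data.Sum using (_⊎_; inj₁; inj₂)
open import Function using (it; _∘_; id)
open import Relation.Nullary using (Dec; yes; no; ¬_; contradiction)
open import Relation.Nullary.Decidable using (_×-dec_; ¬?)
open import Relation.Binary.PropositionalEquality hiding ([_])

-- Finite sums, products and counting

∑ : ℕ → (ℕ → ℕ) → ℕ
∑ zero    f = 0
∑ (suc n) f = f 0 + ∑ n (f ∘ suc)

∏ : ℕ → (ℕ → ℕ) → ℕ
∏ zero    f = 1
∏ (suc n) f = f 0 * ∏ n (f ∘ suc)

∑-mono : ∀ n {f g} → (∀ i → i < n → f i ≤ g i) → ∑ n f ≤ ∑ n g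
∑-mono zero    f≤g = z≤n
∑-mono (suc n) f≤g = +-mono-≤ (f≤g 0 z<s) (∑-mono n (λ i i<n → f≤g (suc i) (s<s i<n)))

∑-cong : ∀ n {f g} → (∀ i → i < n → f i ≡ g i) → ∑ n f ≡ ∑ n g
∑-cong zero    f≡g = refl
∑-cong (suc n) f≡g = cong₂ _+_ (f≡g 0 z<s) (∑-cong n (λ i i<n → f≡g (suc i) (s<s i<n)))

∑-+ : ∀ n f g → ∑ n (λ i → f i + g i) ≡ ∑ n f + ∑ n g
∑-+ zero    f g = refl
∑-+ (suc n) f g rewrite ∑-+ n (f ∘ suc) (g ∘ suc) = interchange (f 0) (g 0) _ _
  where
  interchange : ∀ a b c d → (a + b) + (c + d) ≡ (a + c) + (b + d)
  interchange = ℕSolver.solve-∀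

∑-* : ∀ n c f → ∑ n (λ i → c * f i) ≡ c * ∑ n f
∑-* zero    c f = sym (*-zeroʳ c)
∑-* (suc n) c f rewrite ∑-* n c (f ∘ suc) = sym (*-distribˡ-+ c (f 0) _)

∑-const : ∀ n c → ∑ n (λ _ → c) ≡ n * c
∑-const zero    c = refl
∑-const (suc n) c = cong (c +_) (∑-const n c)

∑-swap : ∀ m n (f : ℕ → ℕ → ℕ) → ∑ m (λ i → ∑ n (f i)) ≡ ∑ n (λ j → ∑ m (λ i → f i j))
∑-swap zero    n f = sym (trans (∑-const n 0) (*-zeroʳ n))
∑-swap (suc m) n f rewrite ∑-swap m n (f ∘ suc) = sym (∑-+ n (f 0) _)

∑-member : ∀ n f i → i < n → f i ≤ ∑ n f
∑-member (suc n) f zero    i<n       = m≤m+n (f 0) _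
∑-member (suc n) f (suc i) (s≤s i<n) = ≤-trans (∑-member n (f ∘ suc) i i<n) (m≤n+m _ (f 0))

∑-last : ∀ n f → ∑ (suc n) f ≡ ∑ n f + f n
∑-last zero    f = +-comm (f 0) 0
∑-last (suc n) f = trans (cong (f 0 +_) (∑-last n (f ∘ suc))) (sym (+-assoc (f 0) _ _))

∏-mono : ∀ n {f g} → (∀ i → i < n → f i ≤ g i) → ∏ n f ≤ ∏ n g
∏-mono zero    f≤g = ≤-refl
∏-mono (suc n) f≤g = *-mono-≤ (f≤g 0 z<s) (∏-mono n (λ i i<n → f≤g (suc i) (s<s i<n)))

∏-cong : ∀ n {f g} → (∀ i → i < n → f i ≡ g i) → ∏ n f ≡ ∏ n g
∏-cong zero    f≡g = refl
∏-cong (suc n) f≡g = cong₂ _*_ (f≡g 0 z<s) (∏-cong n (λ i i<n → f≡g (suc i) (s<s i<n)))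

∏-* : ∀ n f g → ∏ n (λ i → f i * g i) ≡ ∏ n f * ∏ n g
∏-* zero    f g = refl
∏-* (suc n) f g rewrite ∏-* n (f ∘ suc) (g ∘ suc) = interchange (f 0) (g 0) _ _
  where
  interchange : ∀ a b c d → (a * b) * (c * d) ≡ (a * c) * (b * d)
  interchange = ℕSolver.solve-∀

∏-const : ∀ n c → ∏ n (λ _ → c) ≡ c ^ n
∏-const zero    c = refl
∏-const (suc n) c = cong (c *_) (∏-const n c)

∏-swap : ∀ m n (f : ℕ → ℕ → ℕ) → ∏ m (λ i → ∏ n (f i)) ≡ ∏ n (λ j → ∏ m (λ i → f i j))
∏-swap zero    n f = sym (trans (∏-const n 1) (^-zeroˡ n))
∏-swap (suc m) n f rewrite ∏-swap m n (f ∘ suc) = sym (∏-* n (f 0) _)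

∏-last : ∀ n f → ∏ (suc n) f ≡ ∏ n f * f n
∏-last zero    f = *-comm (f 0) 1
∏-last (suc n) f = trans (cong (f 0 *_) (∏-last n (f ∘ suc))) (sym (*-assoc (f 0) _ _))

∏-append : ∀ m n f → ∏ (m + n) f ≡ ∏ m f * ∏ n (λ i → f (m + i))
∏-append zero    n f = sym (*-identityˡ _)
∏-append (suc m) n f = trans (cong (f 0 *_) (∏-append m n (f ∘ suc))) (sym (*-assoc (f 0) _ _))

^-∑ : ∀ c n f → c ^ ∑ n f ≡ ∏ n (λ i → c ^ f i)
^-∑ c zero    f = refl
^-∑ c (suc n) f = trans (^-distribˡ-+-* c (f 0) _) (cong (c ^ f 0 *_) (^-∑ c n (f ∘ suc)))

1≤^ : ∀ {b} → 1 ≤ b → ∀ n → 1 ≤ b ^ n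
1≤^ {b} 1≤b n = subst (_≤ b ^ n) (^-zeroˡ n) (^-monoˡ-≤ n 1≤b)

∏-≤1 : ∀ n f → (∀ i → f i ≤ 1) → ∏ n f ≤ 1
∏-≤1 n f f≤1 = subst (∏ n f ≤_) (trans (∏-const n 1) (^-zeroˡ n)) (∏-mono n (λ i _ → f≤1 i))

1≤∏ : ∀ n f → (∀ i → i < n → 1 ≤ f i) → 1 ≤ ∏ n f
1≤∏ n f 1≤f = subst (_≤ ∏ n f) (trans (∏-const n 1) (^-zeroˡ n)) (∏-mono n 1≤f)

-- For the primes dividing `D`: none exceeds `D`, so only the first `D` factors can differ from 1.
∏-few : ∀ n c b f → 1 ≤ b → (∀ i → f i ≤ b) → (∀ i → c ≤ i → f i ≤ 1) → ∏ n f ≤ b ^ c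
∏-few n       zero    b f 1≤b f≤b f≤1 = ∏-≤1 n f (λ i → f≤1 i z≤n)
∏-few zero    (suc c) b f 1≤b f≤b f≤1 = 1≤^ 1≤b (suc c)
∏-few (suc n) (suc c) b f 1≤b f≤b f≤1 =
  *-mono-≤ (f≤b 0) (∏-few n c b (f ∘ suc) 1≤b (f≤b ∘ suc) (λ i c≤i → f≤1 (suc i) (s≤s c≤i)))

∏-bump : ∀ n c i₀ f g → i₀ < n → (∀ i → f i ≤ g i) → c * f i₀ ≤ g i₀ → c * ∏ n f ≤ ∏ n g
∏-bump (suc n) c zero f g i₀<n f≤g cf≤g =
  subst (_≤ ∏ (suc n) g) (*-assoc c (f 0) _) (*-mono-≤ cf≤g (∏-mono n (λ i _ → f≤g (suc i))))
∏-bump (suc n) c (suc i₀) f g (s≤s i₀<n) f≤g cf≤g =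
  subst (_≤ ∏ (suc n) g) (rotate (f 0) c _) (*-mono-≤ (f≤g 0) (∏-bump n c i₀ (f ∘ suc) (g ∘ suc) i₀<n (f≤g ∘ suc) cf≤g))
  where
  rotate : ∀ a b c → a * (b * c) ≡ b * (a * c)
  rotate = ℕSolver.solve-∀

ind : {P : Set} → Dec P → ℕ
ind (yes _) = 1
ind (no  _) = 0

ind≤1 : {P : Set} (P? : Dec P) → ind P? ≤ 1
ind≤1 (yes _) = ≤-refl
ind≤1 (no  _) = z≤n

ind-yes : {P : Set} (P? : Dec P) → P → ind P? ≡ 1
ind-yes (yes _) p = refl
ind-yes (no ¬p) p = contradiction p ¬p

ind-no : {P : Set} (P? : Dec P) → ¬ P → ind P? ≡ 0
ind-no (yes p) ¬p = contradiction p ¬p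
ind-no (no _)  ¬p = refl

ind-mono : {P Q : Set} (P? : Dec P) (Q? : Dec Q) → (P → Q) → ind P? ≤ ind Q?
ind-mono (no _)  Q? P⇒Q = z≤n
ind-mono (yes p) Q? P⇒Q = ≤-reflexive (sym (ind-yes Q? (P⇒Q p)))

count : ∀ {P : ℕ → Set} → ℕ → (∀ i → Dec (P i)) → ℕ
count n P? = ∑ n (λ i → ind (P? i))

count≤n : ∀ {P : ℕ → Set} n (P? : ∀ i → Dec (P i)) → count n P? ≤ n
count≤n n P? = subst (count n P? ≤_) (trans (∑-const n 1) (*-identityʳ n)) (∑-mono n (λ i _ → ind≤1 (P? i)))

count-none : ∀ {P : ℕ → Set} n (P? : ∀ i → Dec (P i)) → (∀ i → ¬ P i) → count n P? ≡ 0
count-none n P? ¬P = trans (∑-cong n (λ i _ → ind-no (P? i) (¬P i))) (trans (∑-const n 0) (*-zeroʳ n))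

-- A downward closed predicate holds on an initial segment whose length is the count. This is how
-- `count` comes to serve as a valuation, as `small` and as `depth`.
count-holds : ∀ {P : ℕ → Set} n (P? : ∀ i → Dec (P i)) → (∀ i → P (suc i) → P i) →
              ∀ k → k < count n P? → P k
count-holds {P} (suc n) P? down k k<c with P? 0
... | no ¬p0 = contradiction (subst (k <_) (count-none n (P? ∘ suc) (¬P ∘ suc)) k<c) n≮0
  where
  ¬P : ∀ i → ¬ P i
  ¬P zero    = ¬p0
  ¬P (suc i) = ¬P i ∘ down i
count-holds (suc n) P? down zero    k<c       | yes p0 = p0
count-holds (suc n) P? down (suc k) (s≤s k<c) | yes p0 = count-holds n (P? ∘ suc) (down ∘ suc) k k<c

≤count : ∀ {P : ℕ → Set} n (P? : ∀ i → Dec (P i)) c → c ≤ n → (∀ k → k < c → P k) → c ≤ count n P?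
≤count n       P? zero    c≤n       P< = z≤n
≤count (suc n) P? (suc c) (s≤s c≤n) P< =
  +-mono-≤ (≤-reflexive (sym (ind-yes (P? 0) (P< 0 z<s))))
           (≤count n (P? ∘ suc) c c≤n (λ k k<c → P< (suc k) (s<s k<c)))

∑-pick : ∀ n y (g : ℕ → ℕ) → y < n → ∑ n (λ x → ind (y ≟ x) * g x) ≡ g y
∑-pick (suc n) zero g y<n = trans (cong₂ _+_ (*-identityˡ (g 0)) (trans (∑-cong n (λ i _ → cong (_* g (suc i)) (ind-no (0 ≟ suc i) λ ()))) (trans (∑-const n 0) (*-zeroʳ n)))) (+-identityʳ (g 0))
∑-pick (suc n) (suc y) g (s≤s y<n) = trans
  (cong₂ _+_ (cong (_* g 0) (ind-no (suc y ≟ 0) λ ()))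
     (∑-cong n (λ i _ → cong (_* g (suc i)) (same i))))
  (∑-pick n y (g ∘ suc) y<n)
  where
  same : ∀ i → ind (suc y ≟ suc i) ≡ ind (y ≟ i)
  same i with y ≟ i
  ... | yes refl = ind-yes (suc y ≟ suc y) refl
  ... | no  y≢i  = ind-no (suc y ≟ suc i) (y≢i ∘ suc-injective)

argmax : ∀ n (u : ℕ → ℕ) → ∃[ j ] (j < suc n × ∀ i → i < suc n → u i ≤ u j)
argmax zero u = 0 , z<s , λ { zero _ → ≤-refl ; (suc i) (s≤s ()) }
argmax (suc n) u with argmax n (u ∘ suc)
... | j , j<n , max with u 0 ≤? u (suc j)
...   | yes u0≤ = suc j , s<s j<n , λ { zero _ → u0≤ ; (suc i) (s≤s i<n) → max i i<n }
...   | no  u0≰ = 0 , z<s , λ { zero _ → ≤-refl ; (suc i) (s≤s i<n) → ≤-trans (max i i<n) (<⇒≤ (≰⇒> u0≰)) }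

-- Polynomials and the ring ℤ[X]/(f)

coeff-+ₚ : ∀ p q i → coeff (p +ₚ q) i ≡ coeff p i +ℤ coeff q i
coeff-+ₚ []      q       i       = sym (ℤₚ.+-identityˡ _)
coeff-+ₚ (a ∷ p) []      i       = sym (ℤₚ.+-identityʳ _)
coeff-+ₚ (a ∷ p) (b ∷ q) zero    = refl
coeff-+ₚ (a ∷ p) (b ∷ q) (suc i) = coeff-+ₚ p q i

coeff-scale : ∀ c p i → coeff (scale c p) i ≡ c *ℤ coeff p i
coeff-scale c []      i       = sym (ℤₚ.*-zeroʳ c)
coeff-scale c (a ∷ p) zero    = refl
coeff-scale c (a ∷ p) (suc i) = coeff-scale c p i

eval-+ₚ : ∀ p q x → eval (p +ₚ q) x ≡ eval p x +ℤ eval q x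
eval-+ₚ []      q       x = sym (ℤₚ.+-identityˡ _)
eval-+ₚ (a ∷ p) []      x = sym (ℤₚ.+-identityʳ _)
eval-+ₚ (a ∷ p) (b ∷ q) x rewrite eval-+ₚ p q x = regroup a b x (eval p x) (eval q x)
  where
  regroup : ∀ a b x P Q → (a +ℤ b) +ℤ x *ℤ (P +ℤ Q) ≡ (a +ℤ x *ℤ P) +ℤ (b +ℤ x *ℤ Q)
  regroup = ℤSolver.solve-∀

eval-scale : ∀ c p x → eval (scale c p) x ≡ c *ℤ eval p x
eval-scale c []      x = sym (ℤₚ.*-zeroʳ c)
eval-scale c (a ∷ p) x rewrite eval-scale c p x = regroup c a x (eval p x)
  where
  regroup : ∀ c a x P → c *ℤ a +ℤ x *ℤ (c *ℤ P) ≡ c *ℤ (a +ℤ x *ℤ P)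
  regroup = ℤSolver.solve-∀

eval-zero : ∀ p x → IsZero p → eval p x ≡ 0ℤ
eval-zero []      x p≈0 = refl
eval-zero (a ∷ p) x p≈0 rewrite p≈0 0 | eval-zero p x (p≈0 ∘ suc) = trans (ℤₚ.+-identityˡ _) (ℤₚ.*-zeroʳ x)

eval-≈ : ∀ p q x → p ≈ₚ q → eval p x ≡ eval q x
eval-≈ []      q       x p≈q = sym (eval-zero q x (sym ∘ p≈q))
eval-≈ (a ∷ p) []      x p≈q = eval-zero (a ∷ p) x p≈q
eval-≈ (a ∷ p) (b ∷ q) x p≈q = cong₂ (λ s t → s +ℤ x *ℤ t) (p≈q 0) (eval-≈ p q x (p≈q ∘ suc))

eval-map-neg : ∀ p x → eval (map -ℤ_ p) x ≡ -ℤ eval p x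
eval-map-neg []      x = refl
eval-map-neg (a ∷ p) x rewrite eval-map-neg p x = regroup a x (eval p x)
  where
  regroup : ∀ a x P → (-ℤ a) +ℤ x *ℤ (-ℤ P) ≡ -ℤ (a +ℤ x *ℤ P)
  regroup = ℤSolver.solve-∀

eval-negX : ∀ p x → eval (negX p) x ≡ eval p (-ℤ x)
eval-negX []      x = refl
eval-negX (a ∷ p) x rewrite eval-map-neg (negX p) x | eval-negX p x = regroup a x (eval p (-ℤ x))
  where
  regroup : ∀ a x P → a +ℤ x *ℤ (-ℤ P) ≡ a +ℤ (-ℤ x) *ℤ P
  regroup = ℤSolver.solve-∀

-- Elements of the quotient ring are functions rather than lists, so evaluation has to carry the
-- number of terms.
ev : ℕ → (ℕ → ℤ) → ℤ → ℤ
ev zero    v x = 0ℤ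
ev (suc k) v x = v 0 +ℤ x *ℤ ev k (v ∘ suc) x

ev-cong : ∀ k {v w} x → (∀ i → i < k → v i ≡ w i) → ev k v x ≡ ev k w x
ev-cong zero    x v≡w = refl
ev-cong (suc k) x v≡w = cong₂ (λ s t → s +ℤ x *ℤ t) (v≡w 0 z<s) (ev-cong k x (λ i i<k → v≡w (suc i) (s<s i<k)))

ev-lin : ∀ k a b v w x → ev k (λ i → a *ℤ v i +ℤ b *ℤ w i) x ≡ a *ℤ ev k v x +ℤ b *ℤ ev k w x
ev-lin zero    a b v w x = zeros a b
  where
  zeros : ∀ a b → 0ℤ ≡ a *ℤ 0ℤ +ℤ b *ℤ 0ℤ
  zeros = ℤSolver.solve-∀
ev-lin (suc k) a b v w x rewrite ev-lin k a b (v ∘ suc) (w ∘ suc) x = regroup a b (v 0) (w 0) x _ _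
  where
  regroup : ∀ a b s t x V W → a *ℤ s +ℤ b *ℤ t +ℤ x *ℤ (a *ℤ V +ℤ b *ℤ W) ≡ a *ℤ (s +ℤ x *ℤ V) +ℤ b *ℤ (t +ℤ x *ℤ W)
  regroup = ℤSolver.solve-∀

ev-last : ∀ k v x → ev (suc k) v x ≡ ev k v x +ℤ v k *ℤ x ℤ.^ k
ev-last zero    v x = regroup (v 0) x
  where
  regroup : ∀ s x → s +ℤ x *ℤ 0ℤ ≡ 0ℤ +ℤ s *ℤ 1ℤ
  regroup = ℤSolver.solve-∀
ev-last (suc k) v x rewrite ev-last k (v ∘ suc) x = regroup (v 0) x (ev k (v ∘ suc) x) (v (suc k)) (x ℤ.^ k)
  where
  regroup : ∀ s x E t X → s +ℤ x *ℤ (E +ℤ t *ℤ X) ≡ (s +ℤ x *ℤ E) +ℤ t *ℤ (x *ℤ X)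
  regroup = ℤSolver.solve-∀

ev-∣ : ∀ k m v x → (∀ i → i < k → m ∣ℤ v i) → m ∣ℤ ev k v x
ev-∣ zero    m v x m∣v = divides 0ℤ refl
ev-∣ (suc k) m v x m∣v = ℤ∣.∣m∣n⇒∣m+n (m∣v 0 z<s) (ℤ∣.∣n⇒∣m*n x (ev-∣ k m (v ∘ suc) x (λ i i<k → m∣v (suc i) (s<s i<k))))

eval≡ev : ∀ k p x → (∀ i → k ≤ i → coeff p i ≡ 0ℤ) → eval p x ≡ ev k (coeff p) x
eval≡ev zero    p       x high = eval-zero p x (λ i → high i z≤n)
eval≡ev (suc k) []      x high = sym (trans (ℤₚ.+-identityˡ _) (trans (cong (x *ℤ_) (sym (eval≡ev k [] x (λ _ _ → refl)))) (ℤₚ.*-zeroʳ x)))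
eval≡ev (suc k) (a ∷ p) x high = cong (λ t → a +ℤ x *ℤ t) (eval≡ev k p x (λ i k≤i → high (suc i) (s≤s k≤i)))

-- The quotient ring ℤ[X]/(f) for f monic of degree n + 1: its elements are the coefficient
-- functions vanishing beyond n, θ is multiplication by X, and act extends θ to ℤ[X].
module Quotient (f : Poly) (n : ℕ) (lead : coeff f (suc n) ≡ 1ℤ)
                (high : ∀ i → suc n < i → coeff f i ≡ 0ℤ) where

  θ : (ℕ → ℤ) → ℕ → ℤ
  θ v zero    = -ℤ (v n *ℤ coeff f 0)
  θ v (suc i) = v i -ℤ v n *ℤ coeff f (suc i)

  e₀ : ℕ → ℤ
  e₀ = coeff [ 1ℤ ]

  act : Poly → (ℕ → ℤ) → ℕ → ℤ
  act []      v i = 0ℤ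
  act (a ∷ p) v i = a *ℤ v i +ℤ θ (act p v) i

  Supported : (ℕ → ℤ) → Set
  Supported v = ∀ i → n < i → v i ≡ 0ℤ

  θ-cong : ∀ {v w} → v ≗ w → θ v ≗ θ w
  θ-cong v≗w zero    rewrite v≗w n = refl
  θ-cong v≗w (suc i) rewrite v≗w n | v≗w i = refl

  θ-lin : ∀ a b v w → θ (λ i → a *ℤ v i +ℤ b *ℤ w i) ≗ λ i → a *ℤ θ v i +ℤ b *ℤ θ w i
  θ-lin a b v w zero    = regroup a b (v n) (w n) (coeff f 0)
    where
    regroup : ∀ a b s t c → -ℤ ((a *ℤ s +ℤ b *ℤ t) *ℤ c) ≡ a *ℤ (-ℤ (s *ℤ c)) +ℤ b *ℤ (-ℤ (t *ℤ c))
    regroup = ℤSolver.solve-∀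
  θ-lin a b v w (suc i) = regroup a b (v n) (w n) (v i) (w i) (coeff f (suc i))
    where
    regroup : ∀ a b s t s′ t′ c → a *ℤ s′ +ℤ b *ℤ t′ -ℤ (a *ℤ s +ℤ b *ℤ t) *ℤ c
                                ≡ a *ℤ (s′ -ℤ s *ℤ c) +ℤ b *ℤ (t′ -ℤ t *ℤ c)
    regroup = ℤSolver.solve-∀

  θ-zero : ∀ {v} → (∀ i → v i ≡ 0ℤ) → ∀ i → θ v i ≡ 0ℤ
  θ-zero v≡0 zero    rewrite v≡0 n = refl
  θ-zero v≡0 (suc i) rewrite v≡0 n | v≡0 i = refl

  act-cong : ∀ p {v w} → v ≗ w → act p v ≗ act p w
  act-cong []      v≗w i = refl
  act-cong (a ∷ p) v≗w i = cong₂ (λ s t → a *ℤ s +ℤ t) (v≗w i) (θ-cong (act-cong p v≗w) i)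

  act-lin : ∀ p a b v w → act p (λ i → a *ℤ v i +ℤ b *ℤ w i) ≗ λ i → a *ℤ act p v i +ℤ b *ℤ act p w i
  act-lin []      a b v w i = zeros a b
    where
    zeros : ∀ a b → 0ℤ ≡ a *ℤ 0ℤ +ℤ b *ℤ 0ℤ
    zeros = ℤSolver.solve-∀
  act-lin (c ∷ p) a b v w i
    rewrite θ-cong (act-lin p a b v w) i | θ-lin a b (act p v) (act p w) i
    = regroup c a b (v i) (w i) (θ (act p v) i) (θ (act p w) i)
    where
    regroup : ∀ c a b s t S T → c *ℤ (a *ℤ s +ℤ b *ℤ t) +ℤ (a *ℤ S +ℤ b *ℤ T)
                              ≡ a *ℤ (c *ℤ s +ℤ S) +ℤ b *ℤ (c *ℤ t +ℤ T)
    regroup = ℤSolver.solve-∀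

  act-scaled : ∀ p c v → act p (λ i → c *ℤ v i) ≗ λ i → c *ℤ act p v i
  act-scaled p c v i = trans (act-cong p (λ i → pad c (v i)) i)
    (trans (act-lin p c 0ℤ v v i) (sym (pad c (act p v i))))
    where
    pad : ∀ c s → c *ℤ s ≡ c *ℤ s +ℤ 0ℤ *ℤ s
    pad = ℤSolver.solve-∀

  act-θ : ∀ p v → act p (θ v) ≗ θ (act p v)
  act-θ []      v i = sym (θ-zero (λ _ → refl) i)
  act-θ (a ∷ p) v i = begin
    a *ℤ θ v i +ℤ θ (act p (θ v)) i           ≡⟨ cong (a *ℤ θ v i +ℤ_) (θ-cong (act-θ p v) i) ⟩
    a *ℤ θ v i +ℤ θ (θ (act p v)) i           ≡⟨ cong (a *ℤ θ v i +ℤ_) (sym (ℤₚ.*-identityˡ (θ (θ (act p v)) i))) ⟩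
    a *ℤ θ v i +ℤ 1ℤ *ℤ θ (θ (act p v)) i     ≡⟨ sym (θ-lin a 1ℤ v (θ (act p v)) i) ⟩
    θ (λ i → a *ℤ v i +ℤ 1ℤ *ℤ θ (act p v) i) i ≡⟨ θ-cong (λ i → cong (a *ℤ v i +ℤ_) (ℤₚ.*-identityˡ (θ (act p v) i))) i ⟩
    θ (act (a ∷ p) v) i                       ∎
    where open ≡-Reasoning

  act-comm : ∀ p q v → act p (act q v) ≗ act q (act p v)
  act-comm []      q v i = sym (trans (act-cong q (λ _ → refl) i) (trans (act-scaled q 0ℤ v i) refl))
  act-comm (a ∷ p) q v i = begin
    a *ℤ act q v i +ℤ θ (act p (act q v)) i     ≡⟨ cong (a *ℤ act q v i +ℤ_) (θ-cong (act-comm p q v) i) ⟩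
    a *ℤ act q v i +ℤ θ (act q (act p v)) i     ≡⟨ cong (a *ℤ act q v i +ℤ_) (sym (trans (ℤₚ.*-identityˡ (act q (θ (act p v)) i)) (act-θ q (act p v) i))) ⟩
    a *ℤ act q v i +ℤ 1ℤ *ℤ act q (θ (act p v)) i ≡⟨ sym (act-lin q a 1ℤ v (θ (act p v)) i) ⟩
    act q (λ i → a *ℤ v i +ℤ 1ℤ *ℤ θ (act p v) i) i ≡⟨ act-cong q (λ i → cong (a *ℤ v i +ℤ_) (ℤₚ.*-identityˡ (θ (act p v) i))) i ⟩
    act q (act (a ∷ p) v) i                     ∎
    where open ≡-Reasoning

  act-+ₚ : ∀ p q v i → act (p +ₚ q) v i ≡ act p v i +ℤ act q v i
  act-+ₚ []      q       v i = sym (ℤₚ.+-identityˡ _)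
  act-+ₚ (a ∷ p) []      v i = sym (ℤₚ.+-identityʳ _)
  act-+ₚ (a ∷ p) (b ∷ q) v i = begin
    (a +ℤ b) *ℤ v i +ℤ θ (act (p +ₚ q) v) i                  ≡⟨ cong ((a +ℤ b) *ℤ v i +ℤ_) (θ-cong (λ i → trans (act-+ₚ p q v i) (ones (act p v i) (act q v i))) i) ⟩
    (a +ℤ b) *ℤ v i +ℤ θ (λ i → 1ℤ *ℤ act p v i +ℤ 1ℤ *ℤ act q v i) i ≡⟨ cong ((a +ℤ b) *ℤ v i +ℤ_) (θ-lin 1ℤ 1ℤ (act p v) (act q v) i) ⟩
    (a +ℤ b) *ℤ v i +ℤ (1ℤ *ℤ θ (act p v) i +ℤ 1ℤ *ℤ θ (act q v) i) ≡⟨ regroup a b (v i) (θ (act p v) i) (θ (act q v) i) ⟩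
    act (a ∷ p) v i +ℤ act (b ∷ q) v i                       ∎
    where
    open ≡-Reasoning
    ones : ∀ s t → s +ℤ t ≡ 1ℤ *ℤ s +ℤ 1ℤ *ℤ t
    ones = ℤSolver.solve-∀
    regroup : ∀ a b s S T → (a +ℤ b) *ℤ s +ℤ (1ℤ *ℤ S +ℤ 1ℤ *ℤ T) ≡ (a *ℤ s +ℤ S) +ℤ (b *ℤ s +ℤ T)
    regroup = ℤSolver.solve-∀

  act-scale : ∀ c p v i → act (scale c p) v i ≡ c *ℤ act p v i
  act-scale c []      v i = sym (ℤₚ.*-zeroʳ c)
  act-scale c (a ∷ p) v i = begin
    (c *ℤ a) *ℤ v i +ℤ θ (act (scale c p) v) i ≡⟨ cong ((c *ℤ a) *ℤ v i +ℤ_) (θ-cong (λ i → trans (act-scale c p v i) (pad c (act p v i))) i) ⟩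
    (c *ℤ a) *ℤ v i +ℤ θ (λ i → c *ℤ act p v i +ℤ 0ℤ *ℤ act p v i) i ≡⟨ cong ((c *ℤ a) *ℤ v i +ℤ_) (θ-lin c 0ℤ (act p v) (act p v) i) ⟩
    (c *ℤ a) *ℤ v i +ℤ (c *ℤ θ (act p v) i +ℤ 0ℤ *ℤ θ (act p v) i) ≡⟨ regroup c a (v i) (θ (act p v) i) ⟩
    c *ℤ act (a ∷ p) v i ∎
    where
    open ≡-Reasoning
    pad : ∀ c s → c *ℤ s ≡ c *ℤ s +ℤ 0ℤ *ℤ s
    pad = ℤSolver.solve-∀
    regroup : ∀ c a s S → (c *ℤ a) *ℤ s +ℤ (c *ℤ S +ℤ 0ℤ *ℤ S) ≡ c *ℤ (a *ℤ s +ℤ S)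
    regroup = ℤSolver.solve-∀

  act-*ₚ : ∀ p q v → act (p *ₚ q) v ≗ act p (act q v)
  act-*ₚ []      q v i = refl
  act-*ₚ (a ∷ p) q v i = trans (act-+ₚ (scale a q) (0ℤ ∷ (p *ₚ q)) v i)
    (cong₂ _+ℤ_ (act-scale a q v i) (trans (ℤₚ.+-identityˡ (θ (act (p *ₚ q) v) i)) (θ-cong (act-*ₚ p q v) i)))

  act-zero : ∀ p v → IsZero p → ∀ i → act p v i ≡ 0ℤ
  act-zero []      v p≈0 i = refl
  act-zero (a ∷ p) v p≈0 i rewrite p≈0 0 = trans (ℤₚ.+-identityˡ _) (θ-zero (act-zero p v (p≈0 ∘ suc)) i)

  act-≈ : ∀ p q v → p ≈ₚ q → act p v ≗ act q v
  act-≈ []      q       v p≈q i = sym (act-zero q v (sym ∘ p≈q) i)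
  act-≈ (a ∷ p) []      v p≈q i = act-zero (a ∷ p) v p≈q i
  act-≈ (a ∷ p) (b ∷ q) v p≈q i = cong₂ (λ s t → s *ℤ v i +ℤ t) (p≈q 0) (θ-cong (act-≈ p q v (p≈q ∘ suc)) i)

  act-coeff : ∀ p → Supported (coeff p) → act p e₀ ≗ coeff p
  act-coeff []      p-supp i = refl
  act-coeff (a ∷ p) p-supp zero
    rewrite θ-cong (act-coeff p (λ i n<i → p-supp (suc i) (m<n⇒m<1+n n<i))) 0 | p-supp (suc n) ≤-refl = unit a
    where
    unit : ∀ a → a *ℤ 1ℤ +ℤ 0ℤ ≡ a
    unit = ℤSolver.solve-∀
  act-coeff (a ∷ p) p-supp (suc i)
    rewrite θ-cong (act-coeff p (λ i n<i → p-supp (suc i) (m<n⇒m<1+n n<i))) (suc i) | p-supp (suc n) ≤-refl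
    = unit a (coeff p i)
    where
    unit : ∀ a s → a *ℤ 0ℤ +ℤ (s +ℤ 0ℤ) ≡ s
    unit = ℤSolver.solve-∀

  -- Write f = c + X g. Then g is its own remainder, and `θ` folds its leading coefficient 1 back as
  -- minus the lower coefficients of f, cancelling c and the shift of g.
  act-f : ∀ i → act f e₀ i ≡ 0ℤ
  act-f = kills f (λ _ → refl)
    where
    -- `f` is a parameter and admits no case split; a list `g` with the same coefficients does.
    kills : ∀ g → f ≈ₚ g → ∀ i → act g e₀ i ≡ 0ℤ
    kills [] f≈g i = refl
    kills (c ∷ g) f≈g zero
      rewrite θ-cong (act-coeff g (λ i n<i → trans (sym (f≈g (suc i))) (high (suc i) (s<s n<i)))) 0
            | sym (f≈g (suc n)) | lead | f≈g 0 = cancel c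
      where
      cancel : ∀ a → a *ℤ 1ℤ +ℤ -ℤ (1ℤ *ℤ a) ≡ 0ℤ
      cancel = ℤSolver.solve-∀
    kills (c ∷ g) f≈g (suc i)
      rewrite θ-cong (act-coeff g (λ i n<i → trans (sym (f≈g (suc i))) (high (suc i) (s<s n<i)))) (suc i)
            | sym (f≈g (suc n)) | lead | f≈g (suc i) = cancel c (coeff g i)
      where
      cancel : ∀ a s → a *ℤ 0ℤ +ℤ (s -ℤ 1ℤ *ℤ s) ≡ 0ℤ
      cancel = ℤSolver.solve-∀

  ⟦_⟧ : (ℕ → ℤ) → ℤ → ℤ
  ⟦ v ⟧ x = ev (suc n) v x

  ⟦e₀⟧ : ∀ x → ⟦ e₀ ⟧ x ≡ 1ℤ
  ⟦e₀⟧ x = trans (sym (eval≡ev (suc n) [ 1ℤ ] x λ { zero () ; (suc i) _ → refl })) (unit x)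
    where
    unit : ∀ x → 1ℤ +ℤ x *ℤ 0ℤ ≡ 1ℤ
    unit = ℤSolver.solve-∀

  ⟦θ⟧ : ∀ v x → ⟦ θ v ⟧ x ≡ x *ℤ ⟦ v ⟧ x -ℤ v n *ℤ eval f x
  ⟦θ⟧ v x = begin
    -ℤ (v n *ℤ coeff f 0) +ℤ x *ℤ ev n (λ i → v i -ℤ v n *ℤ coeff f (suc i)) x
      ≡⟨ cong (λ t → -ℤ (v n *ℤ coeff f 0) +ℤ x *ℤ t)
           (trans (ev-cong n x (λ i _ → asLin (v i) (v n) (coeff f (suc i))))
                  (ev-lin n 1ℤ (-ℤ v n) v (coeff f ∘ suc) x)) ⟩
    -ℤ (v n *ℤ coeff f 0) +ℤ x *ℤ (1ℤ *ℤ ev n v x +ℤ (-ℤ v n) *ℤ ev n (coeff f ∘ suc) x)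
      ≡⟨ regroup (v n) (coeff f 0) x (ev n v x) (ev n (coeff f ∘ suc) x) (x ℤ.^ n) ⟩
    x *ℤ (ev n v x +ℤ v n *ℤ x ℤ.^ n) -ℤ v n *ℤ (coeff f 0 +ℤ x *ℤ (ev n (coeff f ∘ suc) x +ℤ 1ℤ *ℤ x ℤ.^ n))
      ≡⟨ cong₂ (λ s t → x *ℤ s -ℤ v n *ℤ t) (sym (ev-last n v x)) (sym f≡) ⟩
    x *ℤ ⟦ v ⟧ x -ℤ v n *ℤ eval f x ∎
    where
    open ≡-Reasoning
    asLin : ∀ s t c → s -ℤ t *ℤ c ≡ 1ℤ *ℤ s +ℤ (-ℤ t) *ℤ c
    asLin = ℤSolver.solve-∀
    regroup : ∀ t c x E A X → -ℤ (t *ℤ c) +ℤ x *ℤ (1ℤ *ℤ E +ℤ (-ℤ t) *ℤ A)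
            ≡ x *ℤ (E +ℤ t *ℤ X) -ℤ t *ℤ (c +ℤ x *ℤ (A +ℤ 1ℤ *ℤ X))
    regroup = ℤSolver.solve-∀
    f≡ : eval f x ≡ coeff f 0 +ℤ x *ℤ (ev n (coeff f ∘ suc) x +ℤ 1ℤ *ℤ x ℤ.^ n)
    f≡ = trans (eval≡ev (suc (suc n)) f x high)
      (cong (λ t → coeff f 0 +ℤ x *ℤ t) (trans (ev-last n (coeff f ∘ suc) x)
        (cong (λ t → ev n (coeff f ∘ suc) x +ℤ t *ℤ x ℤ.^ n) lead)))

  -- Evaluation at `x` is a ring homomorphism on ℤ[X]/(f) only modulo f(x): by `⟦θ⟧`, folding back
  -- the top coefficient costs a multiple of f(x).
  ⟦act⟧ : ∀ p v x → eval f x ∣ℤ ⟦ act p v ⟧ x -ℤ eval p x *ℤ ⟦ v ⟧ x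
  ⟦act⟧ [] v x = divides 0ℤ (trans (cong (_-ℤ 0ℤ *ℤ ⟦ v ⟧ x) (sym (eval≡ev (suc n) [] x λ _ _ → refl))) (zeros (⟦ v ⟧ x)))
    where
    zeros : ∀ s → 0ℤ -ℤ 0ℤ *ℤ s ≡ 0ℤ
    zeros = ℤSolver.solve-∀
  ⟦act⟧ (a ∷ p) v x with ⟦act⟧ p v x
  ... | divides k eq = divides (x *ℤ k -ℤ act p v n) (begin
    ⟦ act (a ∷ p) v ⟧ x -ℤ (a +ℤ x *ℤ eval p x) *ℤ ⟦ v ⟧ x
      ≡⟨ cong (_-ℤ (a +ℤ x *ℤ eval p x) *ℤ ⟦ v ⟧ x)
           (trans (ev-cong (suc n) x (λ i _ → cong (a *ℤ v i +ℤ_) (sym (ℤₚ.*-identityˡ (θ (act p v) i)))))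
                  (ev-lin (suc n) a 1ℤ v (θ (act p v)) x)) ⟩
    (a *ℤ ⟦ v ⟧ x +ℤ 1ℤ *ℤ ⟦ θ (act p v) ⟧ x) -ℤ (a +ℤ x *ℤ eval p x) *ℤ ⟦ v ⟧ x
      ≡⟨ cong (λ t → (a *ℤ ⟦ v ⟧ x +ℤ 1ℤ *ℤ t) -ℤ (a +ℤ x *ℤ eval p x) *ℤ ⟦ v ⟧ x) (⟦θ⟧ (act p v) x) ⟩
    (a *ℤ ⟦ v ⟧ x +ℤ 1ℤ *ℤ (x *ℤ ⟦ act p v ⟧ x -ℤ act p v n *ℤ eval f x)) -ℤ (a +ℤ x *ℤ eval p x) *ℤ ⟦ v ⟧ x
      ≡⟨ regroup a x (⟦ v ⟧ x) (⟦ act p v ⟧ x) (act p v n) (eval f x) (eval p x) ⟩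
    x *ℤ (⟦ act p v ⟧ x -ℤ eval p x *ℤ ⟦ v ⟧ x) -ℤ act p v n *ℤ eval f x
      ≡⟨ cong (λ t → x *ℤ t -ℤ act p v n *ℤ eval f x) eq ⟩
    x *ℤ (k *ℤ eval f x) -ℤ act p v n *ℤ eval f x
      ≡⟨ factor x k (act p v n) (eval f x) ⟩
    (x *ℤ k -ℤ act p v n) *ℤ eval f x ∎)
    where
    open ≡-Reasoning
    regroup : ∀ a x V A t F P → (a *ℤ V +ℤ 1ℤ *ℤ (x *ℤ A -ℤ t *ℤ F)) -ℤ (a +ℤ x *ℤ P) *ℤ V
                              ≡ x *ℤ (A -ℤ P *ℤ V) -ℤ t *ℤ F
    regroup = ℤSolver.solve-∀
    factor : ∀ x k t F → x *ℤ (k *ℤ F) -ℤ t *ℤ F ≡ (x *ℤ k -ℤ t) *ℤ F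
    factor = ℤSolver.solve-∀

-- Gauss's lemma and inversion modulo f

coeff-*ₚ-suc : ∀ a A B i → coeff ((a ∷ A) *ₚ B) (suc i) ≡ a *ℤ coeff B (suc i) +ℤ coeff (A *ₚ B) i
coeff-*ₚ-suc a A B i = trans (coeff-+ₚ (scale a B) (0ℤ ∷ (A *ₚ B)) (suc i))
  (cong (_+ℤ coeff (A *ₚ B) i) (coeff-scale a B (suc i)))

coeff-*ₚ-zero : ∀ A B → coeff (A *ₚ B) 0 ≡ coeff A 0 *ℤ coeff B 0
coeff-*ₚ-zero []      B = refl
coeff-*ₚ-zero (a ∷ A) B = trans (coeff-+ₚ (scale a B) (0ℤ ∷ (A *ₚ B)) 0)
  (trans (ℤₚ.+-identityʳ _) (coeff-scale a B 0))

-- `_*ₚ_` recurses on its left factor; this is the recursion on the right one, with which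
-- `gauss-unit` peels off the coefficients of `B`.
coeff-*ₚ-∷ʳ : ∀ A b B i → coeff (A *ₚ (b ∷ B)) (suc i) ≡ b *ℤ coeff A (suc i) +ℤ coeff (A *ₚ B) i
coeff-*ₚ-∷ʳ [] b B i = sym (trans (ℤₚ.+-identityʳ (b *ℤ 0ℤ)) (ℤₚ.*-zeroʳ b))
coeff-*ₚ-∷ʳ (a ∷ A) b B zero = begin
  coeff ((a ∷ A) *ₚ (b ∷ B)) 1                  ≡⟨ coeff-*ₚ-suc a A (b ∷ B) 0 ⟩
  a *ℤ coeff B 0 +ℤ coeff (A *ₚ (b ∷ B)) 0      ≡⟨ cong (a *ℤ coeff B 0 +ℤ_) (coeff-*ₚ-zero A (b ∷ B)) ⟩
  a *ℤ coeff B 0 +ℤ coeff A 0 *ℤ b              ≡⟨ regroup a (coeff B 0) (coeff A 0) b ⟩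
  b *ℤ coeff A 0 +ℤ a *ℤ coeff B 0              ≡⟨ cong (b *ℤ coeff A 0 +ℤ_) (sym (coeff-*ₚ-zero (a ∷ A) B)) ⟩
  b *ℤ coeff A 0 +ℤ coeff ((a ∷ A) *ₚ B) 0      ∎
  where
  open ≡-Reasoning
  regroup : ∀ a s t b → a *ℤ s +ℤ t *ℤ b ≡ b *ℤ t +ℤ a *ℤ s
  regroup = ℤSolver.solve-∀
coeff-*ₚ-∷ʳ (a ∷ A) b B (suc i) = begin
  coeff ((a ∷ A) *ₚ (b ∷ B)) (suc (suc i))      ≡⟨ coeff-*ₚ-suc a A (b ∷ B) (suc i) ⟩
  a *ℤ coeff B (suc i) +ℤ coeff (A *ₚ (b ∷ B)) (suc i)
                                                ≡⟨ cong (a *ℤ coeff B (suc i) +ℤ_) (coeff-*ₚ-∷ʳ A b B i) ⟩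
  a *ℤ coeff B (suc i) +ℤ (b *ℤ coeff A (suc i) +ℤ coeff (A *ₚ B) i)
                                                ≡⟨ regroup (a *ℤ coeff B (suc i)) (b *ℤ coeff A (suc i)) (coeff (A *ₚ B) i) ⟩
  b *ℤ coeff A (suc i) +ℤ (a *ℤ coeff B (suc i) +ℤ coeff (A *ₚ B) i)
                                                ≡⟨ cong (b *ℤ coeff A (suc i) +ℤ_) (sym (coeff-*ₚ-suc a A B i)) ⟩
  b *ℤ coeff A (suc i) +ℤ coeff ((a ∷ A) *ₚ B) (suc i) ∎
  where
  open ≡-Reasoning
  regroup : ∀ s t u → s +ℤ (t +ℤ u) ≡ t +ℤ (s +ℤ u)
  regroup = ℤSolver.solve-∀

coeff-scale-*ₚ : ∀ c A B i → coeff (scale c A *ₚ B) i ≡ c *ℤ coeff (A *ₚ B) i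
coeff-scale-*ₚ c []      B i = sym (ℤₚ.*-zeroʳ c)
coeff-scale-*ₚ c (a ∷ A) B zero = trans (coeff-*ₚ-zero (scale c (a ∷ A)) B)
  (trans (ℤₚ.*-assoc c a (coeff B 0)) (cong (c *ℤ_) (sym (coeff-*ₚ-zero (a ∷ A) B))))
coeff-scale-*ₚ c (a ∷ A) B (suc i) = begin
  coeff (scale c (a ∷ A) *ₚ B) (suc i)                        ≡⟨ coeff-*ₚ-suc (c *ℤ a) (scale c A) B i ⟩
  (c *ℤ a) *ℤ coeff B (suc i) +ℤ coeff (scale c A *ₚ B) i     ≡⟨ cong ((c *ℤ a) *ℤ coeff B (suc i) +ℤ_) (coeff-scale-*ₚ c A B i) ⟩
  (c *ℤ a) *ℤ coeff B (suc i) +ℤ c *ℤ coeff (A *ₚ B) i        ≡⟨ regroup c a (coeff B (suc i)) (coeff (A *ₚ B) i) ⟩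
  c *ℤ (a *ℤ coeff B (suc i) +ℤ coeff (A *ₚ B) i)             ≡⟨ cong (c *ℤ_) (sym (coeff-*ₚ-suc a A B i)) ⟩
  c *ℤ coeff ((a ∷ A) *ₚ B) (suc i)                           ∎
  where
  open ≡-Reasoning
  regroup : ∀ c a s t → (c *ℤ a) *ℤ s +ℤ c *ℤ t ≡ c *ℤ (a *ℤ s +ℤ t)
  regroup = ℤSolver.solve-∀

coeff-*ₚ-scale : ∀ c A B i → coeff (A *ₚ scale c B) i ≡ c *ℤ coeff (A *ₚ B) i
coeff-*ₚ-scale c []      B i = sym (ℤₚ.*-zeroʳ c)
coeff-*ₚ-scale c (a ∷ A) B zero rewrite coeff-*ₚ-zero (a ∷ A) (scale c B) | coeff-scale c B 0 | coeff-*ₚ-zero (a ∷ A) B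
  = regroup a c (coeff B 0)
  where
  regroup : ∀ a c s → a *ℤ (c *ℤ s) ≡ c *ℤ (a *ℤ s)
  regroup = ℤSolver.solve-∀
coeff-*ₚ-scale c (a ∷ A) B (suc i) rewrite coeff-*ₚ-suc a A (scale c B) i | coeff-*ₚ-suc a A B i
  | coeff-scale c B (suc i) | coeff-*ₚ-scale c A B i = regroup a c (coeff B (suc i)) (coeff (A *ₚ B) i)
  where
  regroup : ∀ a c s t → a *ℤ (c *ℤ s) +ℤ c *ℤ t ≡ c *ℤ (a *ℤ s +ℤ t)
  regroup = ℤSolver.solve-∀

*ₚ-zeroˡ : ∀ A B → IsZero A → IsZero (A *ₚ B)
*ₚ-zeroˡ []      B A≈0 i = refl
*ₚ-zeroˡ (a ∷ A) B A≈0 zero = trans (coeff-*ₚ-zero (a ∷ A) B) (trans (cong (_*ℤ coeff B 0) (A≈0 0)) refl)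
*ₚ-zeroˡ (a ∷ A) B A≈0 (suc i) = trans (coeff-*ₚ-suc a A B i)
  (cong₂ _+ℤ_ (cong (_*ℤ coeff B (suc i)) (A≈0 0)) (*ₚ-zeroˡ A B (A≈0 ∘ suc) i))

isZero? : ∀ p → Dec (IsZero p)
isZero? [] = yes λ _ → refl
isZero? (a ∷ p) with a ℤ.≟ 0ℤ | isZero? p
... | yes a≡0 | yes p≈0 = yes λ { zero → a≡0 ; (suc i) → p≈0 i }
... | no  a≢0 | _       = no λ z → a≢0 (z 0)
... | _       | no  p≉0 = no λ z → p≉0 (z ∘ suc)

∣-prime-*ℤ : ∀ {p} → Prime p → ∀ a b → pos p ∣ℤ a *ℤ b → pos p ∣ℤ a ⊎ pos p ∣ℤ b
∣-prime-*ℤ {p} p-prime a b p∣ab with euclidsLemma ∣ a ∣ ∣ b ∣ p-prime (subst (p ∣_) (ℤₚ.abs-* a b) (ℤ∣.∣⇒∣ᵤ p∣ab))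
... | inj₁ p∣a = inj₁ (ℤ∣.∣ᵤ⇒∣ p∣a)
... | inj₂ p∣b = inj₂ (ℤ∣.∣ᵤ⇒∣ p∣b)

_∣ₚ_ : ℕ → Poly → Set
p ∣ₚ A = ∀ i → pos p ∣ℤ coeff A i

∣ₚ-quotient : ∀ p A → p ∣ₚ A → ∃[ B ] A ≡ scale (pos p) B
∣ₚ-quotient p []      p∣A = [] , refl
∣ₚ-quotient p (a ∷ A) p∣A with p∣A 0 | ∣ₚ-quotient p A (p∣A ∘ suc)
... | divides q a≡qp | B , refl = (q ∷ B) , cong (_∷ map (pos p *ℤ_) B) (trans a≡qp (ℤₚ.*-comm q (pos p)))

-- Modulo `p` the polynomial `A` is a unit among power series, so the coefficients of `B` vanish one
-- after the other, starting from the constant one.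
gauss-unit : ∀ {p} → Prime p → ∀ A B → ¬ pos p ∣ℤ coeff A 0 → p ∣ₚ (A *ₚ B) → p ∣ₚ B
gauss-unit {p} p-prime A []      p∤a p∣AB i = divides 0ℤ refl
gauss-unit {p} p-prime A (b ∷ B) p∤a p∣AB = go
  where
  p∣b : pos p ∣ℤ b
  p∣b with ∣-prime-*ℤ p-prime (coeff A 0) b (subst (pos p ∣ℤ_) (coeff-*ₚ-zero A (b ∷ B)) (p∣AB 0))
  ... | inj₁ p∣a = contradiction p∣a p∤a
  ... | inj₂ p∣b = p∣b
  go : p ∣ₚ (b ∷ B)
  go zero    = p∣b
  go (suc i) = gauss-unit p-prime A B p∤a (λ j → ℤ∣.∣m+n∣m⇒∣n (subst (pos p ∣ℤ_) (coeff-*ₚ-∷ʳ A b B j) (p∣AB (suc j)))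
                 (ℤ∣.∣m⇒∣m*n (coeff A (suc j)) p∣b)) i

-- Low coefficients of the left factor divisible by `p` are stripped until one is a unit modulo `p`.
gauss : ∀ {p} → Prime p → ∀ A B → p ∣ₚ (A *ₚ B) → p ∣ₚ A ⊎ p ∣ₚ B
gauss p-prime []      B p∣AB = inj₁ λ _ → divides 0ℤ refl
gauss {p} p-prime (a ∷ A) B p∣AB with pos p ∣ℤ? a
... | no  p∤a = inj₂ (gauss-unit p-prime (a ∷ A) B p∤a p∣AB)
... | yes p∣a with gauss p-prime A B (λ i → ℤ∣.∣m+n∣m⇒∣n (subst (pos p ∣ℤ_) (coeff-*ₚ-suc a A B i) (p∣AB (suc i)))
                                              (ℤ∣.∣m⇒∣m*n (coeff B (suc i)) p∣a))
...   | inj₁ p∣A = inj₁ λ { zero → p∣a ; (suc i) → p∣A i }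
...   | inj₂ p∣B = inj₂ p∣B

prime-divisor : ∀ n → 2 ≤ n → ∃[ p ] (Prime p × p ∣ n)
prime-divisor n@(suc _) 2≤n with factorise n
... | record { factors = [] ; isFactorisation = n≡1 } = contradiction (subst (2 ≤_) n≡1 2≤n) λ { (s≤s ()) }
... | record { factors = p ∷ ps ; isFactorisation = n≡ ; factorsPrime = p-prime ∷ _ } =
  p , p-prime , subst (p ∣_) (sym n≡) (m∣m*n (product ps))

NonConstant : Poly → Set
NonConstant A = ¬ (∀ i → coeff A (suc i) ≡ 0ℤ)

unit⇒constant : ∀ A → IsUnit A → ∀ i → coeff A (suc i) ≡ 0ℤ
unit⇒constant A (inj₁ A≈1)  i = A≈1 (suc i)
unit⇒constant A (inj₂ A≈-1) i = A≈-1 (suc i)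

*ℤ-cancelˡ-zero : ∀ c x → c ≢ 0ℤ → c *ℤ x ≡ 0ℤ → x ≡ 0ℤ
*ℤ-cancelˡ-zero c x c≢0 cx≡0 with ℤₚ.i*j≡0⇒i≡0∨j≡0 c cx≡0
... | inj₁ c≡0 = contradiction c≡0 c≢0
... | inj₂ x≡0 = x≡0

nonConstant-scale : ∀ c A → NonConstant (scale c A) → NonConstant A
nonConstant-scale c A nc const = nc (λ i → trans (coeff-scale c A (suc i)) (trans (cong (c *ℤ_) (const i)) (ℤₚ.*-zeroʳ c)))

∣l∣≡1⇒l*l≡1 : ∀ l → ∣ l ∣ ≡ 1 → l *ℤ l ≡ 1ℤ
∣l∣≡1⇒l*l≡1 (ℤ.+_ .1) refl = refl
∣l∣≡1⇒l*l≡1 (ℤ.-[1+_] .0) refl = refl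

-- Gauss: an irreducible f stays irreducible over ℚ; prime factors of the denominator l are removed one by one.
no-rational-factor : ∀ f → Irreducible f → ∀ k m l → ∣ l ∣ ≡ m → m ≤ k → l ≢ 0ℤ → ∀ Q G →
                     scale l f ≈ₚ (Q *ₚ G) → NonConstant Q → NonConstant G → ⊥
no-rational-factor f f-irr k 0 l ∣l∣≡ m≤k l≢0 Q G lf≈QG Q-nc G-nc = l≢0 (ℤₚ.∣i∣≡0⇒i≡0 ∣l∣≡)
no-rational-factor f f-irr k 1 l ∣l∣≡ m≤k l≢0 Q G lf≈QG Q-nc G-nc
  with proj₂ (proj₂ f-irr) (scale l Q) G f≈
  where
  open ≡-Reasoning
  f≈ : f ≈ₚ (scale l Q *ₚ G)
  f≈ i = begin
    coeff f i                      ≡⟨ sym (ℤₚ.*-identityˡ _) ⟩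
    1ℤ *ℤ coeff f i                ≡⟨ cong (_*ℤ coeff f i) (sym (∣l∣≡1⇒l*l≡1 l ∣l∣≡)) ⟩
    (l *ℤ l) *ℤ coeff f i          ≡⟨ ℤₚ.*-assoc l l _ ⟩
    l *ℤ (l *ℤ coeff f i)          ≡⟨ cong (l *ℤ_) (trans (sym (coeff-scale l f i)) (lf≈QG i)) ⟩
    l *ℤ coeff (Q *ₚ G) i          ≡⟨ sym (coeff-scale-*ₚ l Q G i) ⟩
    coeff (scale l Q *ₚ G) i       ∎
... | inj₁ Q-unit = Q-nc (λ i → *ℤ-cancelˡ-zero l _ l≢0 (trans (sym (coeff-scale l Q (suc i))) (unit⇒constant (scale l Q) Q-unit i)))
... | inj₂ G-unit = G-nc (unit⇒constant G G-unit)
no-rational-factor f f-irr (suc k) (suc (suc l′)) l ∣l∣≡ (s≤s 1+l≤k) l≢0 Q G lf≈QG Q-nc G-nc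
  with prime-divisor (suc (suc l′)) (s≤s (s≤s z≤n))
... | p , p-prime , p∣∣l∣ with ℤ∣.∣ᵤ⇒∣ {pos p} {l} (subst (p ∣_) (sym ∣l∣≡) p∣∣l∣)
... | divides l₁ refl = split (gauss p-prime Q G p∣QG)
  where
  open ≡-Reasoning
  instance
    p≢0 : NonZero p
    p≢0 = prime⇒nonZero p-prime
  p∣QG : p ∣ₚ (Q *ₚ G)
  p∣QG i = subst (pos p ∣ℤ_) (trans (sym (coeff-scale (l₁ *ℤ pos p) f i)) (lf≈QG i))
    (ℤ∣.∣m⇒∣m*n (coeff f i) (divides l₁ refl))
  l₁≢0 : l₁ ≢ 0ℤ
  l₁≢0 refl = l≢0 refl
  ∣l₁∣≤k : ∣ l₁ ∣ ≤ k
  ∣l₁∣≤k = ≤-trans (≤-pred (≤-trans (m<m*n ∣ l₁ ∣ p {{ℤ.≢-nonZero l₁≢0}} (nonTrivial⇒n>1 p {{prime⇒nonTrivial p-prime}}))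
                     (≤-reflexive (trans (sym (ℤₚ.abs-* l₁ (pos p))) ∣l∣≡)))) 1+l≤k
  cancel : ∀ R → (∀ i → coeff (Q *ₚ G) i ≡ pos p *ℤ coeff R i) → scale l₁ f ≈ₚ R
  cancel R QG≡ i = ℤₚ.*-cancelˡ-≡ (pos p) _ _ (begin
    pos p *ℤ coeff (scale l₁ f) i      ≡⟨ cong (pos p *ℤ_) (coeff-scale l₁ f i) ⟩
    pos p *ℤ (l₁ *ℤ coeff f i)         ≡⟨ regroup (pos p) l₁ (coeff f i) ⟩
    (l₁ *ℤ pos p) *ℤ coeff f i         ≡⟨ sym (coeff-scale (l₁ *ℤ pos p) f i) ⟩
    coeff (scale (l₁ *ℤ pos p) f) i    ≡⟨ lf≈QG i ⟩
    coeff (Q *ₚ G) i                   ≡⟨ QG≡ i ⟩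
    pos p *ℤ coeff R i                 ∎)
    where
    regroup : ∀ p l s → p *ℤ (l *ℤ s) ≡ (l *ℤ p) *ℤ s
    regroup = ℤSolver.solve-∀
  split : p ∣ₚ Q ⊎ p ∣ₚ G → ⊥
  split (inj₁ p∣Q) with ∣ₚ-quotient p Q p∣Q
  ... | Q₁ , refl = no-rational-factor f f-irr k ∣ l₁ ∣ l₁ refl ∣l₁∣≤k l₁≢0 Q₁ G
        (cancel (Q₁ *ₚ G) (coeff-scale-*ₚ (pos p) Q₁ G)) (nonConstant-scale (pos p) Q₁ Q-nc) G-nc
  split (inj₂ p∣G) with ∣ₚ-quotient p G p∣G
  ... | G₁ , refl = no-rational-factor f f-irr k ∣ l₁ ∣ l₁ refl ∣l₁∣≤k l₁≢0 Q G₁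
        (cancel (Q *ₚ G₁) (coeff-*ₚ-scale (pos p) Q G₁)) Q-nc (nonConstant-scale (pos p) G₁ G-nc)

-- Division over ℚ with denominators cleared; `l` is a power of the leading coefficient of `G`. The
-- list is consumed from its top end: the old remainder is multiplied by X, and its new top
-- coefficient `u` is cancelled by a multiple of `G`.
pseudo-divide : ∀ G e → coeff G (suc e) ≢ 0ℤ → (∀ i → suc e < i → coeff G i ≡ 0ℤ) → ∀ p →
                ∃[ l ] ∃[ Q ] ∃[ r ] (l ≢ 0ℤ × (∀ i → e < i → coeff r i ≡ 0ℤ) × scale l p ≈ₚ ((Q *ₚ G) +ₚ r))
pseudo-divide G e t≢0 G-high [] = 1ℤ , [] , [] , (λ ()) , (λ _ _ → refl) , λ _ → refl
pseudo-divide G e t≢0 G-high (a ∷ p) with pseudo-divide G e t≢0 G-high p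
... | l , Q , r , l≢0 , r-high , lp≈ = t *ℤ l , u ∷ scale t Q , r′ , tl≢0 , r′-high , eq
  where
  open ≡-Reasoning
  t u : ℤ
  t = coeff G (suc e)
  u = coeff r e
  r′ : Poly
  r′ = scale t (l *ℤ a ∷ r) +ₚ scale (-ℤ u) G
  r′-coeff : ∀ i → coeff r′ i ≡ t *ℤ coeff (l *ℤ a ∷ r) i +ℤ (-ℤ u) *ℤ coeff G i
  r′-coeff i = trans (coeff-+ₚ (scale t (l *ℤ a ∷ r)) (scale (-ℤ u) G) i)
    (cong₂ _+ℤ_ (coeff-scale t (l *ℤ a ∷ r) i) (coeff-scale (-ℤ u) G i))
  tl≢0 : t *ℤ l ≢ 0ℤ
  tl≢0 tl≡0 = l≢0 (*ℤ-cancelˡ-zero t l t≢0 tl≡0)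
  r′-high : ∀ i → e < i → coeff r′ i ≡ 0ℤ
  r′-high (suc i) (s≤s e≤i) with m≤n⇒m<n∨m≡n e≤i
  ... | inj₂ refl = trans (r′-coeff (suc e)) (cancel t u)
    where
    cancel : ∀ t u → t *ℤ u +ℤ (-ℤ u) *ℤ t ≡ 0ℤ
    cancel = ℤSolver.solve-∀
  ... | inj₁ e<i = trans (r′-coeff (suc i)) (trans (cong₂ (λ s s′ → t *ℤ s +ℤ (-ℤ u) *ℤ s′) (r-high i e<i) (G-high (suc i) (s<s e<i))) (zeros t u))
    where
    zeros : ∀ t u → t *ℤ 0ℤ +ℤ (-ℤ u) *ℤ 0ℤ ≡ 0ℤ
    zeros = ℤSolver.solve-∀
  eq : scale (t *ℤ l) (a ∷ p) ≈ₚ (((u ∷ scale t Q) *ₚ G) +ₚ r′)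
  eq zero = sym (begin
    coeff (((u ∷ scale t Q) *ₚ G) +ₚ r′) 0             ≡⟨ coeff-+ₚ ((u ∷ scale t Q) *ₚ G) r′ 0 ⟩
    coeff ((u ∷ scale t Q) *ₚ G) 0 +ℤ coeff r′ 0       ≡⟨ cong₂ _+ℤ_ (coeff-*ₚ-zero (u ∷ scale t Q) G) (r′-coeff 0) ⟩
    u *ℤ coeff G 0 +ℤ (t *ℤ (l *ℤ a) +ℤ (-ℤ u) *ℤ coeff G 0) ≡⟨ regroup u (coeff G 0) t l a ⟩
    (t *ℤ l) *ℤ a                                      ∎)
    where
    regroup : ∀ u g t l a → u *ℤ g +ℤ (t *ℤ (l *ℤ a) +ℤ (-ℤ u) *ℤ g) ≡ (t *ℤ l) *ℤ a
    regroup = ℤSolver.solve-∀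
  eq (suc i) = sym (begin
    coeff (((u ∷ scale t Q) *ₚ G) +ₚ r′) (suc i)
      ≡⟨ coeff-+ₚ ((u ∷ scale t Q) *ₚ G) r′ (suc i) ⟩
    coeff ((u ∷ scale t Q) *ₚ G) (suc i) +ℤ coeff r′ (suc i)
      ≡⟨ cong₂ _+ℤ_ (trans (coeff-*ₚ-suc u (scale t Q) G i) (cong (u *ℤ coeff G (suc i) +ℤ_) (coeff-scale-*ₚ t Q G i))) (r′-coeff (suc i)) ⟩
    (u *ℤ coeff G (suc i) +ℤ t *ℤ coeff (Q *ₚ G) i) +ℤ (t *ℤ coeff r i +ℤ (-ℤ u) *ℤ coeff G (suc i))
      ≡⟨ regroup u (coeff G (suc i)) t (coeff (Q *ₚ G) i) (coeff r i) ⟩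
    t *ℤ (coeff (Q *ₚ G) i +ℤ coeff r i)
      ≡⟨ cong (t *ℤ_) (sym (trans (lp≈ i) (coeff-+ₚ (Q *ₚ G) r i))) ⟩
    t *ℤ coeff (scale l p) i
      ≡⟨ cong (t *ℤ_) (coeff-scale l p i) ⟩
    t *ℤ (l *ℤ coeff p i)
      ≡⟨ sym (ℤₚ.*-assoc t l (coeff p i)) ⟩
    (t *ℤ l) *ℤ coeff p i
      ≡⟨ sym (coeff-scale (t *ℤ l) p i) ⟩
    coeff (scale (t *ℤ l) p) i ∎)
    where
    regroup : ∀ u g t q r → (u *ℤ g +ℤ t *ℤ q) +ℤ (t *ℤ r +ℤ (-ℤ u) *ℤ g) ≡ t *ℤ (q +ℤ r)
    regroup = ℤSolver.solve-∀

-- Inverses modulo f by Euclid's algorithm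

module Inversion (f : Poly) (n : ℕ) (lead : coeff f (suc n) ≡ 1ℤ)
                 (high : ∀ i → suc n < i → coeff f i ≡ 0ℤ) (f-irr : Irreducible f) where

  open Quotient f n lead high public

  Invertible : ℕ → Set
  Invertible k = ∀ G → k ≤ suc n → (∀ i → k ≤ i → coeff G i ≡ 0ℤ) → ¬ IsZero G →
                 ∃[ V ] ∃[ c ] (c ≢ 0ℤ × act V (act G e₀) ≗ λ i → c *ℤ e₀ i)

  -- One step of Euclid's algorithm: from l f = Q G + r follows r ≡ - Q G modulo f, and r has
  -- smaller degree than G, so an inverse of r times - Q inverts G.
  invert-step : ∀ k → Invertible k → ∀ G → suc k ≤ suc n → (∀ i → suc k ≤ i → coeff G i ≡ 0ℤ) → coeff G k ≢ 0ℤ →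
                ∃[ V ] ∃[ c ] (c ≢ 0ℤ × act V (act G e₀) ≗ λ i → c *ℤ e₀ i)
  invert-step zero invert-k G k≤ G-high top≢0 = [ 1ℤ ] , coeff G 0 , top≢0 , eq
    where
    G-const : coeff G ≗ λ i → coeff G 0 *ℤ e₀ i
    G-const zero    = sym (ℤₚ.*-identityʳ _)
    G-const (suc i) = trans (G-high (suc i) (s≤s z≤n)) (sym (ℤₚ.*-zeroʳ (coeff G 0)))
    eq : act [ 1ℤ ] (act G e₀) ≗ λ i → coeff G 0 *ℤ e₀ i
    eq i = trans (cong₂ _+ℤ_ (ℤₚ.*-identityˡ (act G e₀ i)) (θ-zero {act [] (act G e₀)} (λ _ → refl) i))
      (trans (ℤₚ.+-identityʳ (act G e₀ i)) (trans (act-coeff G (λ i n<i → G-high i (≤-trans (s≤s z≤n) n<i)) i) (G-const i)))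
  invert-step (suc k) invert-k G k≤ G-high top≢0 with pseudo-divide G k top≢0 G-high f
  ... | l , Q , r , l≢0 , r-high , lf≈ with isZero? r
  -- Here l f = Q G would be a factorisation over ℚ. A constant Q is excluded by degrees: Q G would
  -- have no term of degree n + 1.
  ...   | yes r≈0 = ⊥-elim (no-rational-factor f f-irr ∣ l ∣ ∣ l ∣ l refl ≤-refl l≢0 Q G lf≈QG Q-nc (λ const → top≢0 (const k)))
    where
    lf≈QG : scale l f ≈ₚ (Q *ₚ G)
    lf≈QG i = trans (lf≈ i) (trans (coeff-+ₚ (Q *ₚ G) r i) (trans (cong (coeff (Q *ₚ G) i +ℤ_) (r≈0 i)) (ℤₚ.+-identityʳ _)))
    const⇒zero : ∀ Q → (∀ i → coeff Q (suc i) ≡ 0ℤ) → coeff (Q *ₚ G) (suc n) ≡ 0ℤ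
    const⇒zero []      const = refl
    const⇒zero (q ∷ Q) const = trans (coeff-*ₚ-suc q Q G n)
      (cong₂ _+ℤ_ (trans (cong (q *ℤ_) (G-high (suc n) k≤)) (ℤₚ.*-zeroʳ q)) (*ₚ-zeroˡ Q G const n))
    Q-nc : NonConstant Q
    Q-nc const = l≢0 (begin
      l                          ≡⟨ sym (ℤₚ.*-identityʳ l) ⟩
      l *ℤ 1ℤ                    ≡⟨ cong (l *ℤ_) (sym lead) ⟩
      l *ℤ coeff f (suc n)       ≡⟨ sym (coeff-scale l f (suc n)) ⟩
      coeff (scale l f) (suc n)  ≡⟨ lf≈QG (suc n) ⟩
      coeff (Q *ₚ G) (suc n)     ≡⟨ const⇒zero Q const ⟩
      0ℤ                         ∎)
      where open ≡-Reasoning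
  ...   | no r≉0 with invert-k r (<⇒≤ k≤) r-high r≉0
  ...     | V , c , c≢0 , Vr≡c = V *ₚ scale -1ℤ Q , c , c≢0 , λ i → trans (act-*ₚ V (scale -1ℤ Q) (act G e₀) i)
              (trans (act-cong V (λ i → trans (act-scale -1ℤ Q (act G e₀) i) (QG≡r i)) i) (Vr≡c i))
    where
    open ≡-Reasoning
    QG≡r : ∀ i → -1ℤ *ℤ act Q (act G e₀) i ≡ act r e₀ i
    QG≡r i = begin
      -1ℤ *ℤ act Q (act G e₀) i                                ≡⟨ regroup (act Q (act G e₀) i) (act r e₀ i) ⟩
      act r e₀ i -ℤ (act Q (act G e₀) i +ℤ act r e₀ i)         ≡⟨ cong (λ s → act r e₀ i -ℤ (s +ℤ act r e₀ i)) (sym (act-*ₚ Q G e₀ i)) ⟩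
      act r e₀ i -ℤ (act (Q *ₚ G) e₀ i +ℤ act r e₀ i)          ≡⟨ cong (λ t → act r e₀ i -ℤ t) (sym (act-+ₚ (Q *ₚ G) r e₀ i)) ⟩
      act r e₀ i -ℤ act ((Q *ₚ G) +ₚ r) e₀ i                   ≡⟨ cong (λ t → act r e₀ i -ℤ t) (sym (act-≈ (scale l f) ((Q *ₚ G) +ₚ r) e₀ lf≈ i)) ⟩
      act r e₀ i -ℤ act (scale l f) e₀ i                       ≡⟨ cong (λ t → act r e₀ i -ℤ t) (trans (act-scale l f e₀ i) (trans (cong (l *ℤ_) (act-f i)) (ℤₚ.*-zeroʳ l))) ⟩
      act r e₀ i -ℤ 0ℤ                                         ≡⟨ ℤₚ.+-identityʳ _ ⟩
      act r e₀ i                                               ∎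
      where
      regroup : ∀ q s → -1ℤ *ℤ q ≡ s -ℤ (q +ℤ s)
      regroup = ℤSolver.solve-∀

  invert : ∀ k → Invertible k
  invert zero    G k≤ G-high G≉0 = contradiction (λ i → G-high i z≤n) G≉0
  invert (suc k) G k≤ G-high G≉0 with coeff G k ℤ.≟ 0ℤ
  ... | yes top≡0 = invert k G (<⇒≤ k≤) lower G≉0
    where
    lower : ∀ i → k ≤ i → coeff G i ≡ 0ℤ
    lower i k≤i with m≤n⇒m<n∨m≡n k≤i
    ... | inj₁ k<i  = G-high i k<i
    ... | inj₂ refl = top≡0
  ... | no top≢0 = invert-step k (invert k) G k≤ G-high top≢0

  -- The relation V G = c of ℤ[X]/(f), specialised to an integer. It shows that f has no integer
  -- root and that `D` lies in (f(x), f′(x)).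
  invert-eval : ∀ G V c → act V (act G e₀) ≗ (λ i → c *ℤ e₀ i) → ∀ x → eval f x ∣ℤ eval V x *ℤ eval G x -ℤ c
  invert-eval G V c VG≡c x = subst (eval f x ∣ℤ_) eq
    (ℤ∣.∣m∣n⇒∣m-n (ℤ∣.∣n⇒∣m*n -1ℤ (⟦act⟧ V (act G e₀) x)) (ℤ∣.∣n⇒∣m*n (eval V x) (⟦act⟧ G e₀ x)))
    where
    open ≡-Reasoning
    eq : -1ℤ *ℤ (⟦ act V (act G e₀) ⟧ x -ℤ eval V x *ℤ ⟦ act G e₀ ⟧ x) -ℤ eval V x *ℤ (⟦ act G e₀ ⟧ x -ℤ eval G x *ℤ ⟦ e₀ ⟧ x)
         ≡ eval V x *ℤ eval G x -ℤ c
    eq = trans (cong₂ (λ s t → -1ℤ *ℤ (s -ℤ eval V x *ℤ ⟦ act G e₀ ⟧ x) -ℤ eval V x *ℤ (⟦ act G e₀ ⟧ x -ℤ eval G x *ℤ t))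
                 (trans (ev-cong (suc n) x (λ i _ → trans (VG≡c i) (pad c (e₀ i))))
                        (trans (ev-lin (suc n) c 0ℤ e₀ e₀ x) (cong (λ t → c *ℤ t +ℤ 0ℤ *ℤ t) (⟦e₀⟧ x)))) (⟦e₀⟧ x))
               (regroup c (eval V x) (⟦ act G e₀ ⟧ x) (eval G x))
      where
      pad : ∀ c s → c *ℤ s ≡ c *ℤ s +ℤ 0ℤ *ℤ s
      pad = ℤSolver.solve-∀
      regroup : ∀ c v g G → -1ℤ *ℤ ((c *ℤ 1ℤ +ℤ 0ℤ *ℤ 1ℤ) -ℤ v *ℤ g) -ℤ v *ℤ (g -ℤ G *ℤ 1ℤ) ≡ v *ℤ G -ℤ c
      regroup = ℤSolver.solve-∀

-- Chinese remaindering and pigeonhole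

∣pos-pos∣ : ∀ a b → ∣ pos a -ℤ pos b ∣ ≡ ∣ a - b ∣
∣pos-pos∣ a b = trans (cong ∣_∣ (ℤₚ.[+m]-[+n]≡m⊖n a b)) (∣⊖∣ a b)
  where
  ∣⊖∣ : ∀ a b → ∣ a ℤ.⊖ b ∣ ≡ ∣ a - b ∣
  ∣⊖∣ zero    zero    = refl
  ∣⊖∣ zero    (suc b) = refl
  ∣⊖∣ (suc a) zero    = refl
  ∣⊖∣ (suc a) (suc b) = trans (cong ∣_∣ (ℤₚ.[1+m]⊖[1+n]≡m⊖n a b)) (∣⊖∣ a b)

∣-diff⇒≡ : ∀ {q a b} → a < q → b < q → q ∣ ∣ a - b ∣ → a ≡ b
∣-diff⇒≡ {q} {a} {b} a<q b<q q∣ with ∣ a - b ∣ in eq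
... | zero  = ∣m-n∣≡0⇒m≡n eq
... | suc k = contradiction (≤-trans (s≤s (∣⇒≤ q∣)) (≤-trans (s≤s (subst (_≤ a ⊔ b) eq (∣m-n∣≤m⊔n a b))) (⊔-lub a<q b<q))) (n≮n q)

coprime-∣ˡ : ∀ {m m′ k} → m′ ∣ m → Coprime m k → Coprime m′ k
coprime-∣ˡ m′∣m cop (d∣m′ , d∣k) = cop (∣-trans d∣m′ m′∣m , d∣k)

coprime-* : ∀ {m a b} → Coprime m a → Coprime m b → Coprime m (a * b)
coprime-* cop-a cop-b (d∣m , d∣ab) = cop-b (d∣m , coprime-divisor (coprime-∣ˡ d∣m cop-a) d∣ab)

coprime-∣* : ∀ {q} a b → Coprime q ∣ b ∣ → pos q ∣ℤ a *ℤ b → q ∣ ∣ a ∣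
coprime-∣* {q} a b cop q∣ab = coprime-divisor cop
  (subst (q ∣_) (trans (ℤₚ.abs-* a b) (*-comm ∣ a ∣ ∣ b ∣)) (ℤ∣.∣⇒∣ᵤ q∣ab))

-- Either condition makes (q, X - r) and (q′, X - r′) comaximal, as their sum contains q, q′ and r -
-- r′.
Apart : ℕ × ℤ → ℕ × ℤ → Set
Apart (q , r) (q′ , r′) = Coprime q q′ ⊎ Coprime q ∣ r -ℤ r′ ∣

module ChineseRemainder {I : Set} (item : I → ℕ × ℤ) where

  q : I → ℕ
  q i = proj₁ (item i)
  r : I → ℤ
  r i = proj₂ (item i)

  CongruentAt : Poly → Poly → I → Set
  CongruentAt g h i = pos (q i) ∣ℤ eval g (r i) -ℤ eval h (r i)

  -- `E` is a product with one factor for each `j`, the constant `q j` or the polynomial X - `r j`,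
  -- whichever is known to be a unit modulo `q i` at `r i`. Being a unit there is enough; no Bézout
  -- coefficients are needed.
  separator : ∀ i js → All (λ j → Apart (item i) (item j)) js →
              ∃[ E ] (All (λ j → pos (q j) ∣ℤ eval E (r j)) js × Coprime (q i) ∣ eval E (r i) ∣)
  separator i [] [] = [ 1ℤ ] , [] , subst (λ t → Coprime (q i) ∣ 1ℤ +ℤ t ∣) (sym (ℤₚ.*-zeroʳ (r i))) (coprime-sym (1-coprimeTo (q i)))
  separator i (j ∷ js) (apart ∷ aparts) with separator i js aparts
  ... | E , E≡0 , E-unit with apart
  ...   | inj₁ cop = scale (pos (q j)) E
      , subst (pos (q j) ∣ℤ_) (sym (eval-scale (pos (q j)) E (r j))) (divides (eval E (r j)) (ℤₚ.*-comm (pos (q j)) (eval E (r j))))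
        ∷ All.map (λ {k} q∣ → subst (pos (q k) ∣ℤ_) (sym (eval-scale (pos (q j)) E (r k))) (ℤ∣.∣n⇒∣m*n (pos (q j)) q∣)) E≡0
      , subst (Coprime (q i)) (sym (trans (cong ∣_∣ (eval-scale (pos (q j)) E (r i))) (ℤₚ.abs-* (pos (q j)) (eval E (r i))))) (coprime-* cop E-unit)
  ...   | inj₂ cop = E′
      , subst (pos (q j) ∣ℤ_) (sym (E′-eval (r j))) (subst (λ t → pos (q j) ∣ℤ t *ℤ eval E (r j)) (sym (ℤₚ.+-inverseʳ (r j))) (divides 0ℤ refl))
        ∷ All.map (λ {k} q∣ → subst (pos (q k) ∣ℤ_) (sym (E′-eval (r k))) (ℤ∣.∣n⇒∣m*n (r k -ℤ r j) q∣)) E≡0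
      , subst (Coprime (q i)) (sym (trans (cong ∣_∣ (E′-eval (r i))) (ℤₚ.abs-* (r i -ℤ r j) (eval E (r i))))) (coprime-* cop E-unit)
    where
    E′ : Poly
    E′ = (0ℤ ∷ E) +ₚ scale (-ℤ r j) E
    E′-eval : ∀ x → eval E′ x ≡ (x -ℤ r j) *ℤ eval E x
    E′-eval x = trans (eval-+ₚ (0ℤ ∷ E) (scale (-ℤ r j) E) x)
      (trans (cong (0ℤ +ℤ x *ℤ eval E x +ℤ_) (eval-scale (-ℤ r j) E x)) (regroup x (r j) (eval E x)))
      where
      regroup : ∀ x s e → 0ℤ +ℤ x *ℤ e +ℤ (-ℤ s) *ℤ e ≡ (x -ℤ s) *ℤ e
      regroup = ℤSolver.solve-∀

  -- The Chinese remainder theorem in mixed radix. `E` vanishes at the later items, so they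
  -- determine `rest`; with equal rests, the unit `E` reveals the digit at `i`. Enough distinct
  -- residue vectors are produced, without solving for a prescribed one.
  distinguished : ∀ js → AllPairs (λ i j → Apart (item i) (item j)) js →
                  Σ (Fin (product (map q js)) → Poly) λ H → ∀ a b → All (CongruentAt (H a) (H b)) js → a ≡ b
  distinguished [] [] = (λ _ → []) , λ { Fin.zero Fin.zero _ → refl }
  distinguished (i ∷ js) (aparts ∷ pairs) with separator i js aparts | distinguished js pairs
  ... | E , E≡0 , E-unit | H , H-inj = H′ , H′-inj
    where
    open ≡-Reasoning
    P : ℕ
    P = product (map q js)
    digit : Fin (q i * P) → Fin (q i)
    digit a = proj₁ (remQuot {q i} P a)
    rest : Fin (q i * P) → Fin P
    rest a = proj₂ (remQuot {q i} P a)
    H′ : Fin (q i * P) → Poly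
    H′ a = H (rest a) +ₚ scale (pos (toℕ (digit a))) E
    H′-diff : ∀ a b x → eval (H′ a) x -ℤ eval (H′ b) x
            ≡ (eval (H (rest a)) x -ℤ eval (H (rest b)) x) +ℤ (pos (toℕ (digit a)) -ℤ pos (toℕ (digit b))) *ℤ eval E x
    H′-diff a b x
      rewrite eval-+ₚ (H (rest a)) (scale (pos (toℕ (digit a))) E) x | eval-scale (pos (toℕ (digit a))) E x
            | eval-+ₚ (H (rest b)) (scale (pos (toℕ (digit b))) E) x | eval-scale (pos (toℕ (digit b))) E x
      = regroup (eval (H (rest a)) x) (eval (H (rest b)) x) (pos (toℕ (digit a))) (pos (toℕ (digit b))) (eval E x)
      where
      regroup : ∀ g h s t e → (g +ℤ s *ℤ e) -ℤ (h +ℤ t *ℤ e) ≡ (g -ℤ h) +ℤ (s -ℤ t) *ℤ e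
      regroup = ℤSolver.solve-∀
    rest-congruent : ∀ a b {js′} → All (λ j → pos (q j) ∣ℤ eval E (r j)) js′ → All (CongruentAt (H′ a) (H′ b)) js′ →
                     All (CongruentAt (H (rest a)) (H (rest b))) js′
    rest-congruent a b [] [] = []
    rest-congruent a b {j ∷ _} (e ∷ es) (c ∷ cs) =
      ℤ∣.∣m+n∣n⇒∣m (subst (pos (q j) ∣ℤ_) (H′-diff a b (r j)) c) (ℤ∣.∣n⇒∣m*n (pos (toℕ (digit a)) -ℤ pos (toℕ (digit b))) e)
      ∷ rest-congruent a b es cs
    H′-inj : ∀ a b → All (CongruentAt (H′ a) (H′ b)) (i ∷ js) → a ≡ b
    H′-inj a b (c ∷ cs) = begin
      a                            ≡⟨ sym (Finₚ.combine-remQuot {q i} P a) ⟩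
      combine (digit a) (rest a)   ≡⟨ cong₂ combine digit≡ rest≡ ⟩
      combine (digit b) (rest b)   ≡⟨ Finₚ.combine-remQuot {q i} P b ⟩
      b                            ∎
      where
      rest≡ : rest a ≡ rest b
      rest≡ = H-inj (rest a) (rest b) (rest-congruent a b E≡0 cs)
      cancelled : ∀ {x y} → x ≡ y → ∀ t → (x -ℤ y) +ℤ t ≡ t
      cancelled {x} refl t = trans (cong (_+ℤ t) (ℤₚ.+-inverseʳ x)) (ℤₚ.+-identityˡ t)
      digit≡ : digit a ≡ digit b
      digit≡ = Finₚ.toℕ-injective (∣-diff⇒≡ (Finₚ.toℕ<n (digit a)) (Finₚ.toℕ<n (digit b))
        (subst (q i ∣_) (∣pos-pos∣ (toℕ (digit a)) (toℕ (digit b)))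
          (coprime-∣* (pos (toℕ (digit a)) -ℤ pos (toℕ (digit b))) (eval E (r i)) E-unit
            (subst (pos (q i) ∣ℤ_) (trans (H′-diff a b (r i)) (cancelled (cong (λ k → eval (H k) (r i)) rest≡) _)) c))))

  -- By the Chinese remainder theorem all ∏ q residue vectors occur, and rep separates them.
  product-≤ : ∀ js → AllPairs (λ i j → Apart (item i) (item j)) js → ∀ s (rep : Poly → Fin s) →
              (∀ g h → rep g ≡ rep h → All (CongruentAt g h) js) → product (map q js) ≤ s
  product-≤ js pairs s rep rep-sound with distinguished js pairs
  ... | H , H-inj = Finₚ.injective⇒≤ {f = rep ∘ H} (λ {a} {b} eq → H-inj a b (rep-sound (H a) (H b) eq))

encode-bounded : ∀ Z z → ∣ z ∣ ≤ Z → ∃[ k ] (k < suc (2 * Z) × z ≡ pos k -ℤ pos Z)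
encode-bounded Z (ℤ.+_ k) k≤Z = k + Z
  , s≤s (subst (k + Z ≤_) (cong (Z +_) (sym (+-identityʳ Z))) (+-monoˡ-≤ Z k≤Z))
  , trans (regroup (pos k) (pos Z)) (cong (_-ℤ pos Z) (sym (ℤₚ.pos-+ k Z)))
  where
  regroup : ∀ k z → k ≡ k +ℤ z -ℤ z
  regroup = ℤSolver.solve-∀
encode-bounded Z (ℤ.-[1+_] k) k<Z = Z ∸ suc k
  , s≤s (≤-trans (m∸n≤m Z (suc k)) (m≤m+n Z _))
  , trans (regroup (pos (suc k)) (pos Z)) (cong (_-ℤ pos Z) (trans (ℤₚ.[+m]-[+n]≡m⊖n Z (suc k)) (ℤₚ.⊖-≥ k<Z)))
  where
  regroup : ∀ k z → -ℤ k ≡ z -ℤ k -ℤ z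
  regroup = ℤSolver.solve-∀

coeff-beyond : ∀ p i → length p ≤ i → coeff p i ≡ 0ℤ
coeff-beyond []      i       len≤ = refl
coeff-beyond (a ∷ p) (suc i) (s≤s len≤) = coeff-beyond p i len≤

-- Counting residues in ℤ[X]/(f)

module Residues (f : Poly) (n : ℕ) (lead : coeff f (suc n) ≡ 1ℤ)
                (high : ∀ i → suc n < i → coeff f i ≡ 0ℤ) (f-irr : Irreducible f)
                (A : ℕ) (f≤A : ∀ i → ∣ coeff f i ∣ ≤ A) where

  open Inversion f n lead high f-irr public

  remainder-congruent : ∀ m x g h → m ∣ℤ eval f x → m ∣ℤ ⟦ act g e₀ ⟧ x -ℤ ⟦ act h e₀ ⟧ x → m ∣ℤ eval g x -ℤ eval h x
  remainder-congruent m x g h m∣f m∣ = subst (m ∣ℤ_) eq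
    (ℤ∣.∣m∣n⇒∣m+n (ℤ∣.∣m∣n⇒∣m-n m∣ (ℤ∣.∣-trans m∣f (⟦act⟧ g e₀ x))) (ℤ∣.∣-trans m∣f (⟦act⟧ h e₀ x)))
    where
    regroup : ∀ a b g h → (a -ℤ b) -ℤ (a -ℤ g *ℤ 1ℤ) +ℤ (b -ℤ h *ℤ 1ℤ) ≡ g -ℤ h
    regroup = ℤSolver.solve-∀
    eq : (⟦ act g e₀ ⟧ x -ℤ ⟦ act h e₀ ⟧ x) -ℤ (⟦ act g e₀ ⟧ x -ℤ eval g x *ℤ ⟦ e₀ ⟧ x) +ℤ (⟦ act h e₀ ⟧ x -ℤ eval h x *ℤ ⟦ e₀ ⟧ x)
         ≡ eval g x -ℤ eval h x
    eq rewrite ⟦e₀⟧ x = regroup (⟦ act g e₀ ⟧ x) (⟦ act h e₀ ⟧ x) (eval g x) (eval h x)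

  ⟦⟧-∣-diff : ∀ m x v w → (∀ i → i < suc n → m ∣ℤ v i -ℤ w i) → m ∣ℤ ⟦ v ⟧ x -ℤ ⟦ w ⟧ x
  ⟦⟧-∣-diff m x v w m∣ = subst (m ∣ℤ_) (trans (ev-lin (suc n) 1ℤ -1ℤ v w x) (sym (asLin (⟦ v ⟧ x) (⟦ w ⟧ x))))
    (ev-∣ (suc n) m _ x (λ i i<d → subst (m ∣ℤ_) (asLin (v i) (w i)) (m∣ i i<d)))
    where
    asLin : ∀ s t → s -ℤ t ≡ 1ℤ *ℤ s +ℤ -1ℤ *ℤ t
    asLin = ℤSolver.solve-∀

  funToFin-injective : ∀ {k s} (u v : Fin k → Fin s) → funToFin u ≡ funToFin v → u ≗ v
  funToFin-injective u v eq i = trans (sym (Finₚ.finToFun-funToFin u i)) (trans (cong (λ t → finToFun t i) eq) (Finₚ.finToFun-funToFin v i))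

  module _ {I : Set} (item : I → ℕ × ℤ) (js : List I) (pairs : AllPairs (λ i j → Apart (item i) (item j)) js)
           (q∣f : ∀ j → pos (proj₁ (item j)) ∣ℤ eval f (proj₂ (item j))) where

    open ChineseRemainder item

    -- Since every modulus divides `M`, the remainder modulo f with its coordinates reduced modulo
    -- `M` decides all residues. Applied to `L′` with the full exponents and to `lcmUpTo M` with
    -- `small`.
    product-≤-modulus : ∀ M .{{_ : NonZero M}} → (∀ j → q j ∣ M) → product (map q js) ≤ M ^ suc n
    product-≤-modulus M q∣M = product-≤ js pairs (M ^ suc n) rep rep-sound
      where
      coords : Poly → Fin (suc n) → Fin M
      coords h i = fromℕ< (ℤᵈ.n%ℕd<d (act h e₀ (toℕ i)) M)
      rep : Poly → Fin (M ^ suc n)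
      rep h = funToFin (coords h)
      M∣ : ∀ a b → a ℤᵈ.%ℕ M ≡ b ℤᵈ.%ℕ M → pos M ∣ℤ a -ℤ b
      M∣ a b eq = divides (a ℤᵈ./ℕ M -ℤ b ℤᵈ./ℕ M)
        (trans (cong₂ _-ℤ_ (ℤᵈ.a≡a%ℕn+[a/ℕn]*n a M) (trans (ℤᵈ.a≡a%ℕn+[a/ℕn]*n b M) (cong (λ t → pos t +ℤ (b ℤᵈ./ℕ M) *ℤ pos M) (sym eq))))
               (regroup (pos (a ℤᵈ.%ℕ M)) (a ℤᵈ./ℕ M) (b ℤᵈ./ℕ M) (pos M)))
        where
        regroup : ∀ s a b m → (s +ℤ a *ℤ m) -ℤ (s +ℤ b *ℤ m) ≡ (a -ℤ b) *ℤ m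
        regroup = ℤSolver.solve-∀
      rep-sound : ∀ g h → rep g ≡ rep h → All (CongruentAt g h) js
      rep-sound g h eq = All.universal (λ j → remainder-congruent (pos (q j)) (r j) g h (q∣f j)
        (⟦⟧-∣-diff (pos (q j)) (r j) (act g e₀) (act h e₀) (λ i i<d → ℤ∣.∣-trans (ℤ∣.∣ᵤ⇒∣ (q∣M j)) (M∣ (act g e₀ i) (act h e₀ i) (coord≡ i i<d))))) js
        where
        coord≡ : ∀ i → i < suc n → act g e₀ i ℤᵈ.%ℕ M ≡ act h e₀ i ℤᵈ.%ℕ M
        coord≡ i i<d = trans (sym (at g)) (trans (cong toℕ (funToFin-injective (coords g) (coords h) eq (fromℕ< i<d))) (at h))
          where
          at : ∀ g → toℕ (coords g (fromℕ< i<d)) ≡ act g e₀ i ℤᵈ.%ℕ M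
          at g = trans (Finₚ.toℕ-fromℕ< _) (cong (λ k → act g e₀ k ℤᵈ.%ℕ M) (Finₚ.toℕ-fromℕ< i<d))

  -- The geometric sum of the powers of 1 + A below the k-th: `θ` multiplies heights by at most 1 +
  -- A.
  growth : ℕ → ℕ
  growth zero    = 0
  growth (suc k) = 1 + suc A * growth k

  ∣θ∣≤ : ∀ S v → (∀ i → ∣ v i ∣ ≤ S) → ∀ i → ∣ θ v i ∣ ≤ suc A * S
  ∣θ∣≤ S v v≤S zero = ≤-trans (≤-reflexive (trans (ℤₚ.∣-i∣≡∣i∣ (v n *ℤ coeff f 0)) (ℤₚ.abs-* (v n) (coeff f 0))))
    (≤-trans (*-mono-≤ (v≤S n) (f≤A 0)) (≤-trans (≤-reflexive (*-comm S A)) (m≤n+m (A * S) S)))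
  ∣θ∣≤ S v v≤S (suc i) = ≤-trans (ℤₚ.∣i-j∣≤∣i∣+∣j∣ (v i) (v n *ℤ coeff f (suc i)))
    (+-mono-≤ (v≤S i) (≤-trans (≤-reflexive (ℤₚ.abs-* (v n) (coeff f (suc i))))
      (≤-trans (*-mono-≤ (v≤S n) (f≤A (suc i))) (≤-reflexive (*-comm S A)))))

  ∣act∣≤ : ∀ T S p v → (∀ i → ∣ coeff p i ∣ ≤ T) → (∀ i → ∣ v i ∣ ≤ S) → ∀ i → ∣ act p v i ∣ ≤ growth (length p) * (T * S)
  ∣act∣≤ T S []      v p≤T v≤S i = z≤n
  ∣act∣≤ T S (a ∷ p) v p≤T v≤S i = ≤-trans (ℤₚ.∣i+j∣≤∣i∣+∣j∣ (a *ℤ v i) (θ (act p v) i))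
    (+-mono-≤ (≤-trans (≤-reflexive (ℤₚ.abs-* a (v i))) (*-mono-≤ (p≤T 0) (v≤S i)))
      (≤-trans (∣θ∣≤ (growth (length p) * (T * S)) (act p v) (∣act∣≤ T S p v (p≤T ∘ suc) v≤S) i)
        (≤-reflexive (sym (*-assoc (suc A) (growth (length p)) (T * S))))))

  invert⁺ : ∀ G → Supported (coeff G) → ¬ IsZero G →
            ∃[ V ] ∃[ c ] (NonZero c × act V (act G e₀) ≗ λ i → pos c *ℤ e₀ i)
  invert⁺ G G-supp G≉0 with invert (suc n) G ≤-refl G-supp G≉0
  ... | V , ℤ.+_ zero    , c≢0 , eq = contradiction refl c≢0
  ... | V , ℤ.+_ (suc c) , c≢0 , eq = V , suc c , _ , eq
  ... | V , ℤ.-[1+_] c   , c≢0 , eq = scale -1ℤ V , suc c , _ , λ i →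
    trans (act-scale -1ℤ V (act G e₀) i) (trans (cong (-1ℤ *ℤ_) (eq i)) (regroup (pos (suc c)) (e₀ i)))
    where
    regroup : ∀ c s → -1ℤ *ℤ ((-ℤ c) *ℤ s) ≡ c *ℤ s
    regroup = ℤSolver.solve-∀

  -- Dividing h by G in ℚ[X]/(f) and rounding the quotient to u leaves a remainder z of height O(T);
  -- so G has O(Tᵈ) residues, which replaces a bound for its norm.
  module Rounding (T : ℕ) (G : Poly) (len : length G ≡ suc n) (G≤T : ∀ i → ∣ coeff G i ∣ ≤ T)
                  (V : Poly) (c : ℕ) {{c≢0 : NonZero c}} (VG≡c : act V (act G e₀) ≗ λ i → pos c *ℤ e₀ i) where

    module _ (h : Poly) where

      w s u z : ℕ → ℤ
      -- As G V = c, the quotient h / G in ℚ[X]/(f) is `w / c`; `u` is its coordinatewise floor,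
      -- `s / c` its fractional part and `z` = h - G u.
      w = act h (act V e₀)
      s i = pos (w i ℤᵈ.%ℕ c)
      u i = w i ℤᵈ./ℕ c
      z i = act h e₀ i -ℤ act G u i

      c*h≡ : ∀ i → pos c *ℤ act h e₀ i ≡ act G s i +ℤ pos c *ℤ act G u i
      c*h≡ i = begin
        pos c *ℤ act h e₀ i                    ≡⟨ sym (act-scaled h (pos c) e₀ i) ⟩
        act h (λ i → pos c *ℤ e₀ i) i          ≡⟨ sym (act-cong h VG≡c i) ⟩
        act h (act V (act G e₀)) i             ≡⟨ act-cong h (act-comm V G e₀) i ⟩
        act h (act G (act V e₀)) i             ≡⟨ act-comm h G (act V e₀) i ⟩
        act G w i                              ≡⟨ act-cong G (λ i → trans (ℤᵈ.a≡a%ℕn+[a/ℕn]*n (w i) c) (asLin (s i) (u i) (pos c))) i ⟩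
        act G (λ i → 1ℤ *ℤ s i +ℤ pos c *ℤ u i) i ≡⟨ act-lin G 1ℤ (pos c) s u i ⟩
        1ℤ *ℤ act G s i +ℤ pos c *ℤ act G u i  ≡⟨ cong (_+ℤ pos c *ℤ act G u i) (ℤₚ.*-identityˡ (act G s i)) ⟩
        act G s i +ℤ pos c *ℤ act G u i        ∎
        where
        open ≡-Reasoning
        asLin : ∀ s u c → s +ℤ u *ℤ c ≡ 1ℤ *ℤ s +ℤ c *ℤ u
        asLin = ℤSolver.solve-∀

      c*z≡ : ∀ i → pos c *ℤ z i ≡ act G s i
      c*z≡ i = trans (distrib (pos c) (act h e₀ i) (act G u i))
        (trans (cong (_-ℤ pos c *ℤ act G u i) (c*h≡ i)) (cancel (act G s i) (pos c *ℤ act G u i)))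
        where
        distrib : ∀ c a b → c *ℤ (a -ℤ b) ≡ c *ℤ a -ℤ c *ℤ b
        distrib = ℤSolver.solve-∀
        cancel : ∀ a b → a +ℤ b -ℤ b ≡ a
        cancel = ℤSolver.solve-∀

      -- The uncontrolled denominator `c` cancels: c z = G s with s < c, so the bound depends on `T`
      -- alone.
      ∣z∣≤ : ∀ i → ∣ z i ∣ ≤ growth (suc n) * T
      ∣z∣≤ i = *-cancelˡ-≤ c (begin
        c * ∣ z i ∣                      ≡⟨ sym (ℤₚ.abs-* (pos c) (z i)) ⟩
        ∣ pos c *ℤ z i ∣                 ≡⟨ cong ∣_∣ (c*z≡ i) ⟩
        ∣ act G s i ∣                    ≤⟨ ∣act∣≤ T c G s G≤T (λ i → <⇒≤ (ℤᵈ.n%ℕd<d (w i) c)) i ⟩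
        growth (length G) * (T * c)      ≡⟨ cong (λ k → growth k * (T * c)) len ⟩
        growth (suc n) * (T * c)         ≡⟨ regroup (growth (suc n)) T c ⟩
        c * (growth (suc n) * T)         ∎)
        where
        open ≤-Reasoning
        regroup : ∀ g t c → g * (t * c) ≡ c * (g * t)
        regroup = ℕSolver.solve-∀

      Z : ℕ
      Z = growth (suc n) * T

      coords : Fin (suc n) → Fin (suc (2 * Z))
      coords i = fromℕ< (proj₁ (proj₂ (encode-bounded Z (z (toℕ i)) (∣z∣≤ (toℕ i)))))

      coords-z : ∀ i (i<d : i < suc n) → z i ≡ pos (toℕ (coords (fromℕ< i<d))) -ℤ pos Z
      coords-z i i<d = trans (cong z (sym (Finₚ.toℕ-fromℕ< i<d)))
        (trans (proj₂ (proj₂ (encode-bounded Z (z (toℕ (fromℕ< i<d))) (∣z∣≤ _))))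
               (cong (λ k → pos k -ℤ pos Z) (sym (Finₚ.toℕ-fromℕ< _))))

    -- Since h = z + G u modulo f, the residue of h at a modulus dividing both f(x) and G(x) is that
    -- of `z`.
    coords≡⇒congruent : ∀ g h m x → coords g ≗ coords h → m ∣ℤ eval f x → m ∣ℤ eval G x → m ∣ℤ eval g x -ℤ eval h x
    coords≡⇒congruent g h m x eq m∣f m∣G = remainder-congruent m x g h m∣f (subst (m ∣ℤ_) (regroup (⟦ act g e₀ ⟧ x) (⟦ act h e₀ ⟧ x) (⟦ act G (u g) ⟧ x) (⟦ act G (u h) ⟧ x))
      (ℤ∣.∣m∣n⇒∣m+n z-diff (ℤ∣.∣m∣n⇒∣m-n (m∣Gu g) (m∣Gu h))))
      where
      z≡ : ∀ i → i < suc n → z g i ≡ z h i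
      z≡ i i<d = trans (coords-z g i i<d) (trans (cong (λ k → pos (toℕ k) -ℤ pos (Z g)) (eq (fromℕ< i<d))) (sym (coords-z h i i<d)))
      m∣Gu : ∀ g → m ∣ℤ ⟦ act G (u g) ⟧ x
      m∣Gu g = subst (m ∣ℤ_) (cancel (⟦ act G (u g) ⟧ x) (eval G x *ℤ ⟦ u g ⟧ x))
        (ℤ∣.∣m∣n⇒∣m+n (ℤ∣.∣-trans m∣f (⟦act⟧ G (u g) x)) (ℤ∣.∣m⇒∣m*n (⟦ u g ⟧ x) m∣G))
        where
        cancel : ∀ a b → a -ℤ b +ℤ b ≡ a
        cancel = ℤSolver.solve-∀
      ⟦z⟧ : ∀ g → ⟦ z g ⟧ x ≡ ⟦ act g e₀ ⟧ x -ℤ ⟦ act G (u g) ⟧ x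
      ⟦z⟧ g = trans (ev-cong (suc n) x (λ i _ → asLin (act g e₀ i) (act G (u g) i)))
        (trans (ev-lin (suc n) 1ℤ -1ℤ (act g e₀) (act G (u g)) x) (sym (asLin (⟦ act g e₀ ⟧ x) (⟦ act G (u g) ⟧ x))))
        where
        asLin : ∀ s t → s -ℤ t ≡ 1ℤ *ℤ s +ℤ -1ℤ *ℤ t
        asLin = ℤSolver.solve-∀
      z-diff : m ∣ℤ (⟦ act g e₀ ⟧ x -ℤ ⟦ act G (u g) ⟧ x) -ℤ (⟦ act h e₀ ⟧ x -ℤ ⟦ act G (u h) ⟧ x)
      z-diff = subst (m ∣ℤ_) (sym (trans (cong₂ _-ℤ_ (sym (⟦z⟧ g)) (trans (sym (⟦z⟧ h)) (ev-cong (suc n) x (λ i i<d → sym (z≡ i i<d)))))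
        (ℤₚ.+-inverseʳ (⟦ z g ⟧ x)))) (divides 0ℤ refl)
      regroup : ∀ a b c e → ((a -ℤ c) -ℤ (b -ℤ e)) +ℤ (c -ℤ e) ≡ a -ℤ b
      regroup = ℤSolver.solve-∀

  product-≤-height : ∀ {I : Set} (item : I → ℕ × ℤ) (js : List I) → AllPairs (λ i j → Apart (item i) (item j)) js →
    (∀ j → pos (proj₁ (item j)) ∣ℤ eval f (proj₂ (item j))) →
    ∀ T G → length G ≡ suc n → (∀ i → ∣ coeff G i ∣ ≤ T) → ¬ IsZero G →
    (∀ j → pos (proj₁ (item j)) ∣ℤ eval G (proj₂ (item j))) →
    product (map (proj₁ ∘ item) js) ≤ suc (2 * (growth (suc n) * T)) ^ suc n
  product-≤-height item js pairs q∣f T G len G≤T G≉0 q∣G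
    with invert⁺ G (λ i n<i → coeff-beyond G i (≤-trans (≤-reflexive len) n<i)) G≉0
  ... | V , c , c≢0 , VG≡c = product-≤ js pairs _ (funToFin ∘ coords) λ g h eq →
      All.universal (λ j → coords≡⇒congruent g h (pos (q j)) (r j) (funToFin-injective (coords g) (coords h) eq) (q∣f j) (q∣G j)) js
    where
    open ChineseRemainder item
    open Rounding T G len G≤T V c {{c≢0}} VG≡c

-- Binomial coefficients, lcm(1, …, n) and size bounds

^-distrib-* : ∀ k a b → (a * b) ^ k ≡ a ^ k * b ^ k
^-distrib-* zero    a b = refl
^-distrib-* (suc k) a b = trans (cong (a * b *_) (^-distrib-* k a b)) (interchange a b (a ^ k) (b ^ k))
  where
  interchange : ∀ a b c d → a * b * (c * d) ≡ a * c * (b * d)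
  interchange = ℕSolver.solve-∀

∏-^ : ∀ n k g → ∏ n (λ i → g i ^ k) ≡ ∏ n g ^ k
∏-^ zero    k g = sym (^-zeroˡ k)
∏-^ (suc n) k g = trans (cong (g 0 ^ k *_) (∏-^ n k (g ∘ suc))) (sym (^-distrib-* k (g 0) _))

^-comm : ∀ b m n → (b ^ m) ^ n ≡ (b ^ n) ^ m
^-comm b m n = trans (^-*-assoc b m n) (trans (cong (b ^_) (*-comm m n)) (sym (^-*-assoc b n m)))

^-double : ∀ b n → b ^ (n + n) ≡ (b * b) ^ n
^-double b n = trans (^-distribˡ-+-* b n n) (sym (^-distrib-* n b b))

b≤b^n : ∀ b n → 1 ≤ b → 1 ≤ n → b ≤ b ^ n
b≤b^n b (suc n) 1≤b 1≤n = m≤m*n b (b ^ n) {{>-nonZero (1≤^ 1≤b n)}}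

C-! : ∀ x y → ((x + y) C x) * (x ! * y !) ≡ (x + y) !
C-! x y = begin
  ((x + y) C x) * (x ! * y !)                            ≡⟨ cong (λ k → ((x + y) C x) * (x ! * k !)) (sym (m+n∸m≡n x y)) ⟩
  ((x + y) C x) * d                                      ≡⟨ cong (_* d) (nCk≡n!/k![n-k]! (m≤m+n x y)) ⟩
  ((x + y) ! / d) * d                                    ≡⟨ m/n*n≡m (k![n∸k]!∣n! (m≤m+n x y)) ⟩
  (x + y) !                                              ∎
  where
  open ≡-Reasoning
  d : ℕ
  d = x ! * (x + y ∸ x) !
  instance
    d≢0 : NonZero d
    d≢0 = x !* (x + y ∸ x) !≢0

nC0≡1 : ∀ n → n C 0 ≡ 1
nC0≡1 n = *-cancelʳ-≡ _ 1 (n !) {{n !≢0}} (trans (cong ((n C 0) *_) (sym (*-identityˡ (n !)))) (trans (C-! 0 n) (sym (*-identityˡ (n !)))))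

C≤2^ : ∀ n k → n C k ≤ 2 ^ n
C≤2^ zero    zero    = ≤-refl
C≤2^ zero    (suc k) = z≤n
C≤2^ (suc n) zero    = subst (_≤ 2 ^ suc n) (sym (nC0≡1 (suc n))) (m^n>0 2 (suc n))
C≤2^ (suc n) (suc k) = subst (_≤ 2 ^ suc n) (nCk+nC[k+1]≡[n+1]C[k+1] n k)
  (+-mono-≤ (C≤2^ n k) (≤-trans (C≤2^ n (suc k)) (m≤m+n (2 ^ n) 0)))

n<2^n : ∀ n → n < 2 ^ n
n<2^n zero    = ≤-refl
n<2^n (suc n) = ≤-trans (+-mono-≤ (m^n>0 2 n) (n<2^n n)) (≤-reflexive (cong (2 ^ n +_) (sym (+-identityʳ (2 ^ n)))))

-- An exponential bound for lcm(1, ..., n) from Leibniz's triangle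

lcmUpTo : ℕ → ℕ
lcmUpTo zero    = 1
lcmUpTo (suc n) = lcm (suc n) (lcmUpTo n)

∣lcmUpTo : ∀ n k → 1 ≤ k → k ≤ n → k ∣ lcmUpTo n
∣lcmUpTo zero    k 1≤k k≤n = contradiction (≤-trans 1≤k k≤n) λ ()
∣lcmUpTo (suc n) k 1≤k k≤n with m≤n⇒m<n∨m≡n k≤n
... | inj₂ refl       = m∣lcm[m,n] (suc n) (lcmUpTo n)
... | inj₁ (s≤s k≤n′) = ∣-trans (∣lcmUpTo n k 1≤k k≤n′) (n∣lcm[m,n] (suc n) (lcmUpTo n))

lcmUpTo-least : ∀ n X → (∀ k → 1 ≤ k → k ≤ n → k ∣ X) → lcmUpTo n ∣ X
lcmUpTo-least zero    X k∣X = 1∣ X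
lcmUpTo-least (suc n) X k∣X = lcm-least (k∣X (suc n) (s≤s z≤n) ≤-refl) (lcmUpTo-least n X (λ k 1≤k k≤n → k∣X k 1≤k (m≤n⇒m≤1+n k≤n)))

lcm-nonZero : ∀ m n → NonZero m → NonZero n → NonZero (lcm m n)
lcm-nonZero m n m≢0 n≢0 with lcm m n in eq
... | suc _ = _
... | zero  = contradiction (trans (sym (gcd*lcm m n)) (trans (cong (gcd m n *_) eq) (*-zeroʳ (gcd m n)))) (≢-nonZero⁻¹ (m * n) {{m*n≢0 m n {{m≢0}} {{n≢0}}}})

lcmUpTo-nonZero : ∀ n → NonZero (lcmUpTo n)
lcmUpTo-nonZero zero    = _
lcmUpTo-nonZero (suc n) = lcm-nonZero (suc n) (lcmUpTo n) _ (lcmUpTo-nonZero n)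

-- The reciprocals of the entries of Leibniz's harmonic triangle.
leibniz : ℕ → ℕ → ℕ
leibniz x y = suc x * ((suc x + y) C suc x)

leibniz-! : ∀ x y → leibniz x y * (x ! * y !) ≡ (suc x + y) !
leibniz-! x y = trans (regroup (suc x) ((suc x + y) C suc x) (x !) (y !)) (C-! (suc x) y)
  where
  regroup : ∀ s c a b → (s * c) * (a * b) ≡ c * ((s * a) * b)
  regroup = ℕSolver.solve-∀

leibniz-nonZero : ∀ x y → NonZero (leibniz x y)
leibniz-nonZero x y = m*n≢0⇒m≢0 (leibniz x y) {x ! * y !} {{subst NonZero (sym (leibniz-! x y)) ((suc x + y) !≢0)}}

leibniz-suc-y : ∀ x y → leibniz x (suc y) * suc y ≡ suc (suc x + y) * leibniz x y
leibniz-suc-y x y = *-cancelʳ-≡ _ _ (x ! * y !) {{x !* y !≢0}} (begin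
  leibniz x (suc y) * suc y * (x ! * y !)         ≡⟨ regroup (leibniz x (suc y)) (suc y) (x !) (y !) ⟩
  leibniz x (suc y) * (x ! * suc y !)             ≡⟨ leibniz-! x (suc y) ⟩
  (suc x + suc y) !                               ≡⟨ cong _! (+-suc (suc x) y) ⟩
  suc (suc x + y) * (suc x + y) !                 ≡⟨ cong (suc (suc x + y) *_) (sym (leibniz-! x y)) ⟩
  suc (suc x + y) * (leibniz x y * (x ! * y !))   ≡⟨ sym (*-assoc (suc (suc x + y)) (leibniz x y) (x ! * y !)) ⟩
  suc (suc x + y) * leibniz x y * (x ! * y !)     ∎)
  where
  open ≡-Reasoning
  regroup : ∀ l s a b → l * s * (a * b) ≡ l * (a * (s * b))
  regroup = ℕSolver.solve-∀

leibniz-suc-x : ∀ x y → leibniz (suc x) y * suc x ≡ suc (suc x + y) * leibniz x y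
leibniz-suc-x x y = *-cancelʳ-≡ _ _ (x ! * y !) {{x !* y !≢0}} (begin
  leibniz (suc x) y * suc x * (x ! * y !)         ≡⟨ regroup (leibniz (suc x) y) (suc x) (x !) (y !) ⟩
  leibniz (suc x) y * (suc x ! * y !)             ≡⟨ leibniz-! (suc x) y ⟩
  suc (suc x + y) * (suc x + y) !                 ≡⟨ cong (suc (suc x + y) *_) (sym (leibniz-! x y)) ⟩
  suc (suc x + y) * (leibniz x y * (x ! * y !))   ≡⟨ sym (*-assoc (suc (suc x + y)) (leibniz x y) (x ! * y !)) ⟩
  suc (suc x + y) * leibniz x y * (x ! * y !)     ∎)
  where
  open ≡-Reasoning
  regroup : ∀ l s a b → l * s * (a * b) ≡ l * ((s * a) * b)
  regroup = ℕSolver.solve-∀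

-- 1 / leibniz (x + 1) y = 1 / leibniz x y − 1 / leibniz x (y + 1), cleared of denominators.
leibniz-rule : ∀ x y → leibniz (suc x) y * leibniz x (suc y)
                     ≡ leibniz x y * leibniz x (suc y) + leibniz (suc x) y * leibniz x y
leibniz-rule x y = *-cancelʳ-≡ _ _ (suc x * suc y) {{_}} (begin
  γ * β * (suc x * suc y)                          ≡⟨ r₁ γ β (suc x) (suc y) ⟩
  (γ * suc x) * (β * suc y)                        ≡⟨ cong₂ _*_ (leibniz-suc-x x y) (leibniz-suc-y x y) ⟩
  (n * α) * (n * α)                                ≡⟨ cong (λ k → (n * α) * (k * α)) (sym (+-suc (suc x) y)) ⟩
  (n * α) * ((suc x + suc y) * α)                  ≡⟨ r₂ n α (suc x) (suc y) ⟩
  α * (n * α) * suc x + α * (n * α) * suc y        ≡⟨ cong₂ (λ s t → α * s * suc x + α * t * suc y) (sym (leibniz-suc-y x y)) (sym (leibniz-suc-x x y)) ⟩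
  α * (β * suc y) * suc x + α * (γ * suc x) * suc y ≡⟨ r₃ α β γ (suc x) (suc y) ⟩
  (α * β + γ * α) * (suc x * suc y)                ∎)
  where
  open ≡-Reasoning
  α β γ n : ℕ
  α = leibniz x y
  β = leibniz x (suc y)
  γ = leibniz (suc x) y
  n = suc (suc x + y)
  r₁ : ∀ g b s t → g * b * (s * t) ≡ (g * s) * (b * t)
  r₁ = ℕSolver.solve-∀
  r₂ : ∀ n a s t → (n * a) * ((s + t) * a) ≡ a * (n * a) * s + a * (n * a) * t
  r₂ = ℕSolver.solve-∀
  r₃ : ∀ a b g s t → a * (b * t) * s + a * (g * s) * t ≡ (a * b + g * a) * (s * t)
  r₃ = ℕSolver.solve-∀

-- With α, β, γ as named below, Λ / γ = Λ / α - Λ / β is a difference of integers.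
leibniz-step : ∀ x y Λ → leibniz x y ∣ Λ → leibniz x (suc y) ∣ Λ → leibniz (suc x) y ∣ Λ
leibniz-step x y Λ (divides s Λ≡sα) (divides t Λ≡tβ) = ∣m+n∣m⇒∣n (subst (γ ∣_) γs≡ (m∣m*n s)) (m∣m*n t)
  where
  open ≡-Reasoning
  α β γ : ℕ
  α = leibniz x y
  β = leibniz x (suc y)
  γ = leibniz (suc x) y
  γs≡ : γ * s ≡ γ * t + Λ
  γs≡ = *-cancelʳ-≡ _ _ (α * β) {{m*n≢0 α β {{leibniz-nonZero x y}} {{leibniz-nonZero x (suc y)}}}} (begin
    γ * s * (α * β)                          ≡⟨ r₁ γ s α β ⟩
    s * α * (γ * β)                          ≡⟨ cong₂ _*_ (sym Λ≡sα) (leibniz-rule x y) ⟩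
    Λ * (α * β + γ * α)                      ≡⟨ r₂ Λ α β γ ⟩
    Λ * (γ * α) + Λ * (α * β)                ≡⟨ cong (λ k → k * (γ * α) + Λ * (α * β)) Λ≡tβ ⟩
    t * β * (γ * α) + Λ * (α * β)            ≡⟨ r₃ Λ α β t γ ⟩
    (γ * t + Λ) * (α * β)                    ∎)
    where
    r₁ : ∀ g s a b → g * s * (a * b) ≡ s * a * (g * b)
    r₁ = ℕSolver.solve-∀
    r₂ : ∀ l a b g → l * (a * b + g * a) ≡ l * (g * a) + l * (a * b)
    r₂ = ℕSolver.solve-∀
    r₃ : ∀ l a b t g → t * b * (g * a) + l * (a * b) ≡ (g * t + l) * (a * b)
    r₃ = ℕSolver.solve-∀

-- The entries with x = 0 are y + 1. For larger x, `leibniz x (suc y)` lies in the same row as the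
-- entry sought and `leibniz x y` in the row before.
leibniz-∣-lcmUpTo : ∀ x y → leibniz x y ∣ lcmUpTo (suc x + y)
leibniz-∣-lcmUpTo zero y = subst (_∣ lcmUpTo (suc y)) (sym (trans (*-identityˡ _) (nC1≡n (suc y)))) (m∣lcm[m,n] (suc y) (lcmUpTo y))
leibniz-∣-lcmUpTo (suc x) y = leibniz-step x y _
  (∣-trans (leibniz-∣-lcmUpTo x y) (n∣lcm[m,n] (suc (suc x + y)) (lcmUpTo (suc x + y))))
  (subst (λ k → leibniz x (suc y) ∣ lcmUpTo k) (+-suc (suc x) y) (leibniz-∣-lcmUpTo x (suc y)))

-- Both sides are (j + 1 + n + z)! / (j! n! z!).
trinomial : ∀ j n z → leibniz j n * (((suc j + n) + z) C (suc j + n)) ≡ ((n + (suc j + z)) C n) * leibniz j z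
trinomial j n z = *-cancelʳ-≡ _ _ (j ! * n ! * z !) {{m*n≢0 (j ! * n !) (z !) {{j !* n !≢0}} {{z !≢0}}}} (begin
  leibniz j n * c₁ * (j ! * n ! * z !)           ≡⟨ r₁ (leibniz j n) c₁ (j !) (n !) (z !) ⟩
  c₁ * (leibniz j n * (j ! * n !) * z !)         ≡⟨ cong (λ k → c₁ * (k * z !)) (leibniz-! j n) ⟩
  c₁ * ((suc j + n) ! * z !)                     ≡⟨ C-! (suc j + n) z ⟩
  ((suc j + n) + z) !                            ≡⟨ cong _! (r₃ j n z) ⟩
  (n + (suc j + z)) !                            ≡⟨ sym (C-! n (suc j + z)) ⟩
  c₂ * (n ! * (suc j + z) !)                     ≡⟨ cong (λ k → c₂ * (n ! * k)) (sym (leibniz-! j z)) ⟩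
  c₂ * (n ! * (leibniz j z * (j ! * z !)))       ≡⟨ r₂ c₂ (leibniz j z) (j !) (n !) (z !) ⟩
  c₂ * leibniz j z * (j ! * n ! * z !)           ∎)
  where
  open ≡-Reasoning
  c₁ c₂ : ℕ
  c₁ = ((suc j + n) + z) C (suc j + n)
  c₂ = (n + (suc j + z)) C n
  r₁ : ∀ l c a b e → l * c * (a * b * e) ≡ c * (l * (a * b) * e)
  r₁ = ℕSolver.solve-∀
  r₂ : ∀ c l a b e → c * (b * (l * (a * e))) ≡ c * l * (a * b * e)
  r₂ = ℕSolver.solve-∀
  r₃ : ∀ j n z → (suc j + n) + z ≡ n + (suc j + z)
  r₃ = ℕSolver.solve-∀

∣-leibniz : ∀ j n → suc j + n ∣ leibniz j n
∣-leibniz j n = subst (suc j + n ∣_) (sym eq) (m∣m*n ((j + n) C j))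
  where
  open ≡-Reasoning
  eq : leibniz j n ≡ (suc j + n) * ((j + n) C j)
  eq = *-cancelʳ-≡ _ _ (j ! * n !) {{j !* n !≢0}} (begin
    leibniz j n * (j ! * n !)                      ≡⟨ leibniz-! j n ⟩
    (suc j + n) * (j + n) !                        ≡⟨ cong ((suc j + n) *_) (sym (C-! j n)) ⟩
    (suc j + n) * (((j + n) C j) * (j ! * n !))    ≡⟨ sym (*-assoc (suc j + n) ((j + n) C j) (j ! * n !)) ⟩
    (suc j + n) * ((j + n) C j) * (j ! * n !)      ∎)

-- For k = j + 1 + n > n write 2n = k + z, so that j + 1 + z = n. Then k divides `leibniz j n`;
-- `trinomial` trades this entry times C(2n, k) for C(2n, n) times `leibniz j z`, and the latter
-- entry divides lcm(1, ..., n).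
lcmUpTo-double : ∀ n → lcmUpTo (n + n) ∣ ((n + n) C n) * lcmUpTo n
lcmUpTo-double n = lcmUpTo-least (n + n) _ each
  where
  each : ∀ k → 1 ≤ k → k ≤ n + n → k ∣ ((n + n) C n) * lcmUpTo n
  each k 1≤k k≤2n with k ≤? n
  ... | yes k≤n = ∣n⇒∣m*n ((n + n) C n) (∣lcmUpTo n k 1≤k k≤n)
  ... | no  k≰n with m≤n⇒∃[o]m+o≡n (≰⇒> k≰n)
  ...   | j , refl with m≤n⇒∃[o]m+o≡n (+-cancelˡ-≤ n (suc j) n (subst (_≤ n + n) (sym (+-suc n j)) k≤2n))
  ...     | z , eq = subst (λ k → k ∣ ((n + n) C n) * lcmUpTo n) (cong suc (+-comm j n))
    (∣-trans (∣m⇒∣m*n (((suc j + n) + z) C (suc j + n)) (∣-leibniz j n))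
      (subst (_∣ ((n + n) C n) * lcmUpTo n) (sym (trinomial j n z))
        (subst (λ k → ((n + k) C n) * leibniz j z ∣ ((n + n) C n) * lcmUpTo n) (sym eq)
          (*-monoʳ-∣ ((n + n) C n) (subst (λ k → leibniz j z ∣ lcmUpTo k) eq (leibniz-∣-lcmUpTo j z))))))

halve : ∀ n → ∃[ k ] (n ≡ k + k ⊎ n ≡ suc (k + k))
halve zero = 0 , inj₁ refl
halve (suc n) with halve n
... | k , inj₁ refl = k , inj₂ refl
... | k , inj₂ refl = suc k , inj₁ (cong suc (sym (+-suc k k)))

lcm≤* : ∀ m n → NonZero m → NonZero n → lcm m n ≤ m * n
lcm≤* m n m≢0 n≢0 = ∣⇒≤ {{m*n≢0 m n {{m≢0}} {{n≢0}}}} (lcm-least (m∣m*n {m} n) (n∣m*n m {n}))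

1+2k≤4^k : ∀ k → suc (k + k) ≤ 4 ^ k
1+2k≤4^k zero    = ≤-refl
1+2k≤4^k (suc k) = ≤-trans (≤-trans (m≤m+n (suc (suc k + suc k)) (6 * k + 1)) (≤-reflexive (regroup k))) (*-monoʳ-≤ 4 (1+2k≤4^k k))
  where
  regroup : ∀ k → suc (suc k + suc k) + (6 * k + 1) ≡ 4 * suc (k + k)
  regroup = ℕSolver.solve-∀

-- At n = 2k the recursion gives 4ᵏ · 16ᵏ = 64ᵏ, while 256ᵏ is allowed; the spare factor 4ᵏ pays for
-- 2k + 1 in the odd case.
lcmUpTo-≤ : ∀ n → lcmUpTo n ≤ 16 ^ n
lcmUpTo-≤ n = go n n ≤-refl
  where
  open ≤-Reasoning
  double : ∀ k → lcmUpTo k ≤ 16 ^ k → lcmUpTo (k + k) ≤ 64 ^ k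
  double k IH = begin
    lcmUpTo (k + k)                ≤⟨ ∣⇒≤ {{m*n≢0 _ _ {{C≢0}} {{lcmUpTo-nonZero k}}}} (lcmUpTo-double k) ⟩
    ((k + k) C k) * lcmUpTo k      ≤⟨ *-mono-≤ (C≤2^ (k + k) k) IH ⟩
    2 ^ (k + k) * 16 ^ k           ≡⟨ cong (_* 16 ^ k) (^-double 2 k) ⟩
    4 ^ k * 16 ^ k                 ≡⟨ sym (^-distrib-* k 4 16) ⟩
    64 ^ k                         ∎
    where
    C≢0 : NonZero ((k + k) C k)
    C≢0 = m*n≢0⇒m≢0 ((k + k) C k) {k ! * k !} {{subst NonZero (sym (C-! k k)) ((k + k) !≢0)}}
  go : ∀ b n → n ≤ b → lcmUpTo n ≤ 16 ^ n
  go b zero n≤b = ≤-refl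
  go (suc b) (suc n) (s≤s n≤b) with halve (suc n)
  ... | zero  , inj₁ ()
  ... | suc k , inj₁ eq = begin
    lcmUpTo (suc n)                ≡⟨ cong lcmUpTo eq ⟩
    lcmUpTo (suc k + suc k)        ≤⟨ double (suc k) (go b (suc k) (≤-trans (≤-trans (m≤n+m (suc k) k) (≤-reflexive (suc-injective (sym eq)))) n≤b)) ⟩
    64 ^ suc k                     ≤⟨ ^-monoˡ-≤ (suc k) (m≤m+n 64 192) ⟩
    256 ^ suc k                    ≡⟨ sym (^-double 16 (suc k)) ⟩
    16 ^ (suc k + suc k)           ≡⟨ cong (16 ^_) (sym eq) ⟩
    16 ^ suc n                     ∎
  ... | k , inj₂ eq = begin
    lcmUpTo (suc n)                ≡⟨ cong lcmUpTo eq ⟩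
    lcmUpTo (suc (k + k))          ≤⟨ lcm≤* (suc (k + k)) (lcmUpTo (k + k)) _ (lcmUpTo-nonZero (k + k)) ⟩
    suc (k + k) * lcmUpTo (k + k)  ≤⟨ *-mono-≤ (1+2k≤4^k k) (double k (go b k (≤-trans (≤-trans (m≤m+n k k) (≤-reflexive (suc-injective (sym eq)))) n≤b))) ⟩
    4 ^ k * 64 ^ k                 ≡⟨ sym (^-distrib-* k 4 64) ⟩
    256 ^ k                        ≡⟨ sym (^-double 16 k) ⟩
    16 ^ (k + k)                   ≤⟨ ^-monoʳ-≤ 16 (n≤1+n (k + k)) ⟩
    16 ^ suc (k + k)               ≡⟨ cong (16 ^_) (sym eq) ⟩
    16 ^ suc n                     ∎

∏-rising : ∀ n k → ∏ k (λ i → suc n + i) * n ! ≡ (n + k) !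
∏-rising n zero    = trans (*-identityˡ (n !)) (cong _! (sym (+-identityʳ n)))
∏-rising n (suc k) = begin
  ∏ (suc k) (λ i → suc n + i) * n !           ≡⟨ cong (_* n !) (∏-last k (λ i → suc n + i)) ⟩
  ∏ k (λ i → suc n + i) * (suc n + k) * n !   ≡⟨ regroup (∏ k (λ i → suc n + i)) (suc n + k) (n !) ⟩
  (suc n + k) * (∏ k (λ i → suc n + i) * n !) ≡⟨ cong ((suc n + k) *_) (∏-rising n k) ⟩
  (suc n + k) !                               ≡⟨ cong _! (sym (+-suc n k)) ⟩
  (n + suc k) !                               ∎
  where
  open ≡-Reasoning
  regroup : ∀ p s f → p * s * f ≡ s * (p * f)
  regroup = ℕSolver.solve-∀

-- Each factor of (n + 1) ⋯ (2n) = C(2n, n) n! is larger than n.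
n^n≤4^n*n! : ∀ n → n ^ n ≤ 4 ^ n * n !
n^n≤4^n*n! n = begin
  n ^ n                        ≡⟨ sym (∏-const n n) ⟩
  ∏ n (λ _ → n)                ≤⟨ ∏-mono n (λ i _ → ≤-trans (n≤1+n n) (m≤m+n (suc n) i)) ⟩
  ∏ n (λ i → suc n + i)        ≡⟨ *-cancelʳ-≡ _ _ (n !) {{n !≢0}} (trans (∏-rising n n) (trans (sym (C-! n n)) (sym (*-assoc ((n + n) C n) (n !) (n !))))) ⟩
  ((n + n) C n) * n !          ≤⟨ *-monoˡ-≤ (n !) (C≤2^ (n + n) n) ⟩
  2 ^ (n + n) * n !            ≡⟨ cong (_* n !) (trans (^-distribˡ-+-* 2 n n) (sym (^-distrib-* n 2 2))) ⟩
  4 ^ n * n !                  ∎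
  where open ≤-Reasoning

∏-suc≡! : ∀ n → ∏ n suc ≡ n !
∏-suc≡! n = trans (sym (*-identityʳ _)) (∏-rising 0 n)

∏-∸≡! : ∀ n → ∏ n (λ i → n ∸ i) ≡ n !
∏-∸≡! zero    = refl
∏-∸≡! (suc n) = cong (suc n *_) (∏-∸≡! n)

-- Induction on `M`: `T` grows by 1 only when its power has become too small, and T + 1 ≤ 2T then
-- accounts for the factor 2^{d + 1}.
root-bounds : ∀ d M → 1 ≤ M → ∃[ T ] (1 ≤ T × M ≤ T ^ suc d × T ^ suc d ≤ 2 ^ suc d * M)
root-bounds d (suc zero) 1≤M = 1 , ≤-refl , 1≤^ ≤-refl (suc d) ,
  ≤-trans (≤-reflexive (^-zeroˡ (suc d))) (≤-trans (m^n>0 2 (suc d)) (m≤m*n (2 ^ suc d) 1))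
root-bounds d (suc (suc M)) 1≤M with root-bounds d (suc M) (s≤s z≤n)
... | T , 1≤T , M≤T , T≤ with suc (suc M) ≤? T ^ suc d
...   | yes M+1≤ = T , 1≤T , M+1≤ , ≤-trans T≤ (*-monoʳ-≤ (2 ^ suc d) (n≤1+n (suc M)))
...   | no  M+1≰ = suc T , s≤s z≤n
  , ≤-trans (s≤s M≤T) (^-monoˡ-< (suc d) (n<1+n T))
  , ≤-trans (^-monoˡ-≤ (suc d) 1+T≤2T) (≤-trans (≤-reflexive (^-distrib-* (suc d) 2 T))
      (*-monoʳ-≤ (2 ^ suc d) (<⇒≤ (≰⇒> M+1≰))))
  where
  1+T≤2T : suc T ≤ 2 * T
  1+T≤2T = ≤-trans (+-monoˡ-≤ T 1≤T) (≤-reflexive (cong (T +_) (sym (+-identityʳ T))))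

^-cancelˡ-≤ : ∀ k x y → NonZero k → x ^ k ≤ y ^ k → x ≤ y
^-cancelˡ-≤ k x y k≢0 x^k≤y^k with x ≤? y
... | yes x≤y = x≤y
... | no  x≰y = contradiction (≤-trans (^-monoˡ-< k {{k≢0}} (≰⇒> x≰y)) x^k≤y^k) (n≮n _)

+-^-≤ : ∀ m a b → 1 ≤ m → a ^ m + b ^ m ≤ (a + b) ^ m
+-^-≤ (suc zero) a b _ = ≤-reflexive (regroup a b)
  where
  regroup : ∀ a b → a * 1 + b * 1 ≡ (a + b) * 1
  regroup = ℕSolver.solve-∀
+-^-≤ (suc (suc m)) a b _ = ≤-trans
  (+-mono-≤ (*-monoʳ-≤ a (^-monoˡ-≤ (suc m) (m≤m+n a b))) (*-monoʳ-≤ b (^-monoˡ-≤ (suc m) (m≤n+m b a))))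
  (≤-reflexive (sym (*-distribʳ-+ ((a + b) ^ suc m) a b)))

-- Sizes of polynomial values

height : Poly → ℕ
height []      = 0
height (a ∷ p) = ∣ a ∣ + height p

∣coeff∣≤height : ∀ p i → ∣ coeff p i ∣ ≤ height p
∣coeff∣≤height []      i       = z≤n
∣coeff∣≤height (a ∷ p) zero    = m≤m+n ∣ a ∣ (height p)
∣coeff∣≤height (a ∷ p) (suc i) = ≤-trans (∣coeff∣≤height p i) (m≤n+m (height p) ∣ a ∣)

∣eval∣*n≤ : ∀ p n → 1 ≤ n → ∣ eval p (pos n) ∣ * n ≤ height p * n ^ length p
∣eval∣*n≤ []      n 1≤n = z≤n
∣eval∣*n≤ (a ∷ p) n 1≤n = begin
  ∣ a +ℤ pos n *ℤ eval p (pos n) ∣ * n          ≤⟨ *-monoˡ-≤ n (ℤₚ.∣i+j∣≤∣i∣+∣j∣ a (pos n *ℤ eval p (pos n))) ⟩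
  (∣ a ∣ + ∣ pos n *ℤ eval p (pos n) ∣) * n     ≡⟨ cong (λ k → (∣ a ∣ + k) * n) (ℤₚ.abs-* (pos n) (eval p (pos n))) ⟩
  (∣ a ∣ + n * ∣ eval p (pos n) ∣) * n          ≡⟨ r₁ (∣ a ∣) n (∣ eval p (pos n) ∣) ⟩
  ∣ a ∣ * (n * 1) + n * (∣ eval p (pos n) ∣ * n) ≤⟨ +-mono-≤ (*-monoʳ-≤ ∣ a ∣ (*-monoʳ-≤ n (1≤^ 1≤n (length p)))) (*-monoʳ-≤ n (∣eval∣*n≤ p n 1≤n)) ⟩
  ∣ a ∣ * (n * n ^ length p) + n * (height p * n ^ length p) ≡⟨ r₂ (∣ a ∣) n (n ^ length p) (height p) ⟩
  (∣ a ∣ + height p) * (n * n ^ length p)       ∎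
  where
  open ≤-Reasoning
  r₁ : ∀ a n e → (a + n * e) * n ≡ a * (n * 1) + n * (e * n)
  r₁ = ℕSolver.solve-∀
  r₂ : ∀ a n l h → a * (n * l) + n * (h * l) ≡ (a + h) * (n * l)
  r₂ = ℕSolver.solve-∀

eval-monic : ∀ p n → eval (p ++ [ 1ℤ ]) (pos n) ≡ eval p (pos n) +ℤ pos (n ^ length p)
eval-monic []      n = cong (1ℤ +ℤ_) (ℤₚ.*-zeroʳ (pos n))
eval-monic (a ∷ p) n rewrite eval-monic p n | ℤₚ.pos-* n (n ^ length p) = regroup a (pos n) (eval p (pos n)) (pos (n ^ length p))
  where
  regroup : ∀ a x P X → a +ℤ x *ℤ (P +ℤ X) ≡ (a +ℤ x *ℤ P) +ℤ x *ℤ X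
  regroup = ℤSolver.solve-∀

-- Beyond twice the height the leading term dominates and 2 suffices. Below it `n ^ length p` is
-- bounded and the value is at least 1. The constant adds up both cases.
monic-lower-bound : ∀ p n → 1 ≤ n → 1 ≤ ∣ eval (p ++ [ 1ℤ ]) (pos n) ∣ →
                    n ^ length p ≤ (2 + (2 * height p) ^ length p) * ∣ eval (p ++ [ 1ℤ ]) (pos n) ∣
monic-lower-bound p n 1≤n 1≤f with n ≤? 2 * height p
... | yes n≤2h = begin
  n ^ length p                                   ≤⟨ ^-monoˡ-≤ (length p) n≤2h ⟩
  (2 * height p) ^ length p                      ≤⟨ m≤n+m _ 2 ⟩
  2 + (2 * height p) ^ length p                  ≡⟨ sym (*-identityʳ _) ⟩
  (2 + (2 * height p) ^ length p) * 1            ≤⟨ *-monoʳ-≤ (2 + (2 * height p) ^ length p) 1≤f ⟩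
  (2 + (2 * height p) ^ length p) * ∣ eval (p ++ [ 1ℤ ]) (pos n) ∣ ∎
  where open ≤-Reasoning
... | no n≰2h = ≤-trans top≤2f (*-monoˡ-≤ (∣ F ∣) (m≤m+n 2 ((2 * height p) ^ length p)))
  where
  open ≤-Reasoning
  F P : ℤ
  F = eval (p ++ [ 1ℤ ]) (pos n)
  P = eval p (pos n)
  X : ℕ
  X = n ^ length p
  2P≤X : 2 * ∣ P ∣ ≤ X
  2P≤X = *-cancelʳ-≤ _ _ n {{>-nonZero 1≤n}} (begin
    2 * ∣ P ∣ * n          ≡⟨ *-assoc 2 (∣ P ∣) n ⟩
    2 * (∣ P ∣ * n)        ≤⟨ *-monoʳ-≤ 2 (∣eval∣*n≤ p n 1≤n) ⟩
    2 * (height p * X)     ≡⟨ sym (*-assoc 2 (height p) X) ⟩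
    2 * height p * X       ≤⟨ *-monoˡ-≤ X (<⇒≤ (≰⇒> n≰2h)) ⟩
    n * X                  ≡⟨ *-comm n X ⟩
    X * n                  ∎)
  X≤F+P : X ≤ ∣ F ∣ + ∣ P ∣
  X≤F+P = ≤-trans (≤-reflexive (cong ∣_∣ (trans (cancel (pos X) P) (cong (_-ℤ P) (sym (eval-monic p n)))))) (ℤₚ.∣i-j∣≤∣i∣+∣j∣ F P)
    where
    cancel : ∀ x P → x ≡ P +ℤ x -ℤ P
    cancel = ℤSolver.solve-∀
  top≤2f : X ≤ 2 * ∣ F ∣
  top≤2f = +-cancelʳ-≤ X X (2 * ∣ F ∣) (begin
    X + X                     ≡⟨ cong (X +_) (sym (+-identityʳ X)) ⟩
    2 * X                     ≤⟨ *-monoʳ-≤ 2 X≤F+P ⟩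
    2 * (∣ F ∣ + ∣ P ∣)       ≡⟨ *-distribˡ-+ 2 (∣ F ∣) (∣ P ∣) ⟩
    2 * ∣ F ∣ + 2 * ∣ P ∣     ≤⟨ +-monoʳ-≤ (2 * ∣ F ∣) 2P≤X ⟩
    2 * ∣ F ∣ + X             ∎)

evalBase : Poly → ℕ
evalBase []      = 0
evalBase (a ∷ p) = ∣ a ∣ + 2 * evalBase p

-- An exponential bound is enough for the primes dividing `D`, as it disappears in Kᴺ. It rests on m
-- ≤ 2ᵐ and aᵐ + bᵐ ≤ (a + b)ᵐ.
∣eval∣≤evalBase^ : ∀ p m x → 1 ≤ m → ∣ x ∣ ≤ m → ∣ eval p x ∣ ≤ evalBase p ^ m
∣eval∣≤evalBase^ []      m       x 1≤m x≤m = z≤n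
∣eval∣≤evalBase^ (a ∷ p) m x 1≤m x≤m = begin
  ∣ a +ℤ x *ℤ eval p x ∣               ≤⟨ ℤₚ.∣i+j∣≤∣i∣+∣j∣ a (x *ℤ eval p x) ⟩
  ∣ a ∣ + ∣ x *ℤ eval p x ∣            ≡⟨ cong (∣ a ∣ +_) (ℤₚ.abs-* x (eval p x)) ⟩
  ∣ a ∣ + ∣ x ∣ * ∣ eval p x ∣         ≤⟨ +-mono-≤ (n≤n^m ∣ a ∣ m 1≤m) (*-mono-≤ (≤-trans x≤m (<⇒≤ (n<2^n m))) (∣eval∣≤evalBase^ p m x 1≤m x≤m)) ⟩
  ∣ a ∣ ^ m + 2 ^ m * evalBase p ^ m   ≡⟨ cong (∣ a ∣ ^ m +_) (sym (^-distrib-* m 2 (evalBase p))) ⟩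
  ∣ a ∣ ^ m + (2 * evalBase p) ^ m     ≤⟨ +-^-≤ m ∣ a ∣ (2 * evalBase p) 1≤m ⟩
  (∣ a ∣ + 2 * evalBase p) ^ m         ∎
  where
  open ≤-Reasoning
  n≤n^m : ∀ n m → 1 ≤ m → n ≤ n ^ m
  n≤n^m zero    m       1≤m = z≤n
  n≤n^m (suc n) (suc m) 1≤m = m≤m*n (suc n) (suc n ^ m) {{m^n≢0 (suc n) m}}

-- Valuations and weights

count-elim : ∀ {P : ℕ → Set} (R : ℕ → Set) n (P? : ∀ i → Dec (P i)) → (∀ i → P (suc i) → P i) →
             R 0 → (∀ k → P k → R (suc k)) → R (count n P?)
count-elim R n P? down r0 r+ = go (count n P?) (λ k k<c → count-holds n P? down k k<c)
  where
  go : ∀ c → (∀ k → k < c → _) → R c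
  go zero    holds = r0
  go (suc k) holds = r+ k (holds k ≤-refl)

-- The p-adic valuation of `n`, cut off at `B` and 0 if `A` fails. With `A` saying that p is prime,
-- or good, products can run over all p.
valuation : {A : Set} → ℕ → Dec A → ℕ → ℕ → ℕ
valuation B A? p n = count B (λ k → A? ×-dec (p ^ suc k ∣? n))

valuation-holds : ∀ {A : Set} B (A? : Dec A) p n k → k < valuation B A? p n → A × p ^ suc k ∣ n
valuation-holds B A? p n = count-holds B (λ k → A? ×-dec (p ^ suc k ∣? n))
  (λ k → λ { (a , p∣n) → a , ∣-trans (n∣m*n p) p∣n })

^valuation∣ : ∀ {A : Set} B (A? : Dec A) p n → p ^ valuation B A? p n ∣ n
^valuation∣ B A? p n = count-elim (λ c → p ^ c ∣ n) B (λ k → A? ×-dec (p ^ suc k ∣? n))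
  (λ k → λ { (a , p∣n) → a , ∣-trans (n∣m*n p) p∣n }) (1∣ n) (λ k → proj₂)

^-monoʳ-∣ : ∀ p {m n} → m ≤ n → p ^ m ∣ p ^ n
^-monoʳ-∣ p {n = n} z≤n       = 1∣ (p ^ n)
^-monoʳ-∣ p         (s≤s m≤n) = *-monoʳ-∣ p (^-monoʳ-∣ p m≤n)

valuation-≥ : ∀ {A : Set} B (A? : Dec A) p n c → c ≤ B → A → p ^ c ∣ n → c ≤ valuation B A? p n
valuation-≥ B A? p n c c≤B a p^c∣n = ≤count B (λ k → A? ×-dec (p ^ suc k ∣? n)) c c≤B
  (λ k k<c → a , ∣-trans (^-monoʳ-∣ p k<c) p^c∣n)

valuation-mono : ∀ {A A′ : Set} B (A? : Dec A) (A′? : Dec A′) p n n′ → (A → A′) → n ∣ n′ →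
                 valuation B A? p n ≤ valuation B A′? p n′
valuation-mono B A? A′? p n n′ A⇒A′ n∣n′ = ∑-mono B (λ k _ → ind-mono (A? ×-dec (p ^ suc k ∣? n)) (A′? ×-dec (p ^ suc k ∣? n′))
  (λ { (a , p∣n) → A⇒A′ a , ∣-trans p∣n n∣n′ }))

primePower : ℕ → ℕ → ℕ → ℕ
primePower B n p′ = suc p′ ^ valuation B (prime? (suc p′)) (suc p′) n

-- `Y` limits the primes and `B` the valuations; both stay fixed while the list shrinks. Each prime
-- p of the list raises its own valuation, and by `∏-bump` multiplies one factor by p.
product≤∏primePower : ∀ Y B ps → All Prime ps → product ps ≤ Y → product ps ≤ B →
                      product ps ≤ ∏ Y (primePower B (product ps))
product≤∏primePower Y B [] [] _ _ = 1≤∏ Y (primePower B 1) (λ i _ → m^n>0 (suc i) (valuation B (prime? (suc i)) (suc i) 1))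
product≤∏primePower Y B (zero ∷ ps) (p-prime ∷ _) _ _ = contradiction p-prime ¬prime[0]
product≤∏primePower Y B (p@(suc p′) ∷ ps) (p-prime ∷ ps-prime) n≤Y n≤B = ≤-trans
  (*-monoʳ-≤ p (product≤∏primePower Y B ps ps-prime (≤-trans n′≤n n≤Y) (≤-trans n′≤n n≤B)))
  (∏-bump Y p p′ (primePower B n′) (primePower B (p * n′)) (≤-trans (m≤m*n p n′) n≤Y)
    (λ i → ^-monoʳ-≤ (suc i) (valuation-mono B (prime? (suc i)) (prime? (suc i)) (suc i) n′ (p * n′) id (n∣m*n p)))
    (^-monoʳ-≤ p (valuation-≥ B (prime? p) p (p * n′) (suc v) 1+v≤B p-prime (*-monoʳ-∣ p (^valuation∣ B (prime? p) p n′)))))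
  where
  n′ v : ℕ
  n′ = product ps
  v = valuation B (prime? p) p n′
  instance
    n′≢0 : NonZero n′
    n′≢0 = productOfPrimes≢0 ps-prime
  n′≤n : n′ ≤ p * n′
  n′≤n = m≤n*m n′ p
  -- The cutoff does not interfere with the new valuation.
  1+v≤B : suc v ≤ B
  1+v≤B = begin
    suc v          ≤⟨ n<2^n v ⟩
    2 ^ v          ≤⟨ ^-monoˡ-≤ v (nonTrivial⇒n>1 p {{prime⇒nonTrivial p-prime}}) ⟩
    p ^ v          ≤⟨ ∣⇒≤ (^valuation∣ B (prime? p) p n′) ⟩
    n′             ≤⟨ n′≤n ⟩
    p * n′         ≤⟨ n≤B ⟩
    B              ∎
    where open ≤-Reasoning

n≤∏primePower : ∀ B n → NonZero n → n ≤ B → n ≤ ∏ B (primePower B n)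
n≤∏primePower B n n≢0 n≤B with factorise n {{n≢0}}
... | record { factors = ps ; isFactorisation = refl ; factorsPrime = ps-prime } =
  product≤∏primePower B B ps ps-prime n≤B n≤B

-- Different hits are at least q / D apart. `go` telescopes these gaps up to the last hit; the
-- summand `q` pays for the first one.
count-gap : ∀ {P : ℕ → Set} (P? : ∀ i → Dec (P i)) q D → (∀ i i′ → P i → P i′ → i < i′ → q ≤ D * (i′ ∸ i)) →
            ∀ M → q * count (suc M) P? ≤ D * M + q
count-gap {P} P? q D gap M with go (suc M)
  where
  open ≤-Reasoning
  go : ∀ n → count n P? ≡ 0 ⊎ ∃[ i ] (i < n × P i × q * count n P? ≤ D * i + q)
  go zero = inj₁ refl
  go (suc n) rewrite ∑-last n (λ i → ind (P? i)) with P? n | go n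
  ... | no  _  | inj₁ none = inj₁ (trans (+-identityʳ _) none)
  ... | no  _  | inj₂ (i , i<n , Pi , le) = inj₂ (i , m<n⇒m<1+n i<n , Pi , subst (λ c → q * c ≤ D * i + q) (sym (+-identityʳ _)) le)
  ... | yes Pn | inj₁ none = inj₂ (n , ≤-refl , Pn , subst (λ c → q * (c + 1) ≤ D * n + q) (sym none) (subst (_≤ D * n + q) (sym (*-identityʳ q)) (m≤n+m q (D * n))))
  ... | yes Pn | inj₂ (i , i<n , Pi , le) = inj₂ (n , ≤-refl , Pn , (begin
    q * (count n P? + 1)         ≡⟨ *-distribˡ-+ q (count n P?) 1 ⟩
    q * count n P? + q * 1       ≤⟨ +-mono-≤ le (≤-trans (≤-reflexive (*-identityʳ q)) (gap i n Pi Pn i<n)) ⟩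
    (D * i + q) + D * (n ∸ i)    ≡⟨ regroup (D * i) q (D * (n ∸ i)) ⟩
    (D * i + D * (n ∸ i)) + q    ≡⟨ cong (_+ q) (trans (sym (*-distribˡ-+ D i (n ∸ i))) (cong (D *_) (m+[n∸m]≡n (<⇒≤ i<n)))) ⟩
    D * n + q                    ∎))
    where
    regroup : ∀ a b c → (a + b) + c ≡ (a + c) + b
    regroup = ℕSolver.solve-∀
... | inj₁ none = subst (λ c → q * c ≤ D * M + q) (sym none) (subst (_≤ D * M + q) (sym (*-zeroʳ q)) z≤n)
... | inj₂ (i , s≤s i≤M , _ , le) = ≤-trans le (+-monoˡ-≤ q (*-monoʳ-≤ D i≤M))

-- The series X / 2 + X / 4 + ... without division: the doubled tail satisfies the same hypothesis.
∑-geometric : ∀ e X t → (∀ k → k < e → 2 ^ suc k * t k ≤ X) → ∑ e t ≤ X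
∑-geometric zero    X t t≤ = z≤n
∑-geometric (suc e) X t t≤ = *-cancelˡ-≤ 2 (begin
  2 * (t 0 + ∑ e (t ∘ suc))                    ≡⟨ *-distribˡ-+ 2 (t 0) (∑ e (t ∘ suc)) ⟩
  2 * t 0 + 2 * ∑ e (t ∘ suc)                  ≤⟨ +-mono-≤ (t≤ 0 z<s) tail≤ ⟩
  X + X                                        ≡⟨ cong (X +_) (sym (+-identityʳ X)) ⟩
  2 * X                                        ∎)
  where
  open ≤-Reasoning
  regroup : ∀ b t → b * (2 * t) ≡ 2 * b * t
  regroup = ℕSolver.solve-∀
  tail≤ : 2 * ∑ e (t ∘ suc) ≤ X
  tail≤ = subst (_≤ X) (∑-* e 2 (t ∘ suc)) (∑-geometric e X (λ k → 2 * t (suc k))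
    (λ k k<e → subst (_≤ X) (sym (regroup (2 ^ suc k) (t (suc k)))) (t≤ (suc k) (s<s k<e))))

2mn≤m²+n² : ∀ m n → 2 * m * n ≤ n * n + m * m
2mn≤m²+n² m n with ≤-total m n
... | inj₁ m≤n with m≤n⇒∃[o]m+o≡n m≤n
...   | k , refl = ≤-trans (m≤m+n _ (k * k)) (≤-reflexive (expand m k))
  where
  expand : ∀ m k → 2 * m * (m + k) + k * k ≡ (m + k) * (m + k) + m * m
  expand = ℕSolver.solve-∀
2mn≤m²+n² m n | inj₂ n≤m with m≤n⇒∃[o]m+o≡n n≤m
...   | k , refl = ≤-trans (m≤m+n _ (k * k)) (≤-reflexive (expand n k))
  where
  expand : ∀ n k → 2 * (n + k) * n + k * k ≡ n * n + (n + k) * (n + k)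
  expand = ℕSolver.solve-∀

-- Summing (c_x − t)² ≥ 0 over the residue classes x, where c_x counts the a with ρ a = x.
collisions-≥ : ∀ M q t (ρ : ℕ → ℕ) → (∀ a → ρ a < q) → q * t ≤ M →
               M * t ≤ ∑ M (λ a → ∑ M (λ b → ind (ρ b ≟ ρ a)))
collisions-≥ M q t ρ ρ<q qt≤M = +-cancelʳ-≤ (M * t) _ _ (begin
  M * t + M * t                                ≡⟨ r₁ M t ⟩
  2 * t * M                                    ≡⟨ cong (2 * t *_) (sym ∑c≡M) ⟩
  2 * t * ∑ q c                                ≡⟨ sym (∑-* q (2 * t) c) ⟩
  ∑ q (λ x → 2 * t * c x)                      ≤⟨ ∑-mono q (λ x _ → 2mn≤m²+n² t (c x)) ⟩
  ∑ q (λ x → c x * c x + t * t)                ≡⟨ ∑-+ q (λ x → c x * c x) (λ _ → t * t) ⟩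
  ∑ q (λ x → c x * c x) + ∑ q (λ _ → t * t)    ≡⟨ cong₂ _+_ ∑c²≡ (∑-const q (t * t)) ⟩
  ∑ M (λ a → c (ρ a)) + q * (t * t)            ≤⟨ +-monoʳ-≤ _ (≤-trans (≤-reflexive (sym (*-assoc q t t))) (*-monoˡ-≤ t qt≤M)) ⟩
  ∑ M (λ a → c (ρ a)) + M * t                  ∎)
  where
  open ≤-Reasoning
  c : ℕ → ℕ
  c x = ∑ M (λ b → ind (ρ b ≟ x))
  r₁ : ∀ m t → m * t + m * t ≡ 2 * t * m
  r₁ = ℕSolver.solve-∀
  ∑c≡M : ∑ q c ≡ M
  ∑c≡M = trans (∑-swap q M (λ x b → ind (ρ b ≟ x)))
    (trans (∑-cong M (λ b _ → trans (∑-cong q (λ x _ → sym (*-identityʳ (ind (ρ b ≟ x))))) (∑-pick q (ρ b) (λ _ → 1) (ρ<q b))))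
      (trans (∑-const M 1) (*-identityʳ M)))
  ∑c²≡ : ∑ q (λ x → c x * c x) ≡ ∑ M (λ a → c (ρ a))
  ∑c²≡ = trans (∑-cong q (λ x _ → trans (*-comm (c x) (c x)) (sym (∑-* M (c x) (λ b → ind (ρ b ≟ x))))))
    (trans (∑-swap q M (λ x b → c x * ind (ρ b ≟ x)))
      (∑-cong M (λ b _ → trans (∑-cong q (λ x _ → *-comm (c x) (ind (ρ b ≟ x)))) (∑-pick q (ρ b) c (ρ<q b)))))

-- Zero off the class, so that `argmax` and sums over the whole interval serve for a single class.
restrict : (c x : ℕ) .{{_ : NonZero c}} → (ℕ → ℕ) → ℕ → ℕ
restrict c x v i = ind (i % c ≟ x) * v i

restrict-< : ∀ c x .{{_ : NonZero c}} v i k → k < restrict c x v i → i % c ≡ x × k < v i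
restrict-< c x v i k k< with i % c ≟ x
... | yes i≡x = i≡x , subst (k <_) (+-identityʳ (v i)) k<

∑-restrict : ∀ m Y c .{{_ : NonZero c}} v → c ≤ Y → ∑ m v ≡ ∑ Y (λ x → ∑ m (restrict c x v))
∑-restrict m Y c v c≤Y = trans
  (∑-cong m (λ i _ → sym (∑-pick Y (i % c) (λ _ → v i) (≤-trans (m%n<n i c) c≤Y))))
  (∑-swap m Y (λ i x → restrict c x v i))

-- Layer-cake summation: `u i` is the number of levels k < `u i`, and the order of summation is
-- exchanged.
∑-≤-levels : ∀ {Q : ℕ → ℕ → Set} (Q? : ∀ i k → Dec (Q i k)) m e u → (∀ i → i < m → u i ≤ e) →
             (∀ i k → i < m → k < u i → Q i k) → ∑ m u ≤ ∑ e (λ k → count m (λ i → Q? i k))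
∑-≤-levels Q? m e u u≤e uQ = ≤-trans
  (∑-mono m (λ i i<m → ≤count e (Q? i) (u i) (u≤e i i<m) (λ k → uQ i k i<m)))
  (≤-reflexive (∑-swap m e (λ i k → ind (Q? i k))))

-- Products of powers in place of sums of logarithms

module Weights {I : Set} (base : I → ℕ) (base≥1 : ∀ i → 1 ≤ base i) (is : List I) where

  -- The exponential of the linear form Σ x i · log (base i); a pointwise inequality between
  -- exponents becomes one between products.
  weight : (I → ℕ) → ℕ
  weight x = product (map (λ i → base i ^ x i) is)

  weight-+ : ∀ x y → weight (λ i → x i + y i) ≡ weight x * weight y
  weight-+ x y = go is
    where
    interchange : ∀ a b c d → a * b * (c * d) ≡ (a * c) * (b * d)
    interchange = ℕSolver.solve-∀
    go : ∀ is → product (map (λ i → base i ^ (x i + y i)) is)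
              ≡ product (map (λ i → base i ^ x i) is) * product (map (λ i → base i ^ y i) is)
    go []       = refl
    go (i ∷ is) = trans (cong₂ _*_ (^-distribˡ-+-* (base i) (x i) (y i)) (go is)) (interchange (base i ^ x i) (base i ^ y i) _ _)

  weight-mono : ∀ {x y} → (∀ i → x i ≤ y i) → weight x ≤ weight y
  weight-mono {x} {y} x≤y = go is
    where
    go : ∀ is → product (map (λ i → base i ^ x i) is) ≤ product (map (λ i → base i ^ y i) is)
    go []       = ≤-refl
    go (i ∷ is) = *-mono-≤ (^-monoʳ-≤ (base i) {{>-nonZero (base≥1 i)}} (x≤y i)) (go is)

  weight-0 : weight (λ _ → 0) ≡ 1
  weight-0 = go is
    where
    go : ∀ is → product (map (λ i → base i ^ 0) is) ≡ 1
    go []       = refl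
    go (i ∷ is) = trans (*-identityˡ _) (go is)

  weight-∑ : ∀ b n (x : ℕ → I → ℕ) → (∀ a → a < n → weight (x a) ≤ b) → weight (λ i → ∑ n (λ a → x a i)) ≤ b ^ n
  weight-∑ b zero    x x≤ = ≤-reflexive weight-0
  weight-∑ b (suc n) x x≤ = ≤-trans (≤-reflexive (weight-+ (x 0) (λ i → ∑ n (λ a → x (suc a) i))))
    (*-mono-≤ (x≤ 0 z<s) (weight-∑ b n (x ∘ suc) (λ a a<n → x≤ (suc a) (s<s a<n))))

  weight-* : ∀ M x → weight (λ i → M * x i) ≡ weight x ^ M
  weight-* zero    x = weight-0
  weight-* (suc M) x = trans (weight-+ x (λ i → M * x i)) (cong (weight x *_) (weight-* M x))

product-map-upTo : ∀ n (g : ℕ → ℕ) → product (map g (upTo n)) ≡ ∏ n g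
product-map-upTo n g = go n id
  where
  go : ∀ n (h : ℕ → ℕ) → product (map g (applyUpTo h n)) ≡ ∏ n (g ∘ h)
  go zero    h = refl
  go (suc n) h = cong (g (h 0) *_) (go n (h ∘ suc))

product-cartesianProduct : ∀ {A B : Set} (g : A × B → ℕ) xs ys →
  product (map g (cartesianProduct xs ys)) ≡ product (map (λ x → product (map (λ y → g (x , y)) ys)) xs)
product-cartesianProduct g []       ys = refl
product-cartesianProduct g (x ∷ xs) ys = begin
  product (map g (map (x ,_) ys ++ cartesianProduct xs ys))
    ≡⟨ cong product (Listₚ.map-++ g (map (x ,_) ys) (cartesianProduct xs ys)) ⟩
  product (map g (map (x ,_) ys) ++ map g (cartesianProduct xs ys))
    ≡⟨ product-++ (map g (map (x ,_) ys)) _ ⟩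
  product (map g (map (x ,_) ys)) * product (map g (cartesianProduct xs ys))
    ≡⟨ cong₂ _*_ (cong product (sym (Listₚ.map-∘ ys))) (product-cartesianProduct g xs ys) ⟩
  product (map (λ y → g (x , y)) ys) * product (map (λ x → product (map (λ y → g (x , y)) ys)) xs) ∎
  where open ≡-Reasoning

-- Index set for the pairs of a prime p and a class x. Letting x run up to Y instead of p keeps it a
-- product; the extra classes are empty and have exponent 0.
square : ℕ → List (ℕ × ℕ)
square Y = cartesianProduct (upTo Y) (upTo Y)

square-unique : ∀ Y → Unique (square Y)
square-unique Y = Uniqueₚ.cartesianProduct⁺ (Uniqueₚ.upTo⁺ Y) (Uniqueₚ.upTo⁺ Y)

product-square : ∀ Y (g : ℕ × ℕ → ℕ) → product (map g (square Y)) ≡ ∏ Y (λ p → ∏ Y (λ x → g (p , x)))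
product-square Y g = trans (product-cartesianProduct g (upTo Y) (upTo Y))
  (trans (product-map-upTo Y (λ x → product (map (λ y → g (x , y)) (upTo Y)))) (∏-cong Y (λ p _ → product-map-upTo Y (λ x → g (p , x)))))

-- Derivative and discriminant

derivFrom : ℕ → Poly → Poly
derivFrom k []      = []
derivFrom k (a ∷ p) = pos k *ℤ a ∷ derivFrom (suc k) p

deriv : Poly → Poly
deriv []      = []
deriv (a ∷ p) = derivFrom 1 p

coeff-derivFrom : ∀ k p i → coeff (derivFrom k p) i ≡ pos (k + i) *ℤ coeff p i
coeff-derivFrom k []      i       = sym (ℤₚ.*-zeroʳ (pos (k + i)))
coeff-derivFrom k (a ∷ p) zero    = cong (λ j → pos j *ℤ a) (sym (+-identityʳ k))
coeff-derivFrom k (a ∷ p) (suc i) = trans (coeff-derivFrom (suc k) p i) (cong (λ j → pos j *ℤ coeff p i) (sym (+-suc k i)))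

coeff-deriv : ∀ p i → coeff (deriv p) i ≡ pos (suc i) *ℤ coeff p (suc i)
coeff-deriv []      i = sym (ℤₚ.*-zeroʳ (pos (suc i)))
coeff-deriv (a ∷ p) i = coeff-derivFrom 1 p i

eval-derivFrom-suc : ∀ k p x → eval (derivFrom (suc k) p) x ≡ eval p x +ℤ eval (derivFrom k p) x
eval-derivFrom-suc k []      x = refl
eval-derivFrom-suc k (a ∷ p) x rewrite eval-derivFrom-suc (suc k) p x | ℤₚ.pos-+ 1 k
  = regroup (pos k) a x (eval p x) (eval (derivFrom (suc k) p) x)
  where
  regroup : ∀ k a x P E → (1ℤ +ℤ k) *ℤ a +ℤ x *ℤ (P +ℤ E) ≡ (a +ℤ x *ℤ P) +ℤ (k *ℤ a +ℤ x *ℤ E)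
  regroup = ℤSolver.solve-∀

eval-deriv-∷ : ∀ a p x → eval (deriv (a ∷ p)) x ≡ eval p x +ℤ x *ℤ eval (deriv p) x
eval-deriv-∷ a p x = trans (eval-derivFrom-suc 0 p x) (cong (eval p x +ℤ_) (shift p))
  where
  shift : ∀ p → eval (derivFrom 0 p) x ≡ x *ℤ eval (deriv p) x
  shift []      = sym (ℤₚ.*-zeroʳ x)
  shift (b ∷ p) = ℤₚ.+-identityˡ (x *ℤ eval (derivFrom 1 p) x)

taylor : ∀ p x y → ∃[ s ] eval p y -ℤ eval p x ≡ (y -ℤ x) *ℤ (eval (deriv p) x +ℤ (y -ℤ x) *ℤ s)
taylor [] x y = 0ℤ , zeros (y -ℤ x)
  where
  zeros : ∀ h → 0ℤ -ℤ 0ℤ ≡ h *ℤ (0ℤ +ℤ h *ℤ 0ℤ)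
  zeros = ℤSolver.solve-∀
taylor (a ∷ p) x y with taylor p x y
... | s , eq = eval (deriv p) x +ℤ y *ℤ s , (begin
  (a +ℤ y *ℤ eval p y) -ℤ (a +ℤ x *ℤ eval p x)
    ≡⟨ r₁ a x y (eval p x) (eval p y) ⟩
  (y -ℤ x) *ℤ eval p x +ℤ y *ℤ (eval p y -ℤ eval p x)
    ≡⟨ cong (λ t → (y -ℤ x) *ℤ eval p x +ℤ y *ℤ t) eq ⟩
  (y -ℤ x) *ℤ eval p x +ℤ y *ℤ ((y -ℤ x) *ℤ (eval (deriv p) x +ℤ (y -ℤ x) *ℤ s))
    ≡⟨ r₂ x y (eval p x) (eval (deriv p) x) s ⟩
  (y -ℤ x) *ℤ ((eval p x +ℤ x *ℤ eval (deriv p) x) +ℤ (y -ℤ x) *ℤ (eval (deriv p) x +ℤ y *ℤ s))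
    ≡⟨ cong (λ t → (y -ℤ x) *ℤ (t +ℤ (y -ℤ x) *ℤ (eval (deriv p) x +ℤ y *ℤ s))) (sym (eval-deriv-∷ a p x)) ⟩
  (y -ℤ x) *ℤ (eval (deriv (a ∷ p)) x +ℤ (y -ℤ x) *ℤ (eval (deriv p) x +ℤ y *ℤ s)) ∎)
  where
  open ≡-Reasoning
  r₁ : ∀ a x y P Q → (a +ℤ y *ℤ Q) -ℤ (a +ℤ x *ℤ P) ≡ (y -ℤ x) *ℤ P +ℤ y *ℤ (Q -ℤ P)
  r₁ = ℤSolver.solve-∀
  r₂ : ∀ x y P D s → (y -ℤ x) *ℤ P +ℤ y *ℤ ((y -ℤ x) *ℤ (D +ℤ (y -ℤ x) *ℤ s))
                   ≡ (y -ℤ x) *ℤ ((P +ℤ x *ℤ D) +ℤ (y -ℤ x) *ℤ (D +ℤ y *ℤ s))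
  r₂ = ℤSolver.solve-∀

prime-coprime : ∀ {p b} → Prime p → ¬ p ∣ b → Coprime p b
prime-coprime p-prime p∤b (d∣p , d∣b) with prime⇒irreducible p-prime d∣p
... | inj₁ d≡1  = d≡1
... | inj₂ refl = contradiction d∣b p∤b

coprime-^ : ∀ {a b} k → Coprime a b → Coprime (a ^ k) b
coprime-^ {b = b} zero cop = 1-coprimeTo b
coprime-^ (suc k) cop = coprime-sym (coprime-* (coprime-sym cop) (coprime-sym (coprime-^ k cop)))

%≡⇒∣ : ∀ c .{{_ : NonZero c}} i j → i % c ≡ j % c → pos c ∣ℤ pos i -ℤ pos j
%≡⇒∣ c i j eq = divides (pos (i / c) -ℤ pos (j / c)) (begin
  pos i -ℤ pos j                                       ≡⟨ cong₂ (λ s t → pos s -ℤ pos t) (m≡m%n+[m/n]*n i c) (trans (m≡m%n+[m/n]*n j c) (cong (_+ (j / c) * c) (sym eq))) ⟩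
  pos (i % c + (i / c) * c) -ℤ pos (i % c + (j / c) * c) ≡⟨ cong₂ _-ℤ_ (split (i / c)) (split (j / c)) ⟩
  (pos (i % c) +ℤ pos (i / c) *ℤ pos c) -ℤ (pos (i % c) +ℤ pos (j / c) *ℤ pos c)
                                                       ≡⟨ regroup (pos (i % c)) (pos (i / c)) (pos (j / c)) (pos c) ⟩
  (pos (i / c) -ℤ pos (j / c)) *ℤ pos c                ∎)
  where
  open ≡-Reasoning
  split : ∀ a → pos (i % c + a * c) ≡ pos (i % c) +ℤ pos a *ℤ pos c
  split a = trans (ℤₚ.pos-+ (i % c) (a * c)) (cong (pos (i % c) +ℤ_) (ℤₚ.pos-* a c))
  regroup : ∀ s a b m → (s +ℤ a *ℤ m) -ℤ (s +ℤ b *ℤ m) ≡ (a -ℤ b) *ℤ m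
  regroup = ℤSolver.solve-∀

digits : (T k a : ℕ) .{{_ : NonZero T}} → Poly
digits T zero    a = []
digits T (suc k) a = pos (a % T) ∷ digits T k (a / T)

length-digits : ∀ T k a .{{_ : NonZero T}} → length (digits T k a) ≡ k
length-digits T zero    a = refl
length-digits T (suc k) a = cong suc (length-digits T k (a / T))

digits-coeff : ∀ T k a .{{_ : NonZero T}} i → ∃[ c ] (c ≤ T × coeff (digits T k a) i ≡ pos c)
digits-coeff T zero    a i       = 0 , z≤n , refl
digits-coeff T (suc k) a zero    = a % T , <⇒≤ (m%n<n a T) , refl
digits-coeff T (suc k) a (suc i) = digits-coeff T k (a / T) i

digits-injective : ∀ T k a b .{{_ : NonZero T}} → a < T ^ k → b < T ^ k → digits T k a ≈ₚ digits T k b → a ≡ b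
digits-injective T zero    a b a<1 b<1 eq = trans (n<1⇒n≡0 a<1) (sym (n<1⇒n≡0 b<1))
digits-injective T (suc k) a b a< b< eq = begin
  a                       ≡⟨ m≡m%n+[m/n]*n a T ⟩
  a % T + (a / T) * T     ≡⟨ cong₂ (λ r q → r + q * T) (ℤₚ.+-injective (eq 0))
                               (digits-injective T k (a / T) (b / T) (shrink a a<) (shrink b b<) (eq ∘ suc)) ⟩
  b % T + (b / T) * T     ≡⟨ sym (m≡m%n+[m/n]*n b T) ⟩
  b                       ∎
  where
  open ≡-Reasoning
  shrink : ∀ a → a < T ^ suc k → a / T < T ^ k
  shrink a a< = m<n*o⇒m/o<n (subst (a <_) (*-comm T (T ^ k)) a<)

length-+ₚ : ∀ p q → length p ≡ length q → length (p +ₚ q) ≡ length p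
length-+ₚ []      []      eq = refl
length-+ₚ (a ∷ p) (b ∷ q) eq = cong suc (length-+ₚ p q (suc-injective eq))

_-ₚ_ : Poly → Poly → Poly
p -ₚ q = p +ₚ scale -1ℤ q

coeff--ₚ : ∀ p q i → coeff (p -ₚ q) i ≡ coeff p i -ℤ coeff q i
coeff--ₚ p q i = trans (coeff-+ₚ p (scale -1ℤ q) i) (cong (coeff p i +ℤ_) (trans (coeff-scale -1ℤ q i) (ℤₚ.-1*i≡-i (coeff q i))))

eval--ₚ : ∀ p q x → eval (p -ₚ q) x ≡ eval p x -ℤ eval q x
eval--ₚ p q x = trans (eval-+ₚ p (scale -1ℤ q) x) (cong (eval p x +ℤ_) (trans (eval-scale -1ℤ q x) (ℤₚ.-1*i≡-i (eval q x))))

length--ₚ : ∀ p q → length p ≡ length q → length (p -ₚ q) ≡ length p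
length--ₚ p q eq = length-+ₚ p (scale -1ℤ q) (trans eq (sym (Listₚ.length-map (-1ℤ *ℤ_) q)))

module Discriminant (f : Poly) (n : ℕ) (lead : coeff f (suc n) ≡ 1ℤ)
                    (high : ∀ i → suc n < i → coeff f i ≡ 0ℤ) (f-irr : Irreducible f) (1≤n : 1 ≤ n) where

  open Residues f n lead high f-irr (height f) (∣coeff∣≤height f) public

  -- As f has degree at least 2, X - x is invertible modulo f up to some c ≠ 0; at a root x of f
  -- this relation would force c = 0.
  eval-f≢0 : ∀ x → eval f x ≢ 0ℤ
  eval-f≢0 x f≡0 with invert⁺ G G-supp (λ G≈0 → case-1≢0 (G≈0 1))
    where
    G : Poly
    G = -ℤ x ∷ 1ℤ ∷ []
    G-supp : Supported (coeff G)
    G-supp zero          ()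
    G-supp (suc zero)    (s≤s n≤0) = contradiction (≤-trans 1≤n n≤0) λ ()
    G-supp (suc (suc i)) _ = refl
    case-1≢0 : 1ℤ ≢ 0ℤ
    case-1≢0 ()
  ... | V , c , c≢0 , VG≡c = ≢-nonZero⁻¹ c {{c≢0}} (trans (sym (ℤₚ.∣-i∣≡∣i∣ (pos c))) (cong ∣_∣ -c≡0))
    where
    -c≡0 : -ℤ pos c ≡ 0ℤ
    -c≡0 = ℤ∣.0∣⇒≡0 (subst₂ _∣ℤ_ f≡0 (G-root (eval V x) x (pos c)) (invert-eval (-ℤ x ∷ 1ℤ ∷ []) V (pos c) VG≡c x))
      where
      G-root : ∀ v x c → v *ℤ (-ℤ x +ℤ x *ℤ (1ℤ +ℤ x *ℤ 0ℤ)) -ℤ c ≡ -ℤ c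
      G-root = ℤSolver.solve-∀

  abstract
    -- Separability: f′ has top coefficient n + 1 ≠ 0 and smaller degree than f.
    deriv-inverse : ∃[ V ] ∃[ D ] (NonZero D × act V (act (deriv f) e₀) ≗ λ i → pos D *ℤ e₀ i)
    deriv-inverse = invert⁺ (deriv f)
      (λ i n<i → trans (coeff-deriv f i) (trans (cong (pos (suc i) *ℤ_) (high (suc i) (s<s n<i))) (ℤₚ.*-zeroʳ (pos (suc i)))))
      (λ f′≈0 → top≢0 (trans (sym (coeff-deriv f n)) (f′≈0 n)))
      where
      top≢0 : pos (suc n) *ℤ coeff f (suc n) ≢ 0ℤ
      top≢0 eq with trans (sym (ℤₚ.*-identityʳ (pos (suc n)))) (trans (cong (pos (suc n) *ℤ_) (sym lead)) eq)
      ... | ()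

  V′ : Poly
  V′ = proj₁ deriv-inverse

  -- A nonzero integer in the ideal (f, f′), in the role of the discriminant.
  D : ℕ
  D = proj₁ (proj₂ deriv-inverse)

  D≢0 : NonZero D
  D≢0 = proj₁ (proj₂ (proj₂ deriv-inverse))

  -- Taylor's formula times `V′`, with V′(x) f′(x) replaced by `D`, which is legitimate modulo f(x).
  common-divisor : ∀ m x y → m ∣ℤ eval f x → m ∣ℤ eval f y → ∃[ z ] m ∣ℤ (y -ℤ x) *ℤ (pos D +ℤ (y -ℤ x) *ℤ z)
  common-divisor m x y m∣fx m∣fy with taylor f x y
  ... | s , eq = eval V′ x *ℤ s , subst (m ∣ℤ_) identity
    (ℤ∣.∣m∣n⇒∣m-n (ℤ∣.∣n⇒∣m*n (eval V′ x) (ℤ∣.∣m∣n⇒∣m-n m∣fy m∣fx))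
       (ℤ∣.∣n⇒∣m*n (y -ℤ x) (ℤ∣.∣-trans m∣fx (invert-eval (deriv f) V′ (pos D) (proj₂ (proj₂ (proj₂ deriv-inverse))) x))))
    where
    regroup : ∀ v h F s D → v *ℤ (h *ℤ (F +ℤ h *ℤ s)) -ℤ h *ℤ (v *ℤ F -ℤ D) ≡ h *ℤ (D +ℤ h *ℤ (v *ℤ s))
    regroup = ℤSolver.solve-∀
    identity : eval V′ x *ℤ (eval f y -ℤ eval f x) -ℤ (y -ℤ x) *ℤ (eval V′ x *ℤ eval (deriv f) x -ℤ pos D)
             ≡ (y -ℤ x) *ℤ (pos D +ℤ (y -ℤ x) *ℤ (eval V′ x *ℤ s))
    identity = trans (cong (λ t → eval V′ x *ℤ t -ℤ (y -ℤ x) *ℤ (eval V′ x *ℤ eval (deriv f) x -ℤ pos D)) eq)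
      (regroup (eval V′ x) (y -ℤ x) (eval (deriv f) x) s (pos D))

  -- Uniqueness in Hensel's lemma: the second factor in `common-divisor` is `D` modulo p, a unit, so
  -- the whole power of p falls to y - x.
  separation-good : ∀ p k x y → Prime p → ¬ p ∣ D → pos p ∣ℤ y -ℤ x →
                    pos (p ^ k) ∣ℤ eval f x → pos (p ^ k) ∣ℤ eval f y → p ^ k ∣ ∣ y -ℤ x ∣
  separation-good p k x y p-prime p∤D p∣y-x pᵏ∣fx pᵏ∣fy = divide (common-divisor (pos (p ^ k)) x y pᵏ∣fx pᵏ∣fy)
    where
    p∤ : ∀ z → ¬ p ∣ ∣ pos D +ℤ (y -ℤ x) *ℤ z ∣
    p∤ z p∣ = p∤D (ℤ∣.∣⇒∣ᵤ {pos p} {pos D} (ℤ∣.∣m+n∣n⇒∣m {m = pos D} (ℤ∣.∣ᵤ⇒∣ {pos p} {pos D +ℤ (y -ℤ x) *ℤ z} p∣) (ℤ∣.∣m⇒∣m*n z p∣y-x)))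
    divide : (∃[ z ] pos (p ^ k) ∣ℤ (y -ℤ x) *ℤ (pos D +ℤ (y -ℤ x) *ℤ z)) → p ^ k ∣ ∣ y -ℤ x ∣
    divide (z , pᵏ∣) = coprime-∣* (y -ℤ x) (pos D +ℤ (y -ℤ x) *ℤ z) (coprime-^ k (prime-coprime p-prime (p∤ z))) pᵏ∣

  -- If y ≡ x modulo D², the second factor in `common-divisor` is D (1 + D ...), whose bracket is a
  -- unit modulo p ∣ D. Only the factor `D` is lost; hence classes modulo D² for these primes.
  separation-bad : ∀ p k x y → Prime p → p ∣ D → pos (D * D) ∣ℤ y -ℤ x →
                   pos (p ^ k) ∣ℤ eval f x → pos (p ^ k) ∣ℤ eval f y → p ^ k ∣ D * ∣ y -ℤ x ∣
  separation-bad p k x y p-prime p∣D (divides t y-x≡) pᵏ∣fx pᵏ∣fy = divide (common-divisor (pos (p ^ k)) x y pᵏ∣fx pᵏ∣fy)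
    where
    regroup : ∀ h D t z → h *ℤ (D +ℤ (t *ℤ (D *ℤ D)) *ℤ z) ≡ (h *ℤ D) *ℤ (1ℤ +ℤ D *ℤ (t *ℤ z))
    regroup = ℤSolver.solve-∀
    factored : ∀ z → (y -ℤ x) *ℤ (pos D +ℤ (y -ℤ x) *ℤ z) ≡ ((y -ℤ x) *ℤ pos D) *ℤ (1ℤ +ℤ pos D *ℤ (t *ℤ z))
    factored z = trans (cong (λ h → (y -ℤ x) *ℤ (pos D +ℤ h *ℤ z)) (trans y-x≡ (cong (t *ℤ_) (ℤₚ.pos-* D D)))) (regroup (y -ℤ x) (pos D) t z)
    p∤ : ∀ z → ¬ p ∣ ∣ 1ℤ +ℤ pos D *ℤ (t *ℤ z) ∣
    p∤ z p∣ = ¬prime[1] (subst Prime (∣1⇒≡1 (ℤ∣.∣⇒∣ᵤ {pos p} {1ℤ} (ℤ∣.∣m+n∣n⇒∣m {m = 1ℤ} (ℤ∣.∣ᵤ⇒∣ {pos p} {1ℤ +ℤ pos D *ℤ (t *ℤ z)} p∣)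
      (ℤ∣.∣m⇒∣m*n (t *ℤ z) (ℤ∣.∣ᵤ⇒∣ {pos p} {pos D} p∣D))))) p-prime)
    divide : (∃[ z ] pos (p ^ k) ∣ℤ (y -ℤ x) *ℤ (pos D +ℤ (y -ℤ x) *ℤ z)) → p ^ k ∣ D * ∣ y -ℤ x ∣
    divide (z , pᵏ∣) = subst (p ^ k ∣_) (trans (ℤₚ.abs-* (y -ℤ x) (pos D)) (*-comm (∣ y -ℤ x ∣) D))
      (coprime-∣* ((y -ℤ x) *ℤ pos D) (1ℤ +ℤ pos D *ℤ (t *ℤ z)) (coprime-^ k (prime-coprime p-prime (p∤ z))) (subst (pos (p ^ k) ∣ℤ_) (factored z) pᵏ∣))

-- The product of f over an interval

∣⇒%≡ : ∀ c .{{_ : NonZero c}} i j → pos c ∣ℤ pos i -ℤ pos j → i % c ≡ j % c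
∣⇒%≡ c i j c∣ = ∣-diff⇒≡ (m%n<n i c) (m%n<n j c) (subst (c ∣_) (∣pos-pos∣ (i % c) (j % c)) (ℤ∣.∣⇒∣ᵤ
  (subst (pos c ∣ℤ_) (regroup (pos i) (pos j) (pos (i % c)) (pos (j % c)))
    (ℤ∣.∣m∣n⇒∣m+n (ℤ∣.∣m∣n⇒∣m-n c∣ (residue i)) (residue j)))))
  where
  regroup : ∀ i j r s → (i -ℤ j) -ℤ (i -ℤ r) +ℤ (j -ℤ s) ≡ r -ℤ s
  regroup = ℤSolver.solve-∀
  residue : ∀ i → pos c ∣ℤ pos i -ℤ pos (i % c)
  residue i = %≡⇒∣ c i (i % c) (sym (m%n%n≡m%n i c))

module Family (f : Poly) (n : ℕ) (lead : coeff f (suc n) ≡ 1ℤ)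
              (high : ∀ i → suc n < i → coeff f i ≡ 0ℤ) (f-irr : Irreducible f) (1≤n : 1 ≤ n)
              (N M : ℕ) (1≤M : 1 ≤ M) (N≤M : N ≤ M) where

  open Discriminant f n lead high f-irr 1≤n

  w : ℕ → ℤ
  w i = pos i -ℤ pos N

  F : ℕ → ℕ
  F i = ∣ eval f (w i) ∣

  F≢0 : ∀ i → NonZero (F i)
  F≢0 i = ≢-nonZero (eval-f≢0 (w i) ∘ ℤₚ.∣i∣≡0⇒i≡0)

  w-diff : ∀ i j → w i -ℤ w j ≡ pos i -ℤ pos j
  w-diff i j = cancel (pos i) (pos j) (pos N)
    where
    cancel : ∀ i j n → (i -ℤ n) -ℤ (j -ℤ n) ≡ i -ℤ j
    cancel = ℤSolver.solve-∀

  %≡⇒∣w : ∀ c .{{_ : NonZero c}} i j → i % c ≡ j % c → pos c ∣ℤ w i -ℤ w j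
  %≡⇒∣w c i j eq = subst (pos c ∣ℤ_) (sym (w-diff i j)) (%≡⇒∣ c i j eq)

  ∣F⇒ : ∀ {q} i → q ∣ F i → pos q ∣ℤ eval f (w i)
  ∣F⇒ i = ℤ∣.∣ᵤ⇒∣

  -- A common cutoff for primes, residues and valuations: no `F i` exceeds it.
  B : ℕ
  B = ∑ (suc M) F

  -- Two hits i < i′ give q ∣ E (i′ - i). `E` is 1 for the primes not dividing `D`, and `D` for the
  -- others.
  count-close : ∀ q E .{{_ : NonZero E}} j → q * count (suc M) (λ s → q ∣? E * ∣ w s -ℤ w j ∣) ≤ E * M + q
  count-close q E j = count-gap (λ s → q ∣? E * ∣ w s -ℤ w j ∣) q E gap M
    where
    ∣E∣ : ∀ s → ∣ pos E *ℤ (w s -ℤ w j) ∣ ≡ E * ∣ w s -ℤ w j ∣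
    ∣E∣ s = ℤₚ.abs-* (pos E) (w s -ℤ w j)
    gap : ∀ i i′ → q ∣ E * ∣ w i -ℤ w j ∣ → q ∣ E * ∣ w i′ -ℤ w j ∣ → i < i′ → q ≤ E * (i′ ∸ i)
    gap i i′ q∣i q∣i′ i<i′ = ∣⇒≤ {{m*n≢0 E (i′ ∸ i) {{it}} {{>-nonZero (m<n⇒0<n∸m i<i′)}}}} (subst (q ∣_) eq (ℤ∣.∣⇒∣ᵤ
      (ℤ∣.∣m∣n⇒∣m-n (ℤ∣.∣ᵤ⇒∣ {pos q} {pos E *ℤ (w i′ -ℤ w j)} (subst (q ∣_) (sym (∣E∣ i′)) q∣i′))
                    (ℤ∣.∣ᵤ⇒∣ {pos q} {pos E *ℤ (w i -ℤ w j)} (subst (q ∣_) (sym (∣E∣ i)) q∣i)))))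
      where
      regroup : ∀ e a b c n → e *ℤ ((b -ℤ n) -ℤ c) -ℤ e *ℤ ((a -ℤ n) -ℤ c) ≡ e *ℤ (b -ℤ a)
      regroup = ℤSolver.solve-∀
      eq : ∣ pos E *ℤ (w i′ -ℤ w j) -ℤ pos E *ℤ (w i -ℤ w j) ∣ ≡ E * (i′ ∸ i)
      eq = trans (cong ∣_∣ (regroup (pos E) (pos i) (pos i′) (w j) (pos N)))
        (trans (ℤₚ.abs-* (pos E) (pos i′ -ℤ pos i)) (cong (E *_) (cong ∣_∣ (trans (ℤₚ.[+m]-[+n]≡m⊖n i′ i) (ℤₚ.⊖-≥ (<⇒≤ i<i′))))))

  restricted-valuation∣ : ∀ {A : Set} (A? : Dec A) c .{{_ : NonZero c}} x p j →
                          p ^ restrict c x (λ i → valuation B A? p (F i)) j ∣ F j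
  restricted-valuation∣ A? c x p j = ∣-trans
    (^-monoʳ-∣ p (≤-trans (*-monoˡ-≤ (valuation B A? p (F j)) (ind≤1 (j % c ≟ x))) (≤-reflexive (*-identityˡ _))))
    (^valuation∣ B A? p (F j))

  -- By maximality of `j`, a power of p counted in `F i` also divides `F j`, so `close` applies and
  -- the integer `w j` stands in for the p-adic root.
  levels : ∀ {A : Set} (A? : Dec A) c .{{_ : NonZero c}} x p E j →
           (∀ i → i < suc M → restrict c x (λ i → valuation B A? p (F i)) i ≤ restrict c x (λ i → valuation B A? p (F i)) j) →
           (∀ i k → A → i % c ≡ j % c → p ^ suc k ∣ F j → p ^ suc k ∣ F i → p ^ suc k ∣ E * ∣ w i -ℤ w j ∣) →
           ∑ (suc M) (restrict c x (λ i → valuation B A? p (F i))) ≤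
           ∑ (restrict c x (λ i → valuation B A? p (F i)) j) (λ k → count (suc M) (λ i → p ^ suc k ∣? E * ∣ w i -ℤ w j ∣))
  levels A? c x p E j j-max close = ∑-≤-levels (λ i k → p ^ suc k ∣? E * ∣ w i -ℤ w j ∣) (suc M) _ _ j-max λ i k i<m k<u →
    let (i≡x , k<vi) = restrict-< c x v i k k<u
        (j≡x , k<vj) = restrict-< c x v j k (≤-trans k<u (j-max i i<m))
        (a , pᵏ∣i)   = valuation-holds B A? p (F i) k k<vi
        (_ , pᵏ∣j)   = valuation-holds B A? p (F j) k k<vj
    in close i k a (trans i≡x (sym j≡x)) pᵏ∣j pᵏ∣i
    where
    v : ℕ → ℕ
    v i = valuation B A? p (F i)

  -- Primes dividing D

  badBound : ℕ
  badBound = (evalBase f ^ suc M * D ^ (D * M)) ^ (D * D)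

  -- Since p ≤ D, even p^{O(M)} can be afforded. In each of the D² classes the largest valuation
  -- costs one value of f, and the remaining count is at most D · M.
  bad-prime-power : ∀ p → p ∣ D → p ^ ∑ (suc M) (λ i → valuation B (prime? p) p (F i)) ≤ badBound
  bad-prime-power p p∣D = begin
    p ^ ∑ (suc M) v                                   ≡⟨ cong (p ^_) (∑-restrict (suc M) c c v ≤-refl) ⟩
    p ^ ∑ c (λ x → ∑ (suc M) (restrict c x v))        ≡⟨ ^-∑ p c _ ⟩
    ∏ c (λ x → p ^ ∑ (suc M) (restrict c x v))        ≤⟨ ∏-mono c (λ x _ → class x) ⟩
    ∏ c (λ _ → evalBase f ^ suc M * D ^ (D * M))      ≡⟨ ∏-const c _ ⟩
    badBound                                          ∎
    where
    open ≤-Reasoning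
    c : ℕ
    c = D * D
    instance
      D-nonZero : NonZero D
      D-nonZero = D≢0
      c≢0 : NonZero c
      c≢0 = m*n≢0 D D
    p≤D : p ≤ D
    p≤D = ∣⇒≤ p∣D
    p≢0 : NonZero p
    p≢0 = ≢-nonZero (λ { refl → ≢-nonZero⁻¹ D (0∣⇒≡0 p∣D) })
    v : ℕ → ℕ
    v i = valuation B (prime? p) p (F i)
    class : ∀ x → p ^ ∑ (suc M) (restrict c x v) ≤ evalBase f ^ suc M * D ^ (D * M)
    class x with argmax M (restrict c x v)
    ... | j , j<m , j-max = begin
      p ^ ∑ (suc M) (restrict c x v)     ≤⟨ ^-monoʳ-≤ p {{p≢0}} (≤-trans (levels (prime? p) c x p D j j-max close) counts≤) ⟩
      p ^ (e + D * M)                    ≡⟨ ^-distribˡ-+-* p e (D * M) ⟩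
      p ^ e * p ^ (D * M)                ≤⟨ *-mono-≤ (≤-trans (∣⇒≤ {{F≢0 j}} (restricted-valuation∣ (prime? p) c x p j)) Fj≤) (^-monoˡ-≤ (D * M) p≤D) ⟩
      evalBase f ^ suc M * D ^ (D * M)   ∎
      where
      e : ℕ
      e = restrict c x v j
      C : ℕ → ℕ
      C k = count (suc M) (λ i → p ^ suc k ∣? D * ∣ w i -ℤ w j ∣)
      Fj≤ : F j ≤ evalBase f ^ suc M
      Fj≤ = ∣eval∣≤evalBase^ f (suc M) (w j) (s≤s z≤n)
        (≤-trans (≤-reflexive (∣pos-pos∣ j N)) (≤-trans (∣m-n∣≤m⊔n j N) (⊔-lub (<⇒≤ j<m) (m≤n⇒m≤1+n N≤M))))
      close : ∀ i k → Prime p → i % c ≡ j % c → p ^ suc k ∣ F j → p ^ suc k ∣ F i → p ^ suc k ∣ D * ∣ w i -ℤ w j ∣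
      close i k p-prime i≡j pᵏ∣j pᵏ∣i = separation-bad p (suc k) (w j) (w i) p-prime p∣D (%≡⇒∣w c i j i≡j) (∣F⇒ j pᵏ∣j) (∣F⇒ i pᵏ∣i)
      -- One point per level is charged to `e`; what remains decays geometrically because p ≥ 2.
      excess≤ : ∀ k → k < e → 2 ^ suc k * (C k ∸ 1) ≤ D * M
      excess≤ k k<e = begin
        2 ^ suc k * (C k ∸ 1)            ≤⟨ *-monoˡ-≤ (C k ∸ 1) (^-monoˡ-≤ (suc k) (nonTrivial⇒n>1 p {{prime⇒nonTrivial p-prime}})) ⟩
        p ^ suc k * (C k ∸ 1)            ≡⟨ *-distribˡ-∸ (p ^ suc k) (C k) 1 ⟩
        p ^ suc k * C k ∸ p ^ suc k * 1  ≡⟨ cong (p ^ suc k * C k ∸_) (*-identityʳ (p ^ suc k)) ⟩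
        p ^ suc k * C k ∸ p ^ suc k      ≤⟨ ∸-monoˡ-≤ (p ^ suc k) (count-close (p ^ suc k) D j) ⟩
        D * M + p ^ suc k ∸ p ^ suc k    ≡⟨ m+n∸n≡m (D * M) (p ^ suc k) ⟩
        D * M                            ∎
        where
        p-prime : Prime p
        p-prime = proj₁ (valuation-holds B (prime? p) p (F j) k (proj₂ (restrict-< c x v j k k<e)))
      counts≤ : ∑ e C ≤ e + D * M
      counts≤ = begin
        ∑ e C                            ≤⟨ ∑-mono e (λ k _ → m≤n+m∸n (C k) 1) ⟩
        ∑ e (λ k → 1 + (C k ∸ 1))        ≡⟨ ∑-+ e (λ _ → 1) (λ k → C k ∸ 1) ⟩
        ∑ e (λ _ → 1) + ∑ e (λ k → C k ∸ 1) ≤⟨ +-mono-≤ (≤-reflexive (trans (∑-const e 1) (*-identityʳ e))) (∑-geometric e (D * M) (λ k → C k ∸ 1) excess≤) ⟩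
        e + D * M                        ∎

  -- Root classes modulo primes not dividing D

  Good : ℕ → Set
  Good p = Prime p × ¬ p ∣ D

  good? : ∀ p → Dec (Good p)
  good? p = prime? p ×-dec ¬? (p ∣? D)

  -- The pair (p′ , x) stands for the residue class x modulo p = p′ + 1. Its representative is the i ≤ M
  -- in the class with the largest valuation of f(w i); the exponent is that valuation, or 0 if p is not good.
  base : ℕ × ℕ → ℕ
  base (p′ , x) = suc p′

  classValuation : ℕ × ℕ → ℕ → ℕ
  classValuation (p′ , x) = restrict (suc p′) x (λ i → valuation B (good? (suc p′)) (suc p′) (F i))

  rep : ℕ × ℕ → ℕ
  rep i = proj₁ (argmax M (classValuation i))

  rep≤M : ∀ i → rep i < suc M
  rep≤M i = proj₁ (proj₂ (argmax M (classValuation i)))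

  exponent : ℕ × ℕ → ℕ
  exponent i = classValuation i (rep i)

  exponent-max : ∀ i s → s < suc M → classValuation i s ≤ exponent i
  exponent-max i = proj₂ (proj₂ (argmax M (classValuation i)))

  base^exponent∣F : ∀ i → base i ^ exponent i ∣ F (rep i)
  base^exponent∣F (p′ , x) = restricted-valuation∣ (good? (suc p′)) (suc p′) x (suc p′) (rep (p′ , x))

  exponent>0 : ∀ p′ x → 0 < exponent (p′ , x) → Good (suc p′) × rep (p′ , x) % suc p′ ≡ x
  exponent>0 p′ x 0<e with restrict-< (suc p′) x (λ i → valuation B (good? (suc p′)) (suc p′) (F i)) (rep (p′ , x)) 0 0<e
  ... | rep≡x , 0<v = proj₁ (valuation-holds B (good? (suc p′)) (suc p′) (F (rep (p′ , x))) 0 0<v) , rep≡x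

  item : (ℕ × ℕ → ℕ) → ℕ × ℕ → ℕ × ℤ
  item g i = base i ^ g i , w (rep i)

  -- Different primes give coprime moduli; for one prime, representatives of different classes are
  -- incongruent modulo p. A general `g` serves for `exponent`, `small` and `depth` alike.
  item-apart : ∀ g → (∀ i → g i ≤ exponent i) → ∀ {i j} → i ≢ j → Apart (item g i) (item g j)
  item-apart g g≤e {p′ , x} {q′ , y} i≢j with g (p′ , x) in eqᵢ | g (q′ , y) in eqⱼ
  -- Exponent 0 means modulus 1. It must be split off, since only a positive exponent ensures a good
  -- prime and a representative in its class.
  ... | zero  | _     = inj₁ (1-coprimeTo _)
  ... | suc k | zero  = inj₁ (coprime-sym (1-coprimeTo _))
  ... | suc k | suc l with exponent>0 p′ x (≤-trans (s≤s z≤n) (≤-trans (≤-reflexive (sym eqᵢ)) (g≤e (p′ , x))))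
                         | exponent>0 q′ y (≤-trans (s≤s z≤n) (≤-trans (≤-reflexive (sym eqⱼ)) (g≤e (q′ , y))))
                         | p′ ≟ q′
  ...   | (p-prime , _) , rep≡x | (q-prime , _) , rep≡y | no p≢q = inj₁ (coprime-^ (suc k) (coprime-sym (coprime-^ (suc l)
            (prime-coprime q-prime q∤p))))
    where
    q∤p : ¬ suc q′ ∣ suc p′
    q∤p q∣p with prime⇒irreducible p-prime q∣p
    ... | inj₁ q≡1  = contradiction (subst Prime q≡1 q-prime) ¬prime[1]
    ... | inj₂ refl = p≢q refl
  ...   | (p-prime , _) , rep≡x | _ , rep≡y | yes refl = inj₂ (coprime-^ (suc k) (prime-coprime p-prime p∤))
    where
    p∤ : ¬ suc p′ ∣ ∣ w (rep (p′ , x)) -ℤ w (rep (p′ , y)) ∣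
    p∤ p∣ = i≢j (cong (p′ ,_) (trans (sym rep≡x) (trans (∣⇒%≡ (suc p′) (rep (p′ , x)) (rep (p′ , y))
      (subst (pos (suc p′) ∣ℤ_) (w-diff (rep (p′ , x)) (rep (p′ , y))) (ℤ∣.∣ᵤ⇒∣ {pos (suc p′)} {w (rep (p′ , x)) -ℤ w (rep (p′ , y))} p∣))) rep≡y)))

  items-apart : ∀ g → (∀ i → g i ≤ exponent i) → AllPairs (λ i j → Apart (item g i) (item g j)) (square B)
  items-apart g g≤e = AllPairs.map (item-apart g g≤e) (square-unique B)

  item∣f : ∀ g → (∀ i → g i ≤ exponent i) → ∀ i → pos (proj₁ (item g i)) ∣ℤ eval f (proj₂ (item g i))
  item∣f g g≤e i = ∣F⇒ (rep i) (∣-trans (^-monoʳ-∣ (base i) (g≤e i)) (base^exponent∣F i))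

  open Weights base (λ _ → s≤s z≤n) (square B)

  weight-exponent-≤ : ∀ L′ .{{_ : NonZero L′}} → (∀ i → i < suc M → F i ∣ L′) → weight exponent ≤ L′ ^ suc n
  weight-exponent-≤ L′ F∣L′ = product-≤-modulus (item exponent) (square B) (items-apart exponent (λ _ → ≤-refl))
    (item∣f exponent (λ _ → ≤-refl)) L′ (λ i → ∣-trans (base^exponent∣F i) (F∣L′ (rep i) (rep≤M i)))

  -- Counts the levels with pᵏ ≤ M, the ones at which the diagonal pairs are charged; the resulting
  -- power of p divides lcm(1, ..., M).
  small : ℕ × ℕ → ℕ
  small i = count (exponent i) (λ k → base i ^ suc k ≤? M)

  weight-small-≤ : weight small ≤ lcmUpTo M ^ suc n
  weight-small-≤ = product-≤-modulus (item small) (square B) (items-apart small small≤)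
    (item∣f small small≤) (lcmUpTo M) {{lcmUpTo-nonZero M}} small∣
    where
    small≤ : ∀ i → small i ≤ exponent i
    small≤ i = count≤n (exponent i) (λ k → base i ^ suc k ≤? M)
    small∣ : ∀ i → base i ^ small i ∣ lcmUpTo M
    small∣ i = count-elim (λ c → base i ^ c ∣ lcmUpTo M) (exponent i) (λ k → base i ^ suc k ≤? M)
      (λ k → ≤-trans (m≤n*m (base i ^ suc k) (base i))) (1∣ lcmUpTo M)
      (λ k → ∣lcmUpTo M (base i ^ suc k) (m^n>0 (base i) (suc k)))

  -- Collisions in a box of ℤ[X]/(f)

  module Box (T : ℕ) {{T≢0 : NonZero T}} (M≤T^d : M ≤ T ^ suc n) where

    -- Base-T digits enumerate the box [0, T)^{n + 1}; the indices below M stay distinct because M ≤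
    -- T^{n + 1}.
    α : ℕ → Poly
    α a = digits T (suc n) a

    γ : ℕ → ℕ → Poly
    γ a b = α a -ₚ α b

    length-α : ∀ a → length (α a) ≡ suc n
    length-α a = length-digits T (suc n) a

    length-γ : ∀ a b → length (γ a b) ≡ suc n
    length-γ a b = trans (length--ₚ (α a) (α b) (trans (length-α a) (sym (length-α b)))) (length-α a)

    γ≤T : ∀ a b i → ∣ coeff (γ a b) i ∣ ≤ T
    γ≤T a b i with digits-coeff T (suc n) a i | digits-coeff T (suc n) b i
    ... | s , s≤T , s≡ | t , t≤T , t≡ = begin
      ∣ coeff (γ a b) i ∣                   ≡⟨ cong ∣_∣ (trans (coeff--ₚ (α a) (α b) i) (cong₂ _-ℤ_ s≡ t≡)) ⟩
      ∣ pos s -ℤ pos t ∣                    ≡⟨ ∣pos-pos∣ s t ⟩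
      ∣ s - t ∣                             ≤⟨ ∣m-n∣≤m⊔n s t ⟩
      s ⊔ t                                 ≤⟨ ⊔-lub s≤T t≤T ⟩
      T                                     ∎
      where open ≤-Reasoning

    γ≉0 : ∀ a b → a < M → b < M → a ≢ b → ¬ IsZero (γ a b)
    γ≉0 a b a<M b<M a≢b γ≈0 = a≢b (digits-injective T (suc n) a b (≤-trans a<M M≤T^d) (≤-trans b<M M≤T^d)
      (λ i → ℤₚ.i-j≡0⇒i≡j (coeff (α a) i) (coeff (α b) i) (trans (sym (coeff--ₚ (α a) (α b) i)) (γ≈0 i))))

    -- The diagonal is excluded because there γ = 0 is divisible by everything and
    -- `product-≤-height` has no hold on it.
    γ-divisible? : ∀ a b i k → Dec (¬ a ≡ b × pos (base i ^ suc k) ∣ℤ eval (γ a b) (w (rep i)))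
    γ-divisible? a b i k = ¬? (a ≟ b) ×-dec (pos (base i ^ suc k) ∣ℤ? eval (γ a b) (w (rep i)))

    depth : ℕ → ℕ → ℕ × ℕ → ℕ
    depth a b i = count (exponent i) (γ-divisible? a b i)

    boxBound : ℕ
    boxBound = suc (2 * (growth (suc n) * T)) ^ suc n

    weight-depth-≤ : ∀ a b → a < M → b < M → weight (depth a b) ≤ boxBound
    weight-depth-≤ a b a<M b<M = by-cases (a ≟ b)
      where
      depth≤ : ∀ i → depth a b i ≤ exponent i
      depth≤ i = count≤n (exponent i) (γ-divisible? a b i)
      depth∣ : ∀ i → pos (base i ^ depth a b i) ∣ℤ eval (γ a b) (w (rep i))
      depth∣ i = count-elim (λ c → pos (base i ^ c) ∣ℤ eval (γ a b) (w (rep i))) (exponent i) (γ-divisible? a b i)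
        (λ k → λ { (a≢b , q∣) → a≢b , ℤ∣.∣-trans (ℤ∣.∣ᵤ⇒∣ (n∣m*n (base i))) q∣ })
        (ℤ∣.∣ᵤ⇒∣ (1∣ ∣ eval (γ a b) (w (rep i)) ∣)) (λ k → proj₂)
      by-cases : Dec (a ≡ b) → weight (depth a b) ≤ boxBound
      by-cases (yes a≡b) = ≤-trans (weight-mono {depth a b} {λ _ → 0} (λ i → ≤-reflexive
          (count-none (exponent i) (γ-divisible? a b i) (λ k → λ { (a≢b , _) → a≢b a≡b }))))
        (≤-trans (≤-reflexive weight-0) (m^n>0 (suc (2 * (growth (suc n) * T))) (suc n)))
      by-cases (no a≢b) = product-≤-height (item (depth a b)) (square B) (items-apart (depth a b) depth≤) (item∣f (depth a b) depth≤)
        T (γ a b) (length-γ a b) (γ≤T a b) (γ≉0 a b a<M b<M a≢b) depth∣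

    -- The factor `1 *` is E = 1 in `count-close` and `levels`.
    close : ℕ × ℕ → ℕ → ℕ
    close i k = count (suc M) (λ s → base i ^ suc k ∣? 1 * ∣ w s -ℤ w (rep i) ∣)

    pairs : ℕ × ℕ → ℕ → ℕ
    pairs i k = ∑ M (λ a → ∑ M (λ b → ind (γ-divisible? a b i k)))

    -- The M diagonal pairs are what costs the factor lcmUpTo M in the end.
    collisions-≤ : ∀ i k t → base i ^ suc k * t ≤ M → M * t ≤ M + pairs i k
    collisions-≤ i k t qt≤M = begin
      M * t                                                        ≤⟨ collisions-≥ M q t ρ (λ a → ℤᵈ.n%ℕd<d (eval (α a) r) q) qt≤M ⟩
      ∑ M (λ a → ∑ M (λ b → ind (ρ b ≟ ρ a)))                      ≤⟨ ∑-mono M (λ a a<M → each a a<M) ⟩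
      ∑ M (λ a → 1 + ∑ M (λ b → ind (γ-divisible? a b i k)))       ≡⟨ ∑-+ M (λ _ → 1) (λ a → ∑ M (λ b → ind (γ-divisible? a b i k))) ⟩
      ∑ M (λ _ → 1) + pairs i k                                    ≡⟨ cong (_+ pairs i k) (trans (∑-const M 1) (*-identityʳ M)) ⟩
      M + pairs i k                                                ∎
      where
      open ≤-Reasoning
      q : ℕ
      q = base i ^ suc k
      instance
        q≢0 : NonZero q
        q≢0 = m^n≢0 (base i) (suc k)
      r : ℤ
      r = w (rep i)
      ρ : ℕ → ℕ
      ρ a = eval (α a) r ℤᵈ.%ℕ q
      q∣γ : ∀ a b → ρ b ≡ ρ a → pos q ∣ℤ eval (γ a b) r
      q∣γ a b eq = divides (eval (α a) r ℤᵈ./ℕ q -ℤ eval (α b) r ℤᵈ./ℕ q) (trans (eval--ₚ (α a) (α b) r)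
        (trans (cong₂ _-ℤ_ (ℤᵈ.a≡a%ℕn+[a/ℕn]*n (eval (α a) r) q)
                           (trans (ℤᵈ.a≡a%ℕn+[a/ℕn]*n (eval (α b) r) q) (cong (λ s → pos s +ℤ (eval (α b) r ℤᵈ./ℕ q) *ℤ pos q) eq)))
               (regroup (pos (ρ a)) (eval (α a) r ℤᵈ./ℕ q) (eval (α b) r ℤᵈ./ℕ q) (pos q))))
        where
        regroup : ∀ s a b m → (s +ℤ a *ℤ m) -ℤ (s +ℤ b *ℤ m) ≡ (a -ℤ b) *ℤ m
        regroup = ℤSolver.solve-∀
      pair : ∀ a b → ind (ρ b ≟ ρ a) ≤ ind (a ≟ b) * 1 + ind (γ-divisible? a b i k)
      pair a b with a ≟ b
      ... | yes _   = ≤-trans (ind≤1 (ρ b ≟ ρ a)) (m≤m+n 1 _)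
      ... | no  a≢b = ind-mono (ρ b ≟ ρ a) (¬? (no a≢b) ×-dec (pos q ∣ℤ? eval (γ a b) r)) (λ eq → a≢b , q∣γ a b eq)
      each : ∀ a → a < M → ∑ M (λ b → ind (ρ b ≟ ρ a)) ≤ 1 + ∑ M (λ b → ind (γ-divisible? a b i k))
      each a a<M = ≤-trans (∑-mono M (λ b _ → pair a b)) (≤-reflexive
        (trans (∑-+ M (λ b → ind (a ≟ b) * 1) (λ b → ind (γ-divisible? a b i k)))
          (cong (_+ ∑ M (λ b → ind (γ-divisible? a b i k))) (∑-pick M a (λ _ → 1) a<M))))

    -- Spacing gives `close i k` ≤ 1 + t with q t ≤ M. The 1 yields the first M. If q ≤ M,
    -- `collisions-≤` bounds M t by the pairs and the M diagonal ones; otherwise t = 0.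
    close-≤ : ∀ i k → M * close i k ≤ M + (M * ind (base i ^ suc k ≤? M) + pairs i k)
    close-≤ i k = by-size (close i k) (base i ^ suc k ≤? M) (count-close (base i ^ suc k) 1 (rep i))
      where
      q : ℕ
      q = base i ^ suc k
      excess : ∀ t → q * suc t ≤ 1 * M + q → q * t ≤ M
      excess t le = +-cancelʳ-≤ q (q * t) M (≤-trans (≤-reflexive (trans (+-comm (q * t) q) (sym (*-suc q t))))
        (≤-trans le (≤-reflexive (cong (_+ q) (*-identityˡ M)))))
      by-size : ∀ c (q≤M? : Dec (q ≤ M)) → q * c ≤ 1 * M + q → M * c ≤ M + (M * ind q≤M? + pairs i k)
      by-size zero q≤M? _ = subst (_≤ M + (M * ind q≤M? + pairs i k)) (sym (*-zeroʳ M)) z≤n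
      by-size (suc t) (yes q≤M) le = begin
        M * suc t                    ≡⟨ *-suc M t ⟩
        M + M * t                    ≤⟨ +-monoʳ-≤ M (collisions-≤ i k t (excess t le)) ⟩
        M + (M + pairs i k)          ≡⟨ cong (λ s → M + (s + pairs i k)) (sym (*-identityʳ M)) ⟩
        M + (M * 1 + pairs i k)      ∎
        where open ≤-Reasoning
      by-size (suc zero) (no q≰M) le = subst (_≤ M + (M * 0 + pairs i k)) (sym (*-identityʳ M)) (m≤m+n M (M * 0 + pairs i k))
      by-size (suc (suc t)) (no q≰M) le = contradiction (≤-trans (m≤m*n q (suc t)) (excess (suc t) le)) q≰M

    total : ℕ × ℕ → ℕ
    total i = ∑ (exponent i) (close i)

    total-≤ : ∀ i → M * total i ≤ M * exponent i + (M * small i + ∑ M (λ a → ∑ M (λ b → depth a b i)))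
    total-≤ i = begin
      M * ∑ e (close i)                                  ≡⟨ sym (∑-* e M (close i)) ⟩
      ∑ e (λ k → M * close i k)                          ≤⟨ ∑-mono e (λ k _ → close-≤ i k) ⟩
      ∑ e (λ k → M + (M * ind (base i ^ suc k ≤? M) + pairs i k))
        ≡⟨ trans (∑-+ e (λ _ → M) _) (cong₂ _+_ (trans (∑-const e M) (*-comm e M)) (∑-+ e (λ k → M * ind (base i ^ suc k ≤? M)) (pairs i))) ⟩
      M * e + (∑ e (λ k → M * ind (base i ^ suc k ≤? M)) + ∑ e (pairs i))
        ≡⟨ cong (M * e +_) (cong₂ _+_ (∑-* e M (λ k → ind (base i ^ suc k ≤? M))) swapped) ⟩
      M * e + (M * small i + ∑ M (λ a → ∑ M (λ b → depth a b i))) ∎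
      where
      open ≤-Reasoning
      e : ℕ
      e = exponent i
      swapped : ∑ e (pairs i) ≡ ∑ M (λ a → ∑ M (λ b → depth a b i))
      swapped = trans (∑-swap e M (λ k a → ∑ M (λ b → ind (γ-divisible? a b i k))))
        (∑-cong M (λ a _ → ∑-swap e M (λ k b → ind (γ-divisible? a b i k))))

    -- An average over the box: after multiplication by M the M² differences weigh at most
    -- `boxBound` each, and the M-th root leaves `boxBound ^ M`.
    weight-total-≤ : ∀ L′ .{{_ : NonZero L′}} → (∀ i → i < suc M → F i ∣ L′) →
                     weight total ≤ L′ ^ suc n * (lcmUpTo M ^ suc n * boxBound ^ M)
    weight-total-≤ L′ F∣L′ = ^-cancelˡ-≤ M _ _ (>-nonZero 1≤M) (begin
      weight total ^ M                                    ≡⟨ sym (weight-* M total) ⟩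
      weight (λ i → M * total i)                          ≤⟨ weight-mono total-≤ ⟩
      weight (λ i → M * exponent i + (M * small i + ∑ M (λ a → ∑ M (λ b → depth a b i))))
        ≡⟨ trans (weight-+ (λ i → M * exponent i) _) (cong (weight (λ i → M * exponent i) *_) (weight-+ (λ i → M * small i) _)) ⟩
      weight (λ i → M * exponent i) * (weight (λ i → M * small i) * weight (λ i → ∑ M (λ a → ∑ M (λ b → depth a b i))))
        ≤⟨ *-mono-≤ (≤-trans (≤-reflexive (weight-* M exponent)) (^-monoˡ-≤ M (weight-exponent-≤ L′ F∣L′)))
             (*-mono-≤ (≤-trans (≤-reflexive (weight-* M small)) (^-monoˡ-≤ M weight-small-≤))
               (weight-∑ (boxBound ^ M) M (λ a i → ∑ M (λ b → depth a b i))
                 (λ a a<M → weight-∑ boxBound M (depth a) (λ b b<M → weight-depth-≤ a b a<M b<M)))) ⟩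
      (L′ ^ suc n) ^ M * ((lcmUpTo M ^ suc n) ^ M * (boxBound ^ M) ^ M)
        ≡⟨ sym (trans (^-distrib-* M (L′ ^ suc n) _) (cong ((L′ ^ suc n) ^ M *_) (^-distrib-* M (lcmUpTo M ^ suc n) (boxBound ^ M)))) ⟩
      (L′ ^ suc n * (lcmUpTo M ^ suc n * boxBound ^ M)) ^ M ∎)
      where open ≤-Reasoning

    class-≤ : ∀ p′ x → ∑ (suc M) (classValuation (p′ , x)) ≤ total (p′ , x)
    class-≤ p′ x = levels (good? (suc p′)) (suc p′) x (suc p′) 1 (rep (p′ , x)) (exponent-max (p′ , x)) λ i k good i≡ pᵏ∣j pᵏ∣i →
      subst (suc p′ ^ suc k ∣_) (sym (*-identityˡ _)) (separation-good (suc p′) (suc k) (w (rep (p′ , x))) (w i) (proj₁ good) (proj₂ good)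
        (%≡⇒∣w (suc p′) i (rep (p′ , x)) i≡) (∣F⇒ (rep (p′ , x)) pᵏ∣j) (∣F⇒ i pᵏ∣i))

    prime-part-≤ : ∀ p′ → p′ < B → suc p′ ^ ∑ (suc M) (λ i → valuation B (prime? (suc p′)) (suc p′) (F i))
                   ≤ badBound ^ ind (suc p′ ∣? D) * ∏ B (λ x → suc p′ ^ total (p′ , x))
    prime-part-≤ p′ p′<B = by-cases (p ∣? D)
      where
      open ≤-Reasoning
      p : ℕ
      p = suc p′
      by-cases : (p∣D? : Dec (p ∣ D)) → p ^ ∑ (suc M) (λ i → valuation B (prime? p) p (F i))
                 ≤ badBound ^ ind p∣D? * ∏ B (λ x → p ^ total (p′ , x))
      by-cases (yes p∣D) = begin
        p ^ ∑ (suc M) (λ i → valuation B (prime? p) p (F i))   ≤⟨ bad-prime-power p p∣D ⟩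
        badBound                                               ≡⟨ sym (trans (*-identityʳ _) (*-identityʳ badBound)) ⟩
        badBound ^ 1 * 1                                       ≤⟨ *-monoʳ-≤ (badBound ^ 1) (1≤∏ B (λ x → p ^ total (p′ , x)) (λ x _ → m^n>0 p (total (p′ , x)))) ⟩
        badBound ^ 1 * ∏ B (λ x → p ^ total (p′ , x))          ∎
      by-cases (no p∤D) = begin
        p ^ ∑ (suc M) (λ i → valuation B (prime? p) p (F i))   ≤⟨ ^-monoʳ-≤ p (∑-mono (suc M) (λ i _ → valuation-mono B (prime? p) (good? p) p (F i) (F i) (_, p∤D) ∣-refl)) ⟩
        p ^ ∑ (suc M) (λ i → valuation B (good? p) p (F i))    ≡⟨ cong (p ^_) (∑-restrict (suc M) B p (λ i → valuation B (good? p) p (F i)) p′<B) ⟩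
        p ^ ∑ B (λ x → ∑ (suc M) (classValuation (p′ , x)))    ≤⟨ ^-monoʳ-≤ p (∑-mono B (λ x _ → class-≤ p′ x)) ⟩
        p ^ ∑ B (λ x → total (p′ , x))                         ≡⟨ ^-∑ p B (λ x → total (p′ , x)) ⟩
        ∏ B (λ x → p ^ total (p′ , x))                         ≡⟨ sym (*-identityˡ _) ⟩
        badBound ^ 0 * ∏ B (λ x → p ^ total (p′ , x))          ∎

    badBound≥1 : 1 ≤ badBound
    badBound≥1 = 1≤^ (*-mono-≤ (≤-trans (>-nonZero⁻¹ (F 0) {{F≢0 0}}) (∣eval∣≤evalBase^ f (suc M) (w 0) (s≤s z≤n) ∣w0∣≤))
                               (1≤^ (>-nonZero⁻¹ D {{D≢0}}) (D * M))) (D * D)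
      where
      ∣w0∣≤ : ∣ w 0 ∣ ≤ suc M
      ∣w0∣≤ = ≤-trans (≤-reflexive (∣pos-pos∣ 0 N)) (m≤n⇒m≤1+n N≤M)

    product-F-≤ : ∀ L′ .{{_ : NonZero L′}} → (∀ i → i < suc M → F i ∣ L′) →
                  ∏ (suc M) F ≤ badBound ^ D * (L′ ^ suc n * (lcmUpTo M ^ suc n * boxBound ^ M))
    product-F-≤ L′ F∣L′ = begin
      ∏ (suc M) F
        ≤⟨ ∏-mono (suc M) (λ i i<m → n≤∏primePower B (F i) (F≢0 i) (∑-member (suc M) F i i<m)) ⟩
      ∏ (suc M) (λ i → ∏ B (primePower B (F i)))
        ≡⟨ ∏-swap (suc M) B (λ i → primePower B (F i)) ⟩
      ∏ B (λ p′ → ∏ (suc M) (λ i → primePower B (F i) p′))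
        ≡⟨ ∏-cong B (λ p′ _ → sym (^-∑ (suc p′) (suc M) (λ i → valuation B (prime? (suc p′)) (suc p′) (F i)))) ⟩
      ∏ B (λ p′ → suc p′ ^ ∑ (suc M) (λ i → valuation B (prime? (suc p′)) (suc p′) (F i)))
        ≤⟨ ∏-mono B prime-part-≤ ⟩
      ∏ B (λ p′ → badBound ^ ind (suc p′ ∣? D) * ∏ B (λ x → suc p′ ^ total (p′ , x)))
        ≡⟨ ∏-* B (λ p′ → badBound ^ ind (suc p′ ∣? D)) (λ p′ → ∏ B (λ x → suc p′ ^ total (p′ , x))) ⟩
      ∏ B (λ p′ → badBound ^ ind (suc p′ ∣? D)) * ∏ B (λ p′ → ∏ B (λ x → suc p′ ^ total (p′ , x)))
        ≡⟨ cong (∏ B (λ p′ → badBound ^ ind (suc p′ ∣? D)) *_) (sym (product-square B (λ i → base i ^ total i))) ⟩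
      ∏ B (λ p′ → badBound ^ ind (suc p′ ∣? D)) * weight total
        ≤⟨ *-mono-≤ (∏-few B D badBound _ badBound≥1 at-most one) (weight-total-≤ L′ F∣L′) ⟩
      badBound ^ D * (L′ ^ suc n * (lcmUpTo M ^ suc n * boxBound ^ M)) ∎
      where
      open ≤-Reasoning
      at-most : ∀ p′ → badBound ^ ind (suc p′ ∣? D) ≤ badBound
      at-most p′ = ≤-trans (^-monoʳ-≤ badBound {{>-nonZero badBound≥1}} (ind≤1 (suc p′ ∣? D))) (≤-reflexive (*-identityʳ badBound))
      one : ∀ p′ → D ≤ p′ → badBound ^ ind (suc p′ ∣? D) ≤ 1
      one p′ D≤p′ = ≤-reflexive (cong (badBound ^_) (ind-no (suc p′ ∣? D) (>⇒∤ {{D≢0}} (s≤s D≤p′))))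

-- Assembly of the constants

-- A general `s` with product N! covers both halves of the interval, i ↦ N - i and i ↦ i + 1.
lower-arithmetic : ∀ d N c s g → ∏ N s ≡ N ! → (∀ i → i < N → s i ^ d ≤ c * g i) → (N ^ d) ^ N ≤ (4 ^ d * c) ^ N * ∏ N g
lower-arithmetic d N c s g ∏s≡ each = begin
  (N ^ d) ^ N                              ≡⟨ ^-comm N d N ⟩
  (N ^ N) ^ d                              ≤⟨ ^-monoˡ-≤ d (n^n≤4^n*n! N) ⟩
  (4 ^ N * N !) ^ d                        ≡⟨ ^-distrib-* d (4 ^ N) (N !) ⟩
  (4 ^ N) ^ d * (N !) ^ d                  ≡⟨ cong₂ _*_ (^-comm 4 N d) (trans (cong (_^ d) (sym ∏s≡)) (sym (∏-^ N d s))) ⟩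
  (4 ^ d) ^ N * ∏ N (λ i → s i ^ d)        ≤⟨ *-monoʳ-≤ ((4 ^ d) ^ N) (∏-mono N each) ⟩
  (4 ^ d) ^ N * ∏ N (λ i → c * g i)        ≡⟨ cong ((4 ^ d) ^ N *_) (trans (∏-* N (λ _ → c) g) (cong (_* ∏ N g) (∏-const N c))) ⟩
  (4 ^ d) ^ N * (c ^ N * ∏ N g)            ≡⟨ sym (*-assoc ((4 ^ d) ^ N) (c ^ N) (∏ N g)) ⟩
  (4 ^ d) ^ N * c ^ N * ∏ N g              ≡⟨ cong (_* ∏ N g) (sym (^-distrib-* N (4 ^ d) c)) ⟩
  (4 ^ d * c) ^ N * ∏ N g                  ∎
  where open ≤-Reasoning

badConstant : ℕ → ℕ → ℕ
badConstant D E = ((suc E ^ 3 * D ^ (D * 2)) ^ (D * D)) ^ D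

bad-arithmetic : ∀ N D E → 1 ≤ N → ((E ^ suc (N + N) * D ^ (D * (N + N))) ^ (D * D)) ^ D ≤ badConstant D E ^ N
bad-arithmetic N D E 1≤N = begin
  ((E ^ suc (N + N) * D ^ (D * (N + N))) ^ (D * D)) ^ D ≤⟨ ^-monoˡ-≤ D (^-monoˡ-≤ (D * D) (*-mono-≤ E-part (≤-reflexive D-part))) ⟩
  (((suc E ^ 3) ^ N * (D ^ (D * 2)) ^ N) ^ (D * D)) ^ D ≡⟨ cong (λ k → (k ^ (D * D)) ^ D) (sym (^-distrib-* N (suc E ^ 3) (D ^ (D * 2)))) ⟩
  (((suc E ^ 3 * D ^ (D * 2)) ^ N) ^ (D * D)) ^ D       ≡⟨ cong (_^ D) (^-comm (suc E ^ 3 * D ^ (D * 2)) N (D * D)) ⟩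
  (((suc E ^ 3 * D ^ (D * 2)) ^ (D * D)) ^ N) ^ D       ≡⟨ ^-comm _ N D ⟩
  badConstant D E ^ N                                   ∎
  where
  open ≤-Reasoning
  triple : ∀ N → N + (N + N) ≡ 3 * N
  triple = ℕSolver.solve-∀
  E-part : E ^ suc (N + N) ≤ (suc E ^ 3) ^ N
  E-part = ≤-trans (^-monoˡ-≤ (suc (N + N)) (n≤1+n E)) (≤-trans (^-monoʳ-≤ (suc E) (+-monoˡ-≤ (N + N) 1≤N))
    (≤-reflexive (trans (cong (suc E ^_) (triple N)) (sym (^-*-assoc (suc E) 3 N)))))
  D-part : D ^ (D * (N + N)) ≡ (D ^ (D * 2)) ^ N
  D-part = trans (cong (D ^_) (double D N)) (sym (^-*-assoc D (D * 2) N))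
    where
    double : ∀ D N → D * (N + N) ≡ D * 2 * N
    double = ℕSolver.solve-∀

-- The factors come from 1 + 2gT ≤ (1 + 2g) T, from `root-bounds`, and from M = 2N.
boxConstant : ℕ → ℕ → ℕ
boxConstant d g = suc (2 * g) ^ d * 2 ^ d * 2

box-arithmetic : ∀ d N g T → 1 ≤ T → T ^ d ≤ 2 ^ d * (N + N) →
                 (suc (2 * (g * T)) ^ d) ^ (N + N) ≤ (boxConstant d g * boxConstant d g) ^ N * N ^ (N + N)
box-arithmetic d N g T 1≤T T^d≤ = ≤-trans (^-monoˡ-≤ (N + N) box)
  (≤-reflexive (trans (^-distrib-* (N + N) (boxConstant d g) N) (cong (_* N ^ (N + N)) (^-double (boxConstant d g) N))))
  where
  open ≤-Reasoning
  s : ℕ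
  s = suc (2 * g)
  side : suc (2 * (g * T)) ≤ s * T
  side = ≤-trans (+-monoˡ-≤ (2 * (g * T)) 1≤T) (≤-reflexive (cong (T +_) (sym (*-assoc 2 g T))))
  double : ∀ a b n → a * (b * (n + n)) ≡ a * b * 2 * n
  double = ℕSolver.solve-∀
  box : suc (2 * (g * T)) ^ d ≤ boxConstant d g * N
  box = begin
    suc (2 * (g * T)) ^ d            ≤⟨ ^-monoˡ-≤ d side ⟩
    (s * T) ^ d                      ≡⟨ ^-distrib-* d s T ⟩
    s ^ d * T ^ d                    ≤⟨ *-monoʳ-≤ (s ^ d) T^d≤ ⟩
    s ^ d * (2 ^ d * (N + N))        ≡⟨ double (s ^ d) (2 ^ d) N ⟩
    boxConstant d g * N              ∎

lcm-arithmetic : ∀ d N → lcmUpTo (N + N) ^ d ≤ (256 ^ d) ^ N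
lcm-arithmetic d N = ≤-trans (^-monoˡ-≤ d (lcmUpTo-≤ (N + N))) (≤-reflexive (trans (cong (_^ d) (^-double 16 N)) (^-comm 256 N d)))

upperConstant : ℕ → ℕ → ℕ → ℕ → ℕ → ℕ
upperConstant d D E g f₀ = badConstant D E * (f₀ ^ d * (256 ^ d * (boxConstant d g * boxConstant d g)))

upper-arithmetic : ∀ d N D E g T Λ f₀ → 1 ≤ N → 1 ≤ T → 1 ≤ f₀ → T ^ d ≤ 2 ^ d * (N + N) →
  ((E ^ suc (N + N) * D ^ (D * (N + N))) ^ (D * D)) ^ D
    * ((Λ * f₀) ^ d * (lcmUpTo (N + N) ^ d * (suc (2 * (g * T)) ^ d) ^ (N + N)))
  ≤ upperConstant d D E g f₀ ^ N * (Λ ^ d * N ^ (N + N))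
upper-arithmetic d N D E g T Λ f₀ 1≤N 1≤T 1≤f₀ T^d≤ = begin
  _ ≤⟨ *-mono-≤ (bad-arithmetic N D E 1≤N) (*-mono-≤ f₀-part (*-mono-≤ (lcm-arithmetic d N) (box-arithmetic d N g T 1≤T T^d≤))) ⟩
  K₁ ^ N * (Λ ^ d * K₂ ^ N * (K₃ ^ N * (K₄ ^ N * N ^ (N + N))))
    ≡⟨ regroup (K₁ ^ N) (Λ ^ d) (K₂ ^ N) (K₃ ^ N) (K₄ ^ N) (N ^ (N + N)) ⟩
  K₁ ^ N * (K₂ ^ N * (K₃ ^ N * K₄ ^ N)) * (Λ ^ d * N ^ (N + N))
    ≡⟨ cong (_* (Λ ^ d * N ^ (N + N))) (sym (merged K₁ K₂ K₃ K₄)) ⟩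
  upperConstant d D E g f₀ ^ N * (Λ ^ d * N ^ (N + N)) ∎
  where
  open ≤-Reasoning
  K₁ K₂ K₃ K₄ : ℕ
  K₁ = badConstant D E
  K₂ = f₀ ^ d
  K₃ = 256 ^ d
  K₄ = boxConstant d g * boxConstant d g
  regroup : ∀ a l b c e m → a * (l * b * (c * (e * m))) ≡ a * (b * (c * e)) * (l * m)
  regroup = ℕSolver.solve-∀
  merged : ∀ a b c e → (a * (b * (c * e))) ^ N ≡ a ^ N * (b ^ N * (c ^ N * e ^ N))
  merged a b c e = trans (^-distrib-* N a _) (cong (a ^ N *_) (trans (^-distrib-* N b _) (cong (b ^ N *_) (^-distrib-* N c e))))
  f₀-part : (Λ * f₀) ^ d ≤ Λ ^ d * K₂ ^ N
  f₀-part = ≤-trans (≤-reflexive (^-distrib-* d Λ f₀)) (*-monoʳ-≤ (Λ ^ d) (b≤b^n K₂ N (1≤^ 1≤f₀ d) 1≤N))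

-- The factor N^{2N} from the box is cancelled against the N^{2dN} from the values.
combine-bounds : ∀ d e N Λ P K₁ K₂ → 1 ≤ N → e + (N + N) ≡ d * N + d * N → (N ^ d) ^ N * (N ^ d) ^ N ≤ K₁ ^ N * P →
                 P ≤ K₂ ^ N * (Λ ^ d * N ^ (N + N)) → N ^ e ≤ Λ ^ d * (K₁ * K₂) ^ N
combine-bounds d e N Λ P K₁ K₂ 1≤N split lower upper = *-cancelʳ-≤ _ _ (N ^ (N + N)) {{m^n≢0 N (N + N) {{>-nonZero 1≤N}}}} (begin
  N ^ e * N ^ (N + N)                                ≡⟨ sym (^-distribˡ-+-* N e (N + N)) ⟩
  N ^ (e + (N + N))                                  ≡⟨ cong (N ^_) split ⟩
  N ^ (d * N + d * N)                                ≡⟨ ^-distribˡ-+-* N (d * N) (d * N) ⟩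
  N ^ (d * N) * N ^ (d * N)                          ≡⟨ cong₂ _*_ (sym (^-*-assoc N d N)) (sym (^-*-assoc N d N)) ⟩
  (N ^ d) ^ N * (N ^ d) ^ N                          ≤⟨ lower ⟩
  K₁ ^ N * P                                         ≤⟨ *-monoʳ-≤ (K₁ ^ N) upper ⟩
  K₁ ^ N * (K₂ ^ N * (Λ ^ d * N ^ (N + N)))          ≡⟨ regroup (K₁ ^ N) (K₂ ^ N) (Λ ^ d) (N ^ (N + N)) ⟩
  Λ ^ d * (K₁ ^ N * K₂ ^ N) * N ^ (N + N)            ≡⟨ cong (λ k → Λ ^ d * k * N ^ (N + N)) (sym (^-distrib-* N K₁ K₂)) ⟩
  Λ ^ d * (K₁ * K₂) ^ N * N ^ (N + N)                ∎)
  where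
  open ≤-Reasoning
  regroup : ∀ a b l m → a * (b * (l * m)) ≡ l * (a * b) * m
  regroup = ℕSolver.solve-∀

∈⇒∣lcms : ∀ {x xs} → x ∈ xs → x ∣ foldr lcm 1 xs
∈⇒∣lcms {xs = y ∷ xs} (here refl) = m∣lcm[m,n] y (foldr lcm 1 xs)
∈⇒∣lcms {xs = y ∷ xs} (there x∈) = ∣-trans (∈⇒∣lcms x∈) (n∣lcm[m,n] y (foldr lcm 1 xs))

lcms-nonZero : ∀ (g : ℕ → ℕ) is → (∀ i → NonZero (g i)) → NonZero (foldr lcm 1 (map g is))
lcms-nonZero g []       g≢0 = _
lcms-nonZero g (i ∷ is) g≢0 = lcm-nonZero (g i) _ (g≢0 i) (lcms-nonZero g is g≢0)

coeff-lead : ∀ p → coeff (p ++ [ 1ℤ ]) (length p) ≡ 1ℤ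
coeff-lead []      = refl
coeff-lead (a ∷ p) = coeff-lead p

-- Even f on the interval [-N, N]

module EvenCase (p : Poly) (n : ℕ) (1≤n : 1 ≤ n) (length-p : length p ≡ suc n)
                (f-irr : Irreducible (p ++ [ 1ℤ ])) (f-even : ∀ x → eval (p ++ [ 1ℤ ]) (-ℤ x) ≡ eval (p ++ [ 1ℤ ]) x) where

  f : Poly
  f = p ++ [ 1ℤ ]

  d : ℕ
  d = suc n

  lead : coeff f d ≡ 1ℤ
  lead = subst (λ k → coeff f k ≡ 1ℤ) length-p (coeff-lead p)

  high : ∀ i → d < i → coeff f i ≡ 0ℤ
  high i d<i = coeff-beyond f i (≤-trans (≤-reflexive (trans (Listₚ.length-++ p) (trans (+-comm (length p) 1) (cong suc length-p)))) d<i)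

  open Discriminant f n lead high f-irr 1≤n using (growth; D; D≢0; eval-f≢0)

  ∣f∣ : ℤ → ℕ
  ∣f∣ x = ∣ eval f x ∣

  ∣f∣≢0 : ∀ x → NonZero (∣f∣ x)
  ∣f∣≢0 x = ≢-nonZero (eval-f≢0 x ∘ ℤₚ.∣i∣≡0⇒i≡0)

  monicConstant : ℕ → ℕ
  monicConstant k = 2 + (2 * height p) ^ k

  c₁ c₂ : ℕ
  c₁ = 4 ^ d * monicConstant d
  c₂ = upperConstant d D (evalBase f) (growth d) (∣f∣ 0ℤ)

  module _ (N : ℕ) (1≤N : 1 ≤ N) where

    M : ℕ
    M = N + N

    1≤M : 1 ≤ M
    1≤M = ≤-trans 1≤N (m≤m+n N N)

    open Family f n lead high f-irr 1≤n N M 1≤M (m≤m+n N N) using (w; F; badBound; module Box)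

    -- Evenness enters here: a negative argument repeats the value at a positive one.
    F-below : ∀ i → i ≤ N → F i ≡ ∣f∣ (pos (N ∸ i))
    F-below i i≤N = cong ∣_∣ (trans (cong (eval f) (trans (ℤₚ.[+m]-[+n]≡m⊖n i N) (ℤₚ.⊖-≤ i≤N))) (f-even (pos (N ∸ i))))

    F-above : ∀ t → F (N + t) ≡ ∣f∣ (pos t)
    F-above t = cong ∣f∣ (trans (cong (_-ℤ pos N) (ℤₚ.pos-+ N t)) (cancel (pos N) (pos t)))
      where
      cancel : ∀ a b → a +ℤ b -ℤ a ≡ b
      cancel = ℤSolver.solve-∀

    -- `L` starts at f(1), but the interval also contains 0.
    L′ : ℕ
    L′ = L f N * ∣f∣ 0ℤ

    L′≢0 : NonZero L′
    L′≢0 = m*n≢0 _ _ {{lcms-nonZero (λ i → ∣f∣ (pos (suc i))) (upTo N) (λ i → ∣f∣≢0 (pos (suc i)))}} {{∣f∣≢0 0ℤ}}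

    ∣L′ : ∀ t → t ≤ N → ∣f∣ (pos t) ∣ L′
    ∣L′ zero    t≤N = n∣m*n (L f N)
    ∣L′ (suc t) t<N = ∣m⇒∣m*n (∣f∣ 0ℤ) (∈⇒∣lcms (∈-map⁺ (λ i → ∣f∣ (pos (suc i))) (∈-upTo⁺ t<N)))

    F∣L′ : ∀ i → i < suc M → F i ∣ L′
    F∣L′ i (s≤s i≤M) with i ≤? N
    ... | yes i≤N = subst (_∣ L′) (sym (F-below i i≤N)) (∣L′ (N ∸ i) (m∸n≤m N i))
    ... | no  i≰N with m≤n⇒∃[o]m+o≡n (<⇒≤ (≰⇒> i≰N))
    ...   | t , refl = subst (_∣ L′) (sym (F-above t)) (∣L′ t (+-cancelˡ-≤ N t N i≤M))

    half-lower : ∀ (s g : ℕ → ℕ) → ∏ N s ≡ N ! → (∀ i → i < N → 1 ≤ s i × g i ≡ ∣f∣ (pos (s i))) → (N ^ d) ^ N ≤ c₁ ^ N * ∏ N g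
    half-lower s g ∏s≡ s-g = lower-arithmetic d N (monicConstant d) s g ∏s≡ (λ i i<N → each i (s-g i i<N))
      where
      each : ∀ i → 1 ≤ s i × g i ≡ ∣f∣ (pos (s i)) → s i ^ d ≤ monicConstant d * g i
      each i (1≤s , g≡) = subst₂ (λ k y → s i ^ k ≤ monicConstant k * y) length-p (sym g≡)
        (monic-lower-bound p (s i) 1≤s (>-nonZero⁻¹ _ {{∣f∣≢0 (pos (s i))}}))

    lower : (N ^ d) ^ N * (N ^ d) ^ N ≤ (c₁ * c₁) ^ N * ∏ (suc M) F
    lower = begin
      (N ^ d) ^ N * (N ^ d) ^ N                ≤⟨ *-mono-≤ (half-lower (λ i → N ∸ i) F (∏-∸≡! N) (λ i i<N → m<n⇒0<n∸m i<N , F-below i (<⇒≤ i<N)))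
                                                    (half-lower suc (λ i → F (N + suc i)) (∏-suc≡! N) (λ i _ → s≤s z≤n , F-above (suc i))) ⟩
      c₁ ^ N * P₁ * (c₁ ^ N * P₂)              ≡⟨ regroup (c₁ ^ N) P₁ P₂ ⟩
      -- The middle value |f(0)| ≥ 1 belongs to neither half.
      c₁ ^ N * c₁ ^ N * (P₁ * P₂)              ≤⟨ *-monoʳ-≤ (c₁ ^ N * c₁ ^ N) (*-monoʳ-≤ P₁ (m≤n*m P₂ (F (N + 0)) {{∣f∣≢0 (w (N + 0))}})) ⟩
      c₁ ^ N * c₁ ^ N * (P₁ * (F (N + 0) * P₂)) ≡⟨ cong₂ _*_ (sym (^-distrib-* N c₁ c₁)) (sym (trans (cong (λ k → ∏ k F) (sym (+-suc N N))) (∏-append N (suc N) F))) ⟩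
      (c₁ * c₁) ^ N * ∏ (suc M) F              ∎
      where
      open ≤-Reasoning
      P₁ P₂ : ℕ
      P₁ = ∏ N F
      P₂ = ∏ N (λ i → F (N + suc i))
      regroup : ∀ c x y → c * x * (c * y) ≡ c * c * (x * y)
      regroup = ℕSolver.solve-∀

    upper : ∏ (suc M) F ≤ c₂ ^ N * (L f N ^ d * N ^ (N + N))
    upper = let (T , 1≤T , M≤T^d , T^d≤) = root-bounds n M 1≤M in ≤-trans (Box.product-F-≤ T {{>-nonZero 1≤T}} M≤T^d L′ {{L′≢0}} F∣L′)
      (upper-arithmetic d N D (evalBase f) (growth d) T (L f N) (∣f∣ 0ℤ) 1≤N 1≤T (>-nonZero⁻¹ (∣f∣ 0ℤ) {{∣f∣≢0 0ℤ}}) T^d≤)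

    bound : N ^ (2 * n * N) ≤ L f N ^ d * (c₁ * c₁ * c₂) ^ N
    bound = combine-bounds d (2 * n * N) N (L f N) (∏ (suc M) F) (c₁ * c₁) c₂ 1≤N (split n N) lower upper
      where
      split : ∀ n N → 2 * n * N + (N + N) ≡ suc n * N + suc n * N
      split = ℕSolver.solve-∀

-- Exponentiated form: logarithms and division by `d` give the inequality with any positive C ≥ (log
-- K) / d.
theorem1p2 : ∀ (d : ℕ) → 2 ≤ d → (a : Vec ℤ d)
    → Irreducible (monic a) → IsEven (monic a)
    → ∃[ K ] (∀ (N : ℕ) → 2 ≤ N
    → N ^ (2 * (d ∸ 1) * N) ≤ (L (monic a) N) ^ d * K ^ N)
theorem1p2 (suc n) (s≤s 1≤n) a a-irr a-even = c₁ * c₁ * c₂ , λ N 2≤N → bound N (≤-trans (s≤s z≤n) 2≤N)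
  where
  open EvenCase (toList a) n 1≤n (Vecₚ.length-toList a) a-irr
    (λ x → trans (sym (eval-negX (monic a) x)) (eval-≈ (negX (monic a)) (monic a) x a-even))
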